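{- Let $G$ be an abelian group. Let $n\geq s_2\geq s_1$ be integers with $s_1=\Omega(s_2)$, and let $m$ be an integer satisfying $s_1+s_2\leq m = o\big(s_2^2(\log s_2)^{ -4}(\log n)^{ -3}\big)$. Then for any $F_1,F_2\subset G$ with $|F_1|=|F_2|=n$, the number of pairs of sets $(X_1,X_2)$ with $X_1\subset F_1$, $X_2\subset F_2$, $|X_i|=s_i$ and $|X_1+X_2|\leq m$ is at most \[2^{o(s_2)}\binom{\frac{s_1}{s_1+s_2}(m+\beta)}{s_1}\binom{\frac{s_2}{s_1+s_2}(m+\beta)}{s_2},\] where $\beta = \beta((1+o(1))m)$.
   Context: For an abelian group $G$ and a positive real $t$, $\beta(t) = \max\{|H| : H \text{ a subgroup of } G,\ |H|\leq t\}$. $X_1+X_2=\{x_1+x_2:x_i\in X_i\}$. Binomial coefficients with non-integer upper argument are the generalized ones, $\binom{x}{k}=x(x-1)\cdots(x-k+1)/k!$. Asymptotic notation refers to $n\to\infty$ with $s_1,s_2,m$ depending on $n$. -}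

module Defs where

open import Level using (_⊔_)
open import Algebra.Bundles using (AbelianGroup)
open import Data.Nat as ℕ using (ℕ; zero; suc; _+_; _*_; _^_)
open import Data.Nat.Logarithm using (⌊log₂_⌋)
open import Data.Fin using (Fin)
open import Data.Fin.Subset using (Subset; _∈_; ∣_∣)
open import Data.Product using (Σ; ∃; _×_; _,_)
open import Data.List using (List; length)
open import Data.List.Relation.Unary.All using (All)
open import Data.List.Relation.Unary.Unique.Propositional using (Unique)
open import Data.Integer using (+_)
open import Data.Rational as ℚ using (ℚ)
open import Relation.Binary.PropositionalEquality using (_≡_)

ℕtoℚ : ℕ → ℚ
ℕtoℚ a = (+ a) ℚ./ 1

-- a / b as a rational (convention: a / 0 = 0; only used with b ≥ 1)
ratio : ℕ → ℕ → ℚ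
ratio a zero    = ℚ.0ℚ
ratio a (suc b) = (+ a) ℚ./ suc b

genBin : ℚ → ℕ → ℚ
genBin x zero    = ℚ.1ℚ
genBin x (suc k) = genBin x k ℚ.* (x ℚ.- ℕtoℚ k) ℚ.* ((+ 1) ℚ./ suc k)

IsLittleO : (ℕ → ℕ) → (ℕ → ℕ) → Set
IsLittleO f g = ∀ j → ∃ λ N → ∀ n → N ℕ.≤ n → j * f n ℕ.≤ g n

IsBigOmega : (ℕ → ℕ) → (ℕ → ℕ) → Set
IsBigOmega f g = ∃ λ K → ∃ λ N → ∀ n → N ℕ.≤ n → g n ℕ.≤ K * f n

TendsToZero : (ℕ → ℚ) → Set
TendsToZero δ = ∀ j → ∃ λ N → ∀ n → N ℕ.≤ n → ℚ.∣ δ n ∣ ℚ.≤ ((+ 1) ℚ./ suc j)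

CountAtMost : ∀ {a p} {A : Set a} → (A → Set p) → ℚ → Set (a ⊔ p)
CountAtMost {A = A} P B = (L : List A) → Unique L → All P L → ℕtoℚ (length L) ℚ.≤ B

module _ {c ℓ} (G : AbelianGroup c ℓ) where
  open AbelianGroup G

  -- an enumeration Fin n → G without repetitions, i.e. an n-element subset of G
  InjectiveEnum : ∀ {n} → (Fin n → Carrier) → Set ℓ
  InjectiveEnum f = ∀ i j → f i ≈ f j → i ≡ j

  HasSubgroupOfSize : ℕ → Set (c ⊔ ℓ)
  HasSubgroupOfSize k =
    Σ (Fin k → Carrier) λ h →
      InjectiveEnum h
      × (∃ λ i → h i ≈ ε)
      × (∀ i j → ∃ λ l → (h i ∙ h j) ≈ h l)
      × (∀ i → ∃ λ l → (h i ⁻¹) ≈ h l)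

  IsBeta : ℚ → ℕ → Set (c ⊔ ℓ)
  IsBeta t b =
    (HasSubgroupOfSize b × ℕtoℚ b ℚ.≤ t)
    × (∀ k → HasSubgroupOfSize k → ℕtoℚ k ℚ.≤ t → k ℕ.≤ b)

  -- |X₁ + X₂| ≤ m, where Xᵢ ⊆ Fᵢ given by index sets: X₁+X₂ is covered by m elements
  SumsetAtMost : ∀ {n} → (Fin n → Carrier) → (Fin n → Carrier) →
                 Subset n → Subset n → ℕ → Set (c ⊔ ℓ)
  SumsetAtMost F₁ F₂ X₁ X₂ m =
    Σ (Fin m → Carrier) λ v →
      ∀ i j → i ∈ X₁ → j ∈ X₂ → ∃ λ k → (F₁ i ∙ F₂ j) ≈ v k

  GoodPair : ∀ {n} → (Fin n → Carrier) → (Fin n → Carrier) → ℕ → ℕ → ℕ →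
             Subset n × Subset n → Set (c ⊔ ℓ)
  GoodPair F₁ F₂ s₁ s₂ m (X₁ , X₂) =
    ∣ X₁ ∣ ≡ s₁ × ∣ X₂ ∣ ≡ s₂ × SumsetAtMost F₁ F₂ X₁ X₂ m

{-# OPTIONS --safe #-}

-- Greedy choices produce T₁ ⊆ X₁ and T₂ ⊆ X₂ of size o(s₂ / log n) such that C = T₁ + T₂ contains almost all
-- of x + X₂ for every x ∈ X₁ ∖ T₁: first T₁ makes most sums popular, then T₂ hits every popular sum. The graph
-- container algorithm for the pairs with sum outside C yields 2^o(s₂) pairs (A₁ , A₂) that contain (X₁ , X₂) up to
-- few elements and have almost all sums in C, where |C| ≤ m. Pollard's theorem, in a form valid in every abelian
-- group, then gives |A₁| + |A₂| ≤ (1 + o(1)) (m + β): in its proof by e-transforms, a pair that no e-transform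
-- changes consists of a union of cosets of a subgroup H and a subset of a coset of H. Finally, for given
-- |A₁| + |A₂|, the number of pairs of subsets of sizes s₁, s₂ is largest when |A₁| : |A₂| = s₁ : s₂.

module Submission where

open import Defs
open import Level using (_⊔_)
import Level
open import Algebra.Bundles using (AbelianGroup)
open import Algebra.Properties.CommutativeSemigroup using (x∙yz≈y∙xz; interchange)
open import Data.Bool as Bool using (Bool; true; false; not; _∧_; _∨_)
open import Data.Empty using (⊥-elim)
open import Data.Fin as Fin using (Fin; zero; suc)
import Data.Fin.Properties as Finₚ
open import Data.Fin.Subset using (Subset; ∣_∣)
import Data.Integer as ℤ
import Data.Integer.Properties as ℤₚ
open import Data.List using (List; []; _∷_; _++_; map; length; filter; lookup; allFin; tabulate; concatMap)
open import Data.List.Properties using (length-++; length-map; length-filter; length-tabulate)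
open import Data.List.Membership.Propositional using (_∈_; _∉_; find; lose)
open import Data.List.Membership.Propositional.Properties using (∈-lookup; ∈-length; ∈-allFin; ∈-tabulate⁺; ∈-map⁺; ∈-map⁻; ∈-++⁺ˡ; ∈-++⁺ʳ; ∈-concatMap⁺; ∈-concatMap⁻; ∈-filter⁺; ∈-filter⁻)
open import Data.List.Relation.Unary.All as All using (All; []; _∷_)
import Data.List.Relation.Unary.All.Properties as Allₚ
open import Data.List.Relation.Unary.AllPairs using ([]; _∷_)
open import Data.List.Relation.Unary.Any as Any using (Any; here; there; any?)
import Data.List.Relation.Unary.Any.Properties as Anyₚ
open import Data.List.Relation.Unary.Unique.Propositional using (Unique)
open import Data.Nat as ℕ using (ℕ; zero; suc; pred; _+_; _*_; _∸_; _^_; _!; _⊓_; _/_; _%_; _≤_; _<_; z≤n; s≤s; _≤?_; _<?_; NonZero; >-nonZero; >-nonZero⁻¹)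
open import Data.Nat.DivMod using (m≡m%n+[m/n]*n; m%n<n; m/n*n≤m; m*n/n≡m; /-monoˡ-≤)
open import Data.Nat.Induction using (<-rec)
open import Data.Nat.Logarithm using (⌊log₂_⌋; ⌊log₂⌋-mono-≤; ⌊log₂[2^n]⌋≡n)
open import Data.Nat.Properties
open import Data.Nat.Solver using (module +-*-Solver)
open import Data.Nat.Tactic.RingSolver using (solve-∀)
open import Data.Product using (∃; Σ; _×_; _,_; proj₁; proj₂)
open import Data.Rational as ℚ using (ℚ; 1ℚ; fromℚᵘ; Positive)
import Data.Rational.Properties as ℚₚ
import Data.Rational.Solver as ℚSolver
open import Data.Rational.Unnormalised as ℚᵘ using (mkℚᵘ; *≡*; *≤*)
import Data.Rational.Unnormalised.Properties as ℚᵘₚ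
open import Data.Sum using (_⊎_; inj₁; inj₂)
open import Data.Unit using (⊤)
open import Data.Vec as Vec using ([]; _∷_)
open import Data.Vec.Properties using (lookup⇒[]=)
open import Function using (_∘_; id)
open import Relation.Binary using (tri<; tri≈; tri>)
open import Relation.Binary.PropositionalEquality using (_≡_; _≢_; refl; sym; trans; cong; cong₂; subst; subst₂; module ≡-Reasoning)
open import Relation.Nullary using (¬_; Dec; yes; no; does)
open import Relation.Nullary.Decidable using (True; toWitness; map′; ¬?; _×-dec_; decidable-stable; ¬¬-excluded-middle)
open import Relation.Unary using (Decidable)

-- Finite sums

-- The graph that drives the container algorithm must be known before the algorithm starts, whereas
-- `X₁ + X₂` is not; the sample solves this, since `T₁` and `T₂` determine `C` and cost only
-- `n ^ o(s₂ / log n) = 2 ^ o(s₂)` choices. The algorithm runs below one vertex `x₀` of `X₁`, its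
-- second side being the at most `m` indices whose sum with `x₀` lies in `C`. Thus an element lost
-- in a step is chosen among `m` indices instead of `n` and costs `O(log s₂)` bits, because
-- `m ≤ s₂ ^ 2`. All `o(1)` terms are governed by one integer `v`. The finite part holds for every
-- admissible `v`, with errors given by explicit powers of `v`; the asymptotic part takes the
-- greatest admissible `v` up to `n`, which tends to infinity. Equality in `G` is not assumed
-- decidable, although stabilisers and e-transforms of finite sets require it. The proof passes to
-- the subgroup generated by `F₁` and `F₂`, where equality is decidable up to double negation; this
-- suffices for an inequality between rationals.

*-rotate : ∀ x y z → x * (y * z) ≡ y * (x * z)
*-rotate = x∙yz≈y∙xz *-commutativeSemigroup

*-interchange : ∀ x y z w → x * y * (z * w) ≡ x * z * (y * w)
*-interchange = interchange *-commutativeSemigroup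

∑ : ∀ {a} {A : Set a} → List A → (A → ℕ) → ℕ
∑ []       f = 0
∑ (x ∷ xs) f = f x + ∑ xs f

𝟙 : Bool → ℕ
𝟙 true  = 1
𝟙 false = 0

𝟙≤1 : ∀ b → 𝟙 b ≤ 1
𝟙≤1 true  = ≤-refl
𝟙≤1 false = z≤n

𝟙-pos : ∀ {b} → 1 ≤ 𝟙 b → b ≡ true
𝟙-pos {true} _ = refl

𝟙? : ∀ {p} {P : Set p} → Dec P → ℕ
𝟙? P? = 𝟙 (does P?)

𝟙?-yes : ∀ {p} {P : Set p} (P? : Dec P) → P → 𝟙? P? ≡ 1
𝟙?-yes (yes _) _ = refl
𝟙?-yes (no ¬p) p = ⊥-elim (¬p p)

𝟙?-no : ∀ {p} {P : Set p} (P? : Dec P) → ¬ P → 𝟙? P? ≡ 0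
𝟙?-no (yes p) ¬p = ⊥-elim (¬p p)
𝟙?-no (no _)  _  = refl

𝟙?-pos : ∀ {p} {P : Set p} (P? : Dec P) → 1 ≤ 𝟙? P? → P
𝟙?-pos (yes p) _ = p

𝟙?-mono : ∀ {p q} {P : Set p} {Q : Set q} (P? : Dec P) (Q? : Dec Q) → (P → Q) → 𝟙? P? ≤ 𝟙? Q?
𝟙?-mono (yes p) Q? f = ≤-reflexive (sym (𝟙?-yes Q? (f p)))
𝟙?-mono (no _)  Q? f = z≤n

𝟙?-cong : ∀ {p q} {P : Set p} {Q : Set q} (P? : Dec P) (Q? : Dec Q) → (P → Q) → (Q → P) → 𝟙? P? ≡ 𝟙? Q?
𝟙?-cong P? Q? f g = ≤-antisym (𝟙?-mono P? Q? f) (𝟙?-mono Q? P? g)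

module _ {a} {A : Set a} where

  ∑-mono∈ : ∀ (xs : List A) {f g} → (∀ x → x ∈ xs → f x ≤ g x) → ∑ xs f ≤ ∑ xs g
  ∑-mono∈ []       h = z≤n
  ∑-mono∈ (x ∷ xs) h = +-mono-≤ (h x (here refl)) (∑-mono∈ xs (λ y y∈ → h y (there y∈)))

  ∑-mono : ∀ (xs : List A) {f g} → (∀ x → f x ≤ g x) → ∑ xs f ≤ ∑ xs g
  ∑-mono xs h = ∑-mono∈ xs (λ x _ → h x)

  ∑-cong∈ : ∀ (xs : List A) {f g} → (∀ x → x ∈ xs → f x ≡ g x) → ∑ xs f ≡ ∑ xs g
  ∑-cong∈ []       h = refl
  ∑-cong∈ (x ∷ xs) h = cong₂ _+_ (h x (here refl)) (∑-cong∈ xs (λ y y∈ → h y (there y∈)))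

  ∑-cong : ∀ (xs : List A) {f g} → (∀ x → f x ≡ g x) → ∑ xs f ≡ ∑ xs g
  ∑-cong xs h = ∑-cong∈ xs (λ x _ → h x)

  ∑-zero : ∀ (xs : List A) → ∑ xs (λ _ → 0) ≡ 0
  ∑-zero []       = refl
  ∑-zero (x ∷ xs) = ∑-zero xs

  ∑-+ : ∀ (xs : List A) f g → ∑ xs (λ x → f x + g x) ≡ ∑ xs f + ∑ xs g
  ∑-+ []       f g = refl
  ∑-+ (x ∷ xs) f g = trans (cong (f x + g x +_) (∑-+ xs f g)) (interchange +-commutativeSemigroup (f x) (g x) (∑ xs f) (∑ xs g))

  ∑-*ˡ : ∀ (xs : List A) k f → ∑ xs (λ x → k * f x) ≡ k * ∑ xs f
  ∑-*ˡ []       k f = sym (*-zeroʳ k)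
  ∑-*ˡ (x ∷ xs) k f = trans (cong (k * f x +_) (∑-*ˡ xs k f)) (sym (*-distribˡ-+ k (f x) _))

  ∑-*ʳ : ∀ (xs : List A) k f → ∑ xs (λ x → f x * k) ≡ ∑ xs f * k
  ∑-*ʳ xs k f = trans (∑-cong xs (λ x → *-comm (f x) k)) (trans (∑-*ˡ xs k f) (*-comm k _))

  ∑-const : ∀ (xs : List A) k → ∑ xs (λ _ → k) ≡ length xs * k
  ∑-const []       k = refl
  ∑-const (x ∷ xs) k = cong (k +_) (∑-const xs k)

  ∑-1 : ∀ (xs : List A) → ∑ xs (λ _ → 1) ≡ length xs
  ∑-1 xs = trans (∑-const xs 1) (*-identityʳ _)

  ∑-++ : ∀ (xs ys : List A) f → ∑ (xs ++ ys) f ≡ ∑ xs f + ∑ ys f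
  ∑-++ []       ys f = refl
  ∑-++ (x ∷ xs) ys f = trans (cong (f x +_) (∑-++ xs ys f)) (sym (+-assoc (f x) _ _))

  ∑-filter : ∀ {p} {P : A → Set p} (P? : Decidable P) (xs : List A) f →
             ∑ (filter P? xs) f ≡ ∑ xs (λ x → 𝟙? (P? x) * f x)
  ∑-filter P? []       f = refl
  ∑-filter P? (x ∷ xs) f with P? x
  ... | yes _ = cong₂ _+_ (sym (+-identityʳ (f x))) (∑-filter P? xs f)
  ... | no  _ = ∑-filter P? xs f

  ∑-split : ∀ {p} {P : A → Set p} (P? : Decidable P) (xs : List A) f →
            ∑ xs f ≡ ∑ (filter P? xs) f + ∑ (filter (¬? ∘ P?) xs) f
  ∑-split P? xs f = begin
    ∑ xs f
      ≡⟨ ∑-cong xs (λ x → pointwise x) ⟩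
    ∑ xs (λ x → 𝟙? (P? x) * f x + 𝟙? (¬? (P? x)) * f x)
      ≡⟨ ∑-+ xs _ _ ⟩
    ∑ xs (λ x → 𝟙? (P? x) * f x) + ∑ xs (λ x → 𝟙? (¬? (P? x)) * f x)
      ≡⟨ sym (cong₂ _+_ (∑-filter P? xs f) (∑-filter (¬? ∘ P?) xs f)) ⟩
    ∑ (filter P? xs) f + ∑ (filter (¬? ∘ P?) xs) f ∎
    where
    open ≡-Reasoning
    pointwise : ∀ x → f x ≡ 𝟙? (P? x) * f x + 𝟙? (¬? (P? x)) * f x
    pointwise x with P? x
    ... | yes _ = sym (trans (+-identityʳ _) (+-identityʳ _))
    ... | no  _ = sym (+-identityʳ _)

  ∑-term : ∀ {xs : List A} {x} f → x ∈ xs → f x ≤ ∑ xs f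
  ∑-term f (here refl) = m≤m+n _ _
  ∑-term f (there x∈)  = ≤-trans (∑-term f x∈) (m≤n+m _ _)

  ∑-pos : ∀ (xs : List A) f → 1 ≤ ∑ xs f → ∃ λ x → x ∈ xs × 1 ≤ f x
  ∑-pos (x ∷ xs) f h with f x in eq
  ... | suc _ = x , here refl , subst (1 ≤_) (sym eq) (s≤s z≤n)
  ... | zero with ∑-pos xs f h
  ...   | y , y∈ , p = y , there y∈ , p

  ∑-pick : ∀ (xs : List A) f g → 1 ≤ length xs → ∑ xs f ≤ ∑ xs g → ∃ λ x → x ∈ xs × f x ≤ g x
  ∑-pick (x ∷ xs) f g _ h with f x ≤? g x
  ... | yes p = x , here refl , p
  ∑-pick (x ∷ [])     f g _ h | no ¬p = ⊥-elim (¬p (+-cancelʳ-≤ 0 _ _ h))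
  ∑-pick (x ∷ y ∷ xs) f g _ h | no ¬p
    with ∑-pick (y ∷ xs) f g (s≤s z≤n)
           (+-cancelˡ-≤ (g x) _ _ (≤-trans (+-monoˡ-≤ _ (<⇒≤ (≰⇒> ¬p))) h))
  ... | z , z∈ , q = z , there z∈ , q

module _ {a b} {A : Set a} {B : Set b} where

  ∑-map : ∀ (g : A → B) (xs : List A) f → ∑ (map g xs) f ≡ ∑ xs (f ∘ g)
  ∑-map g []       f = refl
  ∑-map g (x ∷ xs) f = cong (f (g x) +_) (∑-map g xs f)

  ∑-swap : ∀ (xs : List A) (ys : List B) (f : A → B → ℕ) →
           ∑ xs (λ x → ∑ ys (f x)) ≡ ∑ ys (λ y → ∑ xs (λ x → f x y))
  ∑-swap []       ys f = sym (∑-zero ys)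
  ∑-swap (x ∷ xs) ys f = trans (cong (∑ ys (f x) +_) (∑-swap xs ys f)) (sym (∑-+ ys (f x) _))

  length-concatMap : ∀ (f : A → List B) (xs : List A) → length (concatMap f xs) ≡ ∑ xs (length ∘ f)
  length-concatMap f []       = refl
  length-concatMap f (x ∷ xs) = trans (length-++ (f x)) (cong (length (f x) +_) (length-concatMap f xs))

∑-tabulate : ∀ {a} {A : Set a} {n} (g : Fin n → A) f → ∑ (tabulate g) f ≡ ∑ (allFin n) (f ∘ g)
∑-tabulate {n = zero}  g f = refl
∑-tabulate {n = suc n} g f =
  cong (f (g zero) +_) (trans (∑-tabulate (g ∘ suc) f) (sym (∑-tabulate suc (f ∘ g))))

∑-allFin-suc : ∀ {n} (f : Fin (suc n) → ℕ) → ∑ (allFin (suc n)) f ≡ f zero + ∑ (allFin n) (f ∘ suc)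
∑-allFin-suc f = cong (f zero +_) (∑-tabulate suc f)

∑-single : ∀ {n} (j : Fin n) (f : Fin n → ℕ) → ∑ (allFin n) (λ i → 𝟙? (j Fin.≟ i) * f i) ≡ f j
∑-single {suc n} zero f = begin
  ∑ (allFin (suc n)) (λ i → 𝟙? (zero Fin.≟ i) * f i) ≡⟨ ∑-allFin-suc (λ i → 𝟙? (zero Fin.≟ i) * f i) ⟩
  f zero + 0 + ∑ (allFin n) (λ _ → 0) ≡⟨ cong (f zero + 0 +_) (∑-zero (allFin n)) ⟩
  f zero + 0 + 0 ≡⟨ trans (+-identityʳ _) (+-identityʳ _) ⟩
  f zero ∎
  where open ≡-Reasoning
∑-single {suc n} (suc j) f = begin
  ∑ (allFin (suc n)) (λ i → 𝟙? (suc j Fin.≟ i) * f i)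
    ≡⟨ ∑-allFin-suc (λ i → 𝟙? (suc j Fin.≟ i) * f i) ⟩
  ∑ (allFin n) (λ i → 𝟙? (suc j Fin.≟ suc i) * f (suc i))
    ≡⟨ ∑-cong (allFin n) (λ i → cong (_* f (suc i)) (𝟙?-cong (suc j Fin.≟ suc i) (j Fin.≟ i) Finₚ.suc-injective (cong suc))) ⟩
  ∑ (allFin n) (λ i → 𝟙? (j Fin.≟ i) * f (suc i))
    ≡⟨ ∑-single j (f ∘ suc) ⟩
  f (suc j) ∎
  where open ≡-Reasoning

-- Pollard's theorem in abelian groups

length-union : ∀ {a b i a′ b′ u} → a ≡ i + a′ → b ≡ i + b′ → u ≡ a + b′ → a + b ≡ u + i
length-union {i = i} {a′} {b′} refl refl refl = lemma i a′ b′
  where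
  lemma : ∀ i a b → i + a + (i + b) ≡ i + a + b + i
  lemma = solve-∀

-- If `r(x)` is the number of representations of `x` as a sum, then the sum of `min(t, r(x))` is at
-- most `t * m + E` when `m` sums are allowed and `E` pairs have another sum. Pollard's lower bound
-- for this sum becomes the second alternative; the first records that a subgroup with more than `K`
-- elements occurred.
PollardBound : (m K β t a b E : ℕ) → Set
PollardBound m K β t a b E = t * K ≤ t * m + E ⊎ t * (a + b) ≤ t * m + E + t * t + t * β

module _ {m K β : ℕ} where

  -- The case in which the intersection still has `t` elements: union and intersection have the same
  -- total size as the old pair, and their error is part of the old one.
  bound-enlarge : ∀ {t a b u i E E₁ E₂} → a + b ≡ u + i → E ≡ E₁ + E₂ →
            PollardBound m K β t u i E₁ → PollardBound m K β t a b E
  bound-enlarge {t} ab refl (inj₁ p) = inj₁ (≤-trans p (+-monoʳ-≤ (t * m) (m≤m+n _ _)))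
  bound-enlarge {t} ab refl (inj₂ p) =
    inj₂ (≤-trans (≤-reflexive (cong (t *_) ab)) (≤-trans p (+-monoˡ-≤ (t * β) (+-monoˡ-≤ (t * t) (+-monoʳ-≤ (t * m) (m≤m+n _ _))))))

  -- The case of a small intersection, with `i` elements: union and intersection satisfy the trivial
  -- bound `low` with `i` in place of `t`, the complementary pair satisfies the bound for
  -- `t′ = t − i`, and the two are added.
  bound-split : ∀ {t i t′ a b a′ b′ u E E₁ E₂} → t ≡ i + t′ → a ≡ i + a′ → b ≡ i + b′ → u ≡ a + b′ → E ≡ E₁ + E₂ →
          i ≤ t → i * u ≤ i * m + E₁ → PollardBound m K β t′ a′ b′ E₂ → PollardBound m K β t a b E
  bound-split {i = i} {t′} {a′ = a′} {b′} {E₁ = E₁} {E₂} refl refl refl refl refl i≤t low = cases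
    where
    open ≤-Reasoning
    t = i + t′
    u = i + a′ + b′
    regroup : ∀ x y p q k → x * k + p + (y * k + q) ≡ (x + y) * k + (p + q)
    regroup = solve-∀
    both : ∀ k → i * k ≤ i * m + E₁ → t′ * k ≤ t′ * m + E₂ → t * k ≤ t * m + (E₁ + E₂)
    both k p q = begin
      t * k ≡⟨ *-distribʳ-+ k i t′ ⟩
      i * k + t′ * k ≤⟨ +-mono-≤ p q ⟩
      i * m + E₁ + (t′ * m + E₂) ≡⟨ regroup i t′ E₁ E₂ m ⟩
      t * m + (E₁ + E₂) ∎
    cases : PollardBound m K β t′ a′ b′ E₂ → PollardBound m K β t (i + a′) (i + b′) (E₁ + E₂)
    cases (inj₁ p) with K ≤? u
    ... | yes K≤u = inj₁ (both K (≤-trans (*-monoʳ-≤ i K≤u) low) p)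
    -- Now `u < K`, so the alternative for `t′` bounds `t′ * u` too; `a + b` exceeds `u` only by
    -- `i ≤ t`, which `t * t` covers.
    ... | no  K≰u = inj₂ (begin
      t * (i + a′ + (i + b′)) ≡⟨ shape t i a′ b′ ⟩
      t * u + t * i ≤⟨ +-mono-≤ (both u low (≤-trans (*-monoʳ-≤ t′ (<⇒≤ (≰⇒> K≰u))) p)) (*-monoʳ-≤ t i≤t) ⟩
      t * m + (E₁ + E₂) + t * t ≤⟨ m≤m+n _ _ ⟩
      t * m + (E₁ + E₂) + t * t + t * β ∎)
      where
      shape : ∀ t i a b → t * (i + a + (i + b)) ≡ t * (i + a + b) + t * i
      shape = solve-∀
    -- The overlap contributes `i * i + 2 * (i * t′)`, which completes `t′ * t′` to `t * t`.
    cases (inj₂ p) = inj₂ (begin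
      t * (i + a′ + (i + b′))
        ≡⟨ expand i t′ a′ b′ ⟩
      i * u + t′ * (a′ + b′) + (i * i + 2 * (i * t′))
        ≤⟨ +-monoˡ-≤ (i * i + 2 * (i * t′)) (+-mono-≤ low p) ⟩
      i * m + E₁ + (t′ * m + E₂ + t′ * t′ + t′ * β) + (i * i + 2 * (i * t′))
        ≡⟨ collect i t′ m E₁ E₂ (t′ * β) ⟩
      t * m + (E₁ + E₂) + t * t + t′ * β
        ≤⟨ +-monoʳ-≤ (t * m + (E₁ + E₂) + t * t) (*-monoˡ-≤ β (m≤n+m t′ i)) ⟩
      t * m + (E₁ + E₂) + t * t + t * β ∎)
      where
      expand : ∀ i t x y → (i + t) * (i + x + (i + y)) ≡ i * (i + x + y) + t * (x + y) + (i * i + 2 * (i * t))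
      expand = solve-∀
      collect : ∀ i t m x y z → i * m + x + (t * m + y + t * t + z) + (i * i + 2 * (i * t)) ≡ (i + t) * m + (x + y) + (i + t) * (i + t) + z
      collect = solve-∀

module DecidableGroup {c ℓ} (G : AbelianGroup c ℓ)
                      (_≟_ : ∀ x y → Dec (AbelianGroup._≈_ G x y)) where
  open AbelianGroup G using (Carrier; _≈_; _∙_; _⁻¹; ∙-congˡ; ∙-congʳ; assoc; comm; identityʳ; inverseˡ; inverseʳ; reflexive) renaming (refl to ≈-refl; sym to ≈-sym; trans to ≈-trans)

  cancel-right : ∀ x e → (x ∙ e) ∙ e ⁻¹ ≈ x
  cancel-right x e = ≈-trans (assoc x e (e ⁻¹)) (≈-trans (∙-congˡ (inverseʳ e)) (identityʳ x))

  cancel-right′ : ∀ x e → (x ∙ e ⁻¹) ∙ e ≈ x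
  cancel-right′ x e = ≈-trans (assoc x (e ⁻¹) e) (≈-trans (∙-congˡ (inverseˡ e)) (identityʳ x))

  δ : Carrier → Carrier → ℕ
  δ x y = 𝟙? (x ≟ y)

  δ-cong : ∀ {x x′ y y′} → (x ≈ y → x′ ≈ y′) → (x′ ≈ y′ → x ≈ y) → δ x y ≡ δ x′ y′
  δ-cong {x} {x′} {y} {y′} = 𝟙?-cong (x ≟ y) (x′ ≟ y′)

  μ : List Carrier → Carrier → ℕ
  μ A z = ∑ A (λ a → δ a z)

  μ-cong : ∀ A {z z′} → z ≈ z′ → μ A z ≡ μ A z′
  μ-cong A z≈z′ = ∑-cong A (λ a → δ-cong (λ p → ≈-trans p z≈z′) (λ p → ≈-trans p (≈-sym z≈z′)))

  -- Finite subsets of the group are lists in which each element is represented at most once.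
  IsSet : List Carrier → Set c
  IsSet A = ∀ z → μ A z ≤ 1

  _∈ˢ_ : Carrier → List Carrier → Set
  z ∈ˢ A = 1 ≤ μ A z

  _∈ˢ?_ : ∀ z A → Dec (z ∈ˢ A)
  z ∈ˢ? A = 1 ≤? μ A z

  ∈ˢ-resp : ∀ A {z z′} → z ≈ z′ → z ∈ˢ A → z′ ∈ˢ A
  ∈ˢ-resp A z≈z′ = subst (1 ≤_) (μ-cong A z≈z′)

  ∈⇒∈ˢ : ∀ {A a} → a ∈ A → a ∈ˢ A
  ∈⇒∈ˢ {A} {a} a∈ = ≤-trans (≤-reflexive (sym (𝟙?-yes (a ≟ a) ≈-refl))) (∑-term (λ x → δ x a) a∈)

  ∈ˢ⇒∈ : ∀ {A z} → z ∈ˢ A → ∃ λ a → a ∈ A × a ≈ z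
  ∈ˢ⇒∈ {A} {z} h with ∑-pos A (λ a → δ a z) h
  ... | a , a∈ , p = a , a∈ , 𝟙?-pos (a ≟ z) p

  μ-𝟙? : ∀ A → IsSet A → ∀ z → 𝟙? (z ∈ˢ? A) ≡ μ A z
  μ-𝟙? A set z with μ A z | set z
  ... | zero        | _ = refl
  ... | suc zero    | _ = refl
  ... | suc (suc _) | s≤s ()

  IsSet-filter : ∀ {p} {P : Carrier → Set p} (P? : ∀ x → Dec (P x)) A → IsSet A → IsSet (filter P? A)
  IsSet-filter P? A set z =
    ≤-trans (≤-reflexive (∑-filter P? A _))
      (≤-trans (∑-mono A (λ a → ≤-trans (*-monoˡ-≤ (δ a z) (𝟙≤1 (does (P? a)))) (≤-reflexive (+-identityʳ _)))) (set z))

  IsSet-translate : ∀ e A → IsSet A → IsSet (map (_∙ e) A)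
  IsSet-translate e A set z = ≤-trans (≤-reflexive eq) (set (z ∙ e ⁻¹))
    where
    eq : μ (map (_∙ e) A) z ≡ μ A (z ∙ e ⁻¹)
    eq = trans (∑-map (_∙ e) A _) (∑-cong A (λ a → δ-cong
           (λ p → ≈-trans (≈-sym (cancel-right a e)) (∙-congʳ p))
           (λ p → ≈-trans (∙-congʳ p) (cancel-right′ z e))))

  length-≤ : ∀ A B → IsSet A → (∀ z → z ∈ˢ A → z ∈ˢ B) → length A ≤ length B
  length-≤ A B set A⊆B = begin
    length A ≡⟨ sym (∑-1 A) ⟩
    ∑ A (λ _ → 1) ≤⟨ ∑-mono∈ A (λ a a∈ → A⊆B a (∈⇒∈ˢ a∈)) ⟩
    ∑ A (λ a → ∑ B (λ b → δ b a)) ≡⟨ ∑-swap A B _ ⟩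
    ∑ B (λ b → ∑ A (λ a → δ b a)) ≡⟨ ∑-cong B (λ b → ∑-cong A (λ a → δ-cong ≈-sym ≈-sym)) ⟩
    ∑ B (λ b → μ A b) ≤⟨ ∑-mono B set ⟩
    ∑ B (λ _ → 1) ≡⟨ ∑-1 B ⟩
    length B ∎
    where open ≤-Reasoning

  -- An element of `B` missing from `A` could be put in front of `A`, giving a set inside `B` that
  -- is longer than `B`.
  ⊆-antisym-length : ∀ A B → IsSet A → (∀ z → z ∈ˢ A → z ∈ˢ B) → length B ≤ length A → ∀ z → z ∈ˢ B → z ∈ˢ A
  ⊆-antisym-length A B set A⊆B B≤A z z∈B with z ∈ˢ? A
  ... | yes p = p
  ... | no ¬p = ⊥-elim (<⇒≱ (length-≤ (z ∷ A) B set′ sub) B≤A)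
    where
    set′ : IsSet (z ∷ A)
    set′ y with z ≟ y
    ... | no _    = set y
    ... | yes z≈y = s≤s (≤-trans (≤-reflexive (sym (μ-cong A z≈y))) (≤-pred (≰⇒> ¬p)))
    sub : ∀ y → y ∈ˢ (z ∷ A) → y ∈ˢ B
    sub y h with z ≟ y
    ... | yes z≈y = ∈ˢ-resp B z≈y z∈B
    ... | no _    = A⊆B y h

  lookup-injective : ∀ A → IsSet A → ∀ i j → lookup A i ≈ lookup A j → i ≡ j
  lookup-injective (a ∷ A) set zero    zero    _ = refl
  lookup-injective (a ∷ A) set (suc i) (suc j) p = cong suc (lookup-injective A (λ z → ≤-trans (m≤n+m _ _) (set z)) i j p)
  lookup-injective (a ∷ A) set zero    (suc j) p = ⊥-elim (<⇒≱ (s≤s (∈⇒∈ˢ (∈-lookup {xs = A} j)))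
     (≤-trans (+-monoˡ-≤ _ (≤-reflexive (sym (𝟙?-yes (a ≟ lookup A j) p)))) (set (lookup A j))))
  lookup-injective (a ∷ A) set (suc i) zero    p = ⊥-elim (<⇒≱ (s≤s (∈⇒∈ˢ (∈-lookup {xs = A} i)))
     (≤-trans (+-monoˡ-≤ _ (≤-reflexive (sym (𝟙?-yes (a ≟ lookup A i) (≈-sym p))))) (set (lookup A i))))

  ∈ˢ⇒lookup : ∀ A {z} → z ∈ˢ A → ∃ λ i → z ≈ lookup A i
  ∈ˢ⇒lookup A {z} h with ∈ˢ⇒∈ {A} h
  ... | a , a∈ , a≈z = Any.index a∈ , ≈-trans (≈-sym a≈z) (reflexive (Anyₚ.lookup-index a∈))

  module Stabiliser (A : List Carrier) (set : IsSet A) (a₀ : Carrier) (a₀∈A : a₀ ∈ A) where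

    Stabilises : Carrier → Set c
    Stabilises h = All (λ a → (a ∙ h) ∈ˢ A) A

    stabilises? : ∀ h → Dec (Stabilises h)
    stabilises? h = All.all? (λ a → (a ∙ h) ∈ˢ? A) A

    stabilises : ∀ {h} → Stabilises h → ∀ z → z ∈ˢ A → (z ∙ h) ∈ˢ A
    stabilises {h} st z z∈ with ∈ˢ⇒∈ {A} z∈
    ... | a , a∈ , a≈z = ∈ˢ-resp A (∙-congʳ a≈z) (All.lookup st a∈)

    -- A stabilising element moves `a₀` into `A`, hence lies in the translate of `A` by the inverse
    -- of `a₀`; the stabiliser is found by searching this finite list.
    H : List Carrier
    H = filter stabilises? (map (_∙ a₀ ⁻¹) A)

    H-set : IsSet H
    H-set = IsSet-filter stabilises? (map (_∙ a₀ ⁻¹) A) (IsSet-translate (a₀ ⁻¹) A set)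

    ∈H⁺ : ∀ {h} → Stabilises h → h ∈ˢ H
    ∈H⁺ {h} st = begin
      1 ≤⟨ stabilises st a₀ (∈⇒∈ˢ a₀∈A) ⟩
      ∑ A (λ a → δ a (a₀ ∙ h))
        ≤⟨ ∑-mono A pointwise ⟩
      ∑ A (λ a → 𝟙? (stabilises? (a ∙ a₀ ⁻¹)) * δ (a ∙ a₀ ⁻¹) h)
        ≡⟨ sym (∑-map (_∙ a₀ ⁻¹) A _) ⟩
      ∑ (map (_∙ a₀ ⁻¹) A) (λ x → 𝟙? (stabilises? x) * δ x h)
        ≡⟨ sym (∑-filter stabilises? (map (_∙ a₀ ⁻¹) A) _) ⟩
      μ H h ∎
      where
      open ≤-Reasoning
      pointwise : ∀ a → δ a (a₀ ∙ h) ≤ 𝟙? (stabilises? (a ∙ a₀ ⁻¹)) * δ (a ∙ a₀ ⁻¹) h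
      pointwise a with a ≟ (a₀ ∙ h)
      ... | no _  = z≤n
      ... | yes p = ≤-reflexive (sym (cong₂ _*_ (𝟙?-yes (stabilises? _) st′) (𝟙?-yes (_ ≟ _) q)))
        where
        q : a ∙ a₀ ⁻¹ ≈ h
        q = ≈-trans (∙-congʳ (≈-trans p (comm a₀ h))) (cancel-right h a₀)
        st′ : Stabilises (a ∙ a₀ ⁻¹)
        st′ = All.map (∈ˢ-resp A (∙-congˡ (≈-sym q))) st

    ∈H⁻ : ∀ {h} → h ∈ H → Stabilises h
    ∈H⁻ h∈ = proj₂ (∈-filter⁻ stabilises? {xs = map (_∙ a₀ ⁻¹) A} h∈)

    H-length : length H ≤ length A
    H-length = ≤-trans (length-filter stabilises? (map (_∙ a₀ ⁻¹) A)) (≤-reflexive (length-map (_∙ a₀ ⁻¹) A))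

    -- Translation by `h` maps the finite set `A` injectively into itself, hence onto itself.
    inverse-stabilises : ∀ {h} → Stabilises h → Stabilises (h ⁻¹)
    inverse-stabilises {h} st = All.tabulate λ {a} a∈ → back a (⊆-antisym-length (map (_∙ h) A) A (IsSet-translate h A set) image (≤-reflexive (sym (length-map (_∙ h) A))) a (∈⇒∈ˢ a∈))
      where
      image : ∀ z → z ∈ˢ map (_∙ h) A → z ∈ˢ A
      image z z∈ with ∈ˢ⇒∈ {map (_∙ h) A} z∈
      ... | y , y∈ , y≈z with ∈-map⁻ (_∙ h) y∈
      ...   | a , a∈ , refl = ∈ˢ-resp A y≈z (All.lookup st a∈)
      back : ∀ a → a ∈ˢ map (_∙ h) A → (a ∙ h ⁻¹) ∈ˢ A
      back a a∈ with ∈ˢ⇒∈ {map (_∙ h) A} a∈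
      ... | y , y∈ , y≈a with ∈-map⁻ (_∙ h) y∈
      ...   | x , x∈ , refl = ∈ˢ-resp A (≈-trans (≈-sym (cancel-right x h)) (∙-congʳ y≈a)) (∈⇒∈ˢ x∈)

    subgroup : HasSubgroupOfSize G (length H)
    subgroup = lookup H , lookup-injective H H-set
      , flip (∈ˢ⇒lookup H (∈H⁺ (All.tabulate λ a∈ → ∈ˢ-resp A (≈-sym (identityʳ _)) (∈⇒∈ˢ a∈))))
      , (λ i j → ∈ˢ⇒lookup H (∈H⁺ (prod (∈H⁻ (∈-lookup i)) (∈H⁻ (∈-lookup j)))))
      , (λ i → ∈ˢ⇒lookup H (∈H⁺ (inverse-stabilises (∈H⁻ (∈-lookup i)))))
      where
      flip : ∀ {z} → (∃ λ i → z ≈ lookup H i) → ∃ λ i → lookup H i ≈ z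
      flip (i , p) = i , ≈-sym p
      prod : ∀ {h h′} → Stabilises h → Stabilises h′ → Stabilises (h ∙ h′)
      prod {h} {h′} st st′ = All.tabulate λ a∈ → ∈ˢ-resp A (assoc _ h h′) (stabilises st′ _ (All.lookup st a∈))

  -- In the application w is the indicator of the complement of a set of at most m elements.
  module Pollard (w : Carrier → ℕ) (w-resp : ∀ {x y} → x ≈ y → w x ≡ w y)
                 (m : ℕ) (capacity : ∀ A → IsSet A → length A ≤ m + ∑ A w)
                 (K β : ℕ) (bound : ∀ k → HasSubgroupOfSize G k → k ≤ K → k ≤ β) where

    E : List Carrier → List Carrier → ℕ
    E A B = ∑ A (λ a → ∑ B (λ b → w (a ∙ b)))

    -- Each `b` in `B` translates `A` to a set with as many elements, to which `capacity` applies.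
    E-lower : ∀ A B → IsSet A → length B * length A ≤ length B * m + E A B
    E-lower A B set = begin
      length B * length A ≡⟨ sym (∑-const B (length A)) ⟩
      ∑ B (λ _ → length A) ≤⟨ ∑-mono B row ⟩
      ∑ B (λ b → m + ∑ A (λ a → w (a ∙ b))) ≡⟨ ∑-+ B _ _ ⟩
      ∑ B (λ _ → m) + ∑ B (λ b → ∑ A (λ a → w (a ∙ b)))
        ≡⟨ cong₂ _+_ (∑-const B m) (∑-swap B A _) ⟩
      length B * m + E A B ∎
      where
      open ≤-Reasoning
      row : ∀ b → length A ≤ m + ∑ A (λ a → w (a ∙ b))
      row b = begin
        length A ≡⟨ sym (length-map (_∙ b) A) ⟩
        length (map (_∙ b) A) ≤⟨ capacity (map (_∙ b) A) (IsSet-translate b A set) ⟩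
        m + ∑ (map (_∙ b) A) w ≡⟨ cong (m +_) (∑-map _ A w) ⟩
        m + ∑ A (λ a → w (a ∙ b)) ∎

    module Transform (A B : List Carrier) (setA : IsSet A) (setB : IsSet B) (e : Carrier) where

      inA? : ∀ b → Dec ((b ∙ e) ∈ˢ A)
      inA? b = (b ∙ e) ∈ˢ? A

      inB? : ∀ a → Dec ((a ∙ e ⁻¹) ∈ˢ B)
      inB? a = (a ∙ e ⁻¹) ∈ˢ? B

      -- Additively, `I` is `B ∩ (A − e)`, `Aᴵ` is `A ∩ (B + e) = I + e`, and `U` is `A ∪ (B + e)`.
      I B′ Aᴵ A′ U : List Carrier
      I  = filter inA? B
      B′ = filter (¬? ∘ inA?) B
      Aᴵ = filter inB? A
      A′ = filter (¬? ∘ inB?) A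
      U  = A ++ map (_∙ e) B′

      I-set : IsSet I
      I-set = IsSet-filter inA? B setB

      B′-set : IsSet B′
      B′-set = IsSet-filter (¬? ∘ inA?) B setB

      A′-set : IsSet A′
      A′-set = IsSet-filter (¬? ∘ inB?) A setA

      U-set : IsSet U
      U-set z with z ∈ˢ? map (_∙ e) B′
      ... | no ¬p = ≤-trans (≤-reflexive (∑-++ A (map (_∙ e) B′) _))
                      (≤-trans (+-monoʳ-≤ _ (≤-pred (≰⇒> ¬p))) (≤-trans (≤-reflexive (+-identityʳ _)) (setA z)))
      ... | yes p = ≤-trans (≤-reflexive (∑-++ A (map (_∙ e) B′) _))
                      (≤-trans (+-monoˡ-≤ _ (≤-pred (≰⇒> z∉A))) (IsSet-translate e B′ B′-set z))
        where
        z∉A : ¬ z ∈ˢ A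
        z∉A z∈A with ∈ˢ⇒∈ {map (_∙ e) B′} p
        ... | y , y∈ , y≈z with ∈-map⁻ (_∙ e) y∈
        ...   | b , b∈ , refl = proj₂ (∈-filter⁻ (¬? ∘ inA?) {xs = B} b∈) (∈ˢ-resp A (≈-sym y≈z) z∈A)

      -- `Aᴵ` and the translate of `I` are the same set, but one list is taken from `A` and the
      -- other from `B`; replacing the membership indicators by multiplicities turns both sums into
      -- one double sum.
      matching : ∀ f → (∀ {x y} → x ≈ y → f x ≡ f y) → ∑ Aᴵ f ≡ ∑ I (λ b → f (b ∙ e))
      matching f f-resp = begin
        ∑ Aᴵ f
          ≡⟨ ∑-filter inB? A f ⟩
        ∑ A (λ a → 𝟙? (inB? a) * f a)
          ≡⟨ ∑-cong A (λ a → cong (_* f a) (μ-𝟙? B setB _)) ⟩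
        ∑ A (λ a → ∑ B (λ b → δ b (a ∙ e ⁻¹)) * f a)
          ≡⟨ ∑-cong A (λ a → sym (∑-*ʳ B (f a) _)) ⟩
        ∑ A (λ a → ∑ B (λ b → δ b (a ∙ e ⁻¹) * f a))
          ≡⟨ ∑-cong A (λ a → ∑-cong B (λ b → move a b)) ⟩
        ∑ A (λ a → ∑ B (λ b → δ a (b ∙ e) * f (b ∙ e)))
          ≡⟨ ∑-swap A B _ ⟩
        ∑ B (λ b → ∑ A (λ a → δ a (b ∙ e) * f (b ∙ e)))
          ≡⟨ ∑-cong B (λ b → ∑-*ʳ A (f (b ∙ e)) _) ⟩
        ∑ B (λ b → μ A (b ∙ e) * f (b ∙ e))
          ≡⟨ ∑-cong B (λ b → cong (_* f (b ∙ e)) (sym (μ-𝟙? A setA _))) ⟩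
        ∑ B (λ b → 𝟙? (inA? b) * f (b ∙ e))
          ≡⟨ sym (∑-filter inA? B _) ⟩
        ∑ I (λ b → f (b ∙ e)) ∎
        where
        open ≡-Reasoning
        move : ∀ a b → δ b (a ∙ e ⁻¹) * f a ≡ δ a (b ∙ e) * f (b ∙ e)
        move a b with a ≟ (b ∙ e)
        ... | yes p = cong₂ _*_ (𝟙?-yes (b ≟ _) (≈-trans (≈-sym (cancel-right b e)) (∙-congʳ (≈-sym p)))) (f-resp p)
        ... | no ¬p = cong (_* f a) (𝟙?-no (b ≟ _) (λ q → ¬p (≈-trans (≈-sym (cancel-right′ a e)) (∙-congʳ (≈-sym q)))))

      length-A : length A ≡ length I + length A′
      length-A = begin
        length A ≡⟨ sym (∑-1 A) ⟩
        ∑ A (λ _ → 1) ≡⟨ ∑-split inB? A _ ⟩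
        ∑ Aᴵ (λ _ → 1) + ∑ A′ (λ _ → 1) ≡⟨ cong₂ _+_ (matching (λ _ → 1) (λ _ → refl)) (∑-1 A′) ⟩
        ∑ I (λ _ → 1) + length A′ ≡⟨ cong (_+ length A′) (∑-1 I) ⟩
        length I + length A′ ∎
        where open ≡-Reasoning

      length-B : length B ≡ length I + length B′
      length-B = trans (sym (∑-1 B)) (trans (∑-split inA? B _) (cong₂ _+_ (∑-1 I) (∑-1 B′)))

      length-U : length U ≡ length A + length B′
      length-U = trans (length-++ A) (cong (length A +_) (length-map _ B′))

      -- The pairs from `I + e` and `B′` are exchanged for the pairs from `B′ + e` and `I` by
      -- `(y + e) + b = (b + e) + y`; all other pairs stay.
      E-split : E A B ≡ E U I + E A′ B′
      E-split = begin
        E A B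
          ≡⟨ ∑-cong A (λ a → ∑-split inA? B _) ⟩
        ∑ A (λ a → rowI a + rowB′ a)
          ≡⟨ ∑-+ A rowI rowB′ ⟩
        ∑ A rowI + ∑ A rowB′
          ≡⟨ cong (∑ A rowI +_) (∑-split inB? A rowB′) ⟩
        ∑ A rowI + (∑ Aᴵ rowB′ + E A′ B′)
          ≡⟨ sym (+-assoc (∑ A rowI) _ _) ⟩
        ∑ A rowI + ∑ Aᴵ rowB′ + E A′ B′
          ≡⟨ cong (λ k → ∑ A rowI + k + E A′ B′) (matching rowB′ (λ p → ∑-cong B′ (λ b → w-resp (∙-congʳ p)))) ⟩
        ∑ A rowI + ∑ I (λ y → rowB′ (y ∙ e)) + E A′ B′
          ≡⟨ cong (λ k → ∑ A rowI + k + E A′ B′) (trans (∑-swap I B′ _) (∑-cong B′ (λ b → ∑-cong I (λ y → w-resp (exchange y b))))) ⟩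
        ∑ A rowI + ∑ B′ (λ b → rowI (b ∙ e)) + E A′ B′
          ≡⟨ cong (λ k → ∑ A rowI + k + E A′ B′) (sym (∑-map (_∙ e) B′ rowI)) ⟩
        ∑ A rowI + ∑ (map (_∙ e) B′) rowI + E A′ B′
          ≡⟨ cong (_+ E A′ B′) (sym (∑-++ A (map (_∙ e) B′) rowI)) ⟩
        E U I + E A′ B′ ∎
        where
        open ≡-Reasoning
        rowI rowB′ : Carrier → ℕ
        rowI a  = ∑ I (λ b → w (a ∙ b))
        rowB′ a = ∑ B′ (λ b → w (a ∙ b))
        exchange : ∀ y b → (y ∙ e) ∙ b ≈ (b ∙ e) ∙ y
        exchange y b = ≈-trans (comm _ b) (≈-trans (∙-congˡ (comm y e)) (≈-sym (assoc b e y)))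

    Conclusion : ℕ → List Carrier → List Carrier → Set
    Conclusion t A B = PollardBound m K β t (length A) (length B) (E A B)

    -- `closed` puts the differences of `B` into the stabiliser `H` of `A`, so `B` is no larger than
    -- `H`. If `H` has at most `K` elements, `β` bounds it; otherwise `A`, which is at least as
    -- large as `H`, has more than `K` elements, and `tA` gives the first alternative.
    terminal : ∀ t A B → IsSet A → IsSet B → 1 ≤ length A → 1 ≤ length B → t ≤ length B →
               (∀ a b b′ → a ∈ A → b ∈ B → b′ ∈ B → (a ∙ (b′ ∙ b ⁻¹)) ∈ˢ A) → Conclusion t A B
    terminal t (a₀ ∷ A₀) (b₀ ∷ B₀) setA setB _ _ t≤B closed = conclude
      where
      A = a₀ ∷ A₀
      B = b₀ ∷ B₀
      open Stabiliser A setA a₀ (here refl)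
      open ≤-Reasoning
      -- `E-lower` counts the excess of `A` over `m` once for each of the at least `t` elements of
      -- `B`.
      tA : t * length A ≤ t * m + E A B
      tA with length A ≤? m
      ... | yes A≤m = ≤-trans (*-monoʳ-≤ t A≤m) (m≤m+n _ _)
      ... | no  A≰m = begin
        t * length A ≡⟨ cong (t *_) (sym (m+[n∸m]≡n (<⇒≤ (≰⇒> A≰m)))) ⟩
        t * (m + (length A ∸ m)) ≡⟨ *-distribˡ-+ t m _ ⟩
        t * m + t * (length A ∸ m) ≤⟨ +-monoʳ-≤ (t * m) (*-monoˡ-≤ _ t≤B) ⟩
        t * m + length B * (length A ∸ m) ≤⟨ +-monoʳ-≤ (t * m) (+-cancelˡ-≤ (length B * m) _ _ (begin
          length B * m + length B * (length A ∸ m) ≡⟨ sym (*-distribˡ-+ (length B) m _) ⟩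
          length B * (m + (length A ∸ m)) ≡⟨ cong (length B *_) (m+[n∸m]≡n (<⇒≤ (≰⇒> A≰m))) ⟩
          length B * length A ≤⟨ E-lower A B setA ⟩
          length B * m + E A B ∎)) ⟩
        t * m + E A B ∎
      B≤H : length B ≤ length H
      B≤H = ≤-trans (≤-reflexive (sym (length-map (_∙ b₀ ⁻¹) B))) (length-≤ (map (_∙ b₀ ⁻¹) B) H (IsSet-translate (b₀ ⁻¹) B setB) sub)
        where
        sub : ∀ z → z ∈ˢ map (_∙ b₀ ⁻¹) B → z ∈ˢ H
        sub z z∈ with ∈ˢ⇒∈ {map (_∙ b₀ ⁻¹) B} z∈
        ... | y , y∈ , y≈z with ∈-map⁻ (_∙ b₀ ⁻¹) y∈
        ...   | b , b∈ , refl = ∈ˢ-resp H y≈z (∈H⁺ (All.tabulate λ a∈ → closed _ b₀ b a∈ (here refl) b∈))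
      conclude : Conclusion t A B
      conclude with length H ≤? K
      ... | no  H≰K = inj₁ (≤-trans (*-monoʳ-≤ t (≤-trans (<⇒≤ (≰⇒> H≰K)) H-length)) tA)
      ... | yes H≤K = inj₂ (begin
        t * (length A + length B) ≡⟨ *-distribˡ-+ t _ _ ⟩
        t * length A + t * length B ≤⟨ +-mono-≤ tA (*-monoʳ-≤ t (≤-trans B≤H (bound _ subgroup H≤K))) ⟩
        t * m + E A B + t * β ≤⟨ +-monoˡ-≤ (t * β) (m≤m+n _ (t * t)) ⟩
        t * m + E A B + t * t + t * β ∎)

    Closed : List Carrier → List Carrier → Set c
    Closed A B = All (λ a → All (λ b → All (λ b′ → (a ∙ (b′ ∙ b ⁻¹)) ∈ˢ A) B) B) A

    closed? : ∀ A B → Dec (Closed A B)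
    closed? A B = All.all? (λ a → All.all? (λ b → All.all? (λ b′ → (a ∙ (b′ ∙ b ⁻¹)) ∈ˢ? A) B) B) A

    not-closed : ∀ A B → ¬ Closed A B → ∃ λ a → ∃ λ b → ∃ λ b′ →
                 a ∈ A × b ∈ B × b′ ∈ B × ¬ (a ∙ (b′ ∙ b ⁻¹)) ∈ˢ A
    not-closed A B ¬cl
      with find (Allₚ.¬All⇒Any¬ (λ a → All.all? (λ b → All.all? (λ b′ → (a ∙ (b′ ∙ b ⁻¹)) ∈ˢ? A) B) B) A ¬cl)
    ... | a , a∈ , ¬cl₁ with find (Allₚ.¬All⇒Any¬ (λ b → All.all? (λ b′ → (a ∙ (b′ ∙ b ⁻¹)) ∈ˢ? A) B) B ¬cl₁)
    ...   | b , b∈ , ¬cl₂ with find (Allₚ.¬All⇒Any¬ (λ b′ → (a ∙ (b′ ∙ b ⁻¹)) ∈ˢ? A) B ¬cl₂)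
    ...     | b′ , b′∈ , ∉A = a , b , b′ , a∈ , b∈ , b′∈ , ∉A

    Pollard-≤ : ℕ → Set c
    Pollard-≤ n = ∀ t A B → length B ≤ n → IsSet A → IsSet B → 1 ≤ t → t ≤ length A → t ≤ length B → Conclusion t A B

    -- Dyson's e-transform replaces (A , B) by (A ∪ (B + e) , B ∩ (A − e)) and the complementary pair.
    pollard-step : ∀ n → Pollard-≤ n → ∀ t A B → length B ≤ suc n → (setA : IsSet A) (setB : IsSet B) →
                   1 ≤ t → t ≤ length A → t ≤ length B →
                   ∀ a b b′ → a ∈ A → b ∈ B → b′ ∈ B → ¬ (a ∙ (b′ ∙ b ⁻¹)) ∈ˢ A → Conclusion t A B
    -- The shift `e = a − b` puts `b` into `I` and `b′` into `B′`; both being nonempty, the second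
    -- set shrinks whichever new pair is used.
    pollard-step n ih t A B B≤n setA setB 1≤t t≤A t≤B a b b′ a∈A b∈B b′∈B ∉A with t ≤? length (Transform.I A B setA setB (a ∙ b ⁻¹))
    ... | yes t≤i = bound-enlarge {m} {K} {β} {t} {length A} {length B} {length U} {length I} {E A B} {E U I} {E A′ B′}
                      (length-union length-A length-B length-U) E-split
                      (ih t U I I≤n U-set I-set 1≤t (≤-trans t≤A (≤-trans (m≤m+n _ _) (≤-reflexive (sym length-U)))) t≤i)
      where
      open Transform A B setA setB (a ∙ b ⁻¹)
      b′∈B′ : b′ ∈ B′
      b′∈B′ = ∈-filter⁺ (¬? ∘ inA?) b′∈B (λ h → ∉A (∈ˢ-resp A swap h))
        where
        swap : b′ ∙ (a ∙ b ⁻¹) ≈ a ∙ (b′ ∙ b ⁻¹)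
        swap = ≈-trans (≈-sym (assoc b′ a (b ⁻¹))) (≈-trans (∙-congʳ (comm b′ a)) (assoc a b′ (b ⁻¹)))
      I≤n : length I ≤ n
      I≤n = ≤-pred (≤-trans (≤-trans (≤-reflexive (sym (+-comm (length I) 1))) (+-monoʳ-≤ (length I) (∈-length b′∈B′)))
                            (≤-trans (≤-reflexive (sym length-B)) B≤n))
    ... | no t≰i = bound-split t≡ length-A length-B length-U E-split (<⇒≤ (≰⇒> t≰i)) (E-lower U I U-set)
                     (ih (t ∸ length I) A′ B′ B′≤n A′-set B′-set (m<n⇒0<n∸m (≰⇒> t≰i))
                         (+-cancelˡ-≤ (length I) _ _ (≤-trans (≤-reflexive (sym t≡)) (≤-trans t≤A (≤-reflexive length-A))))
                         (+-cancelˡ-≤ (length I) _ _ (≤-trans (≤-reflexive (sym t≡)) (≤-trans t≤B (≤-reflexive length-B)))))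
      where
      open Transform A B setA setB (a ∙ b ⁻¹)
      t≡ : t ≡ length I + (t ∸ length I)
      t≡ = sym (m+[n∸m]≡n (<⇒≤ (≰⇒> t≰i)))
      b∈I : b ∈ I
      b∈I = ∈-filter⁺ inA? b∈B (∈ˢ-resp A (≈-sym (≈-trans (comm b _) (cancel-right′ a b))) (∈⇒∈ˢ a∈A))
      B′≤n : length B′ ≤ n
      B′≤n = ≤-pred (≤-trans (+-monoˡ-≤ (length B′) (∈-length b∈I)) (≤-trans (≤-reflexive (sym length-B)) B≤n))

    pollard-≤ : ∀ n → Pollard-≤ n
    pollard-≤ zero    t A B B≤n setA setB 1≤t t≤A t≤B = ⊥-elim (<⇒≱ 1≤t (≤-trans t≤B B≤n))
    pollard-≤ (suc n) t A B B≤n setA setB 1≤t t≤A t≤B with closed? A B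
    ... | yes cl = terminal t A B setA setB (≤-trans 1≤t t≤A) (≤-trans 1≤t t≤B) t≤B
                     (λ a b b′ a∈ b∈ b′∈ → All.lookup (All.lookup (All.lookup cl a∈) b∈) b′∈)
    ... | no ¬cl with not-closed A B ¬cl
    ...   | a , b , b′ , a∈ , b∈ , b′∈ , ∉A =
      pollard-step n (pollard-≤ n) t A B B≤n setA setB 1≤t t≤A t≤B a b b′ a∈ b∈ b′∈ ∉A

    pollard : ∀ t A B → IsSet A → IsSet B → 1 ≤ t → t ≤ length A → t ≤ length B → Conclusion t A B
    pollard t A B = pollard-≤ (length B) t A B ≤-refl

-- Graph containers

∧⁺ : ∀ {a b} → a ≡ true → b ≡ true → a ∧ b ≡ true
∧⁺ refl refl = refl

∧⁻ : ∀ {a b} → a ∧ b ≡ true → a ≡ true × b ≡ true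
∧⁻ {true} {true} _ = refl , refl

does⁻ : ∀ {p} {P : Set p} (P? : Dec P) → does P? ≡ true → P
does⁻ (yes p) _ = p

does⁺ : ∀ {p} {P : Set p} (P? : Dec P) → P → does P? ≡ true
does⁺ (yes _) _ = refl
does⁺ (no ¬p) p = ⊥-elim (¬p p)

𝟙-mono : ∀ {a b} → (a ≡ true → b ≡ true) → 𝟙 a ≤ 𝟙 b
𝟙-mono {false} _ = z≤n
𝟙-mono {true}  h = ≤-reflexive (cong 𝟙 (sym (h refl)))

𝟙-split : ∀ a b → 𝟙 a ≡ 𝟙 (a ∧ b) + 𝟙 (a ∧ not b)
𝟙-split true  true  = refl
𝟙-split true  false = refl
𝟙-split false _     = refl

shrink : ∀ r₁ {p p₁ p₂} → p ≡ p₁ + p₂ → p ≤ suc r₁ * p₁ → suc r₁ * p₂ ≤ r₁ * p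
shrink r₁ {p} {p₁} {p₂} eq h = +-cancelˡ-≤ p _ _ (begin
  p + suc r₁ * p₂ ≤⟨ +-monoˡ-≤ (suc r₁ * p₂) h ⟩
  suc r₁ * p₁ + suc r₁ * p₂ ≡⟨ sym (*-distribˡ-+ (suc r₁) p₁ p₂) ⟩
  suc r₁ * (p₁ + p₂) ≡⟨ cong (suc r₁ *_) (sym eq) ⟩
  p + r₁ * p ∎)
  where open ≤-Reasoning

-- With `r = suc r₁`, the invariant says `p * (1 − 1/r) ^ d < 1`. Removing at least the fraction
-- `1/r` of `p` preserves it for `d` lowered by one; at `d = 0` it says `p = 0`.
geometric-step : ∀ r₁ d {p q} → r₁ ^ suc d * p < suc r₁ ^ suc d → suc r₁ * q ≤ r₁ * p → r₁ ^ d * q < suc r₁ ^ d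
geometric-step r₁ d {p} {q} measure h = *-cancelˡ-< (suc r₁) _ _ (begin-strict
  suc r₁ * (r₁ ^ d * q) ≡⟨ *-rotate (suc r₁) (r₁ ^ d) q ⟩
  r₁ ^ d * (suc r₁ * q) ≤⟨ *-monoʳ-≤ (r₁ ^ d) h ⟩
  r₁ ^ d * (r₁ * p) ≡⟨ trans (sym (*-assoc (r₁ ^ d) r₁ p)) (cong (_* p) (*-comm (r₁ ^ d) r₁)) ⟩
  r₁ ^ suc d * p <⟨ measure ⟩
  suc r₁ ^ suc d ∎)
  where open ≤-Reasoning

FinSet : ℕ → Set
FinSet n = Fin n → Bool

module _ {n : ℕ} where

  card : FinSet n → ℕ
  card A = ∑ (allFin n) (𝟙 ∘ A)

  infix 4 _⊆_
  _⊆_ : FinSet n → FinSet n → Set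
  A ⊆ B = ∀ i → A i ≡ true → B i ≡ true

  card-mono : ∀ {A B} → A ⊆ B → card A ≤ card B
  card-mono A⊆B = ∑-mono (allFin n) (λ i → 𝟙-mono (A⊆B i))

  card-split : ∀ (A P : FinSet n) → card A ≡ card (λ i → A i ∧ P i) + card (λ i → A i ∧ not (P i))
  card-split A P = trans (∑-cong (allFin n) (λ i → 𝟙-split (A i) (P i))) (∑-+ (allFin n) _ _)

  card-pos : ∀ A {i} → A i ≡ true → 1 ≤ card A
  card-pos A {i} Ai = ≤-trans (≤-reflexive (cong 𝟙 (sym Ai))) (∑-term (𝟙 ∘ A) (∈-allFin i))

  card-witness : ∀ A → 1 ≤ card A → ∃ λ i → A i ≡ true
  card-witness A h with ∑-pos (allFin n) (𝟙 ∘ A) h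
  ... | i , _ , p = i , 𝟙-pos p

  elems : FinSet n → List (Fin n)
  elems A = filter (λ i → A i Bool.≟ true) (allFin n)

  ∈-elems⁺ : ∀ A {i} → A i ≡ true → i ∈ elems A
  ∈-elems⁺ A {i} = ∈-filter⁺ (λ i → A i Bool.≟ true) (∈-allFin i)

  ∈-elems⁻ : ∀ A {i} → i ∈ elems A → A i ≡ true
  ∈-elems⁻ A i∈ = proj₂ (∈-filter⁻ (λ i → A i Bool.≟ true) {xs = allFin n} i∈)

  ∑-elems : ∀ A f → ∑ (elems A) f ≡ ∑ (allFin n) (λ i → 𝟙 (A i) * f i)
  ∑-elems A f = trans (∑-filter (λ i → A i Bool.≟ true) (allFin n) f)
                      (∑-cong (allFin n) (λ i → cong (_* f i) (≟-true (A i))))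
    where
    ≟-true : ∀ b → 𝟙? (b Bool.≟ true) ≡ 𝟙 b
    ≟-true true  = refl
    ≟-true false = refl

  length-elems : ∀ A → length (elems A) ≡ card A
  length-elems A = trans (sym (∑-1 (elems A))) (trans (∑-elems A (λ _ → 1)) (∑-cong (allFin n) (λ i → *-identityʳ _)))

  member : List (Fin n) → FinSet n
  member ds i = does (any? (i Fin.≟_) ds)

  member⁺ : ∀ {ds i} → i ∈ ds → member ds i ≡ true
  member⁺ {ds} {i} = does⁺ (any? (i Fin.≟_) ds)

  _∪ˡ_ : FinSet n → List (Fin n) → FinSet n
  (A ∪ˡ ds) i = A i ∨ member ds i

  ∪ˡ⁺₁ : ∀ A ds {i} → A i ≡ true → (A ∪ˡ ds) i ≡ true
  ∪ˡ⁺₁ A ds Ai rewrite Ai = refl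

  ∪ˡ⁺₂ : ∀ A {ds i} → i ∈ ds → (A ∪ˡ ds) i ≡ true
  ∪ˡ⁺₂ A {ds} {i} i∈ with A i
  ... | true  = refl
  ... | false = member⁺ i∈

  card-∪ˡ : ∀ A ds → card (A ∪ˡ ds) ≤ card A + length ds
  card-∪ˡ A ds = begin
    card (A ∪ˡ ds) ≤⟨ ∑-mono (allFin n) (λ i → pointwise (A i) _) ⟩
    ∑ (allFin n) (λ i → 𝟙 (A i) + 𝟙 (member ds i)) ≡⟨ ∑-+ (allFin n) _ _ ⟩
    card A + card (member ds) ≤⟨ +-monoʳ-≤ (card A) (card-member ds) ⟩
    card A + length ds ∎
    where
    open ≤-Reasoning
    pointwise : ∀ a b → 𝟙 (a ∨ b) ≤ 𝟙 a + 𝟙 b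
    pointwise true  b = s≤s z≤n
    pointwise false b = ≤-refl
    card-member : ∀ ds → card (member ds) ≤ length ds
    card-member []       = ≤-reflexive (∑-zero (allFin n))
    card-member (d ∷ ds) = begin
      card (member (d ∷ ds))
        ≤⟨ ∑-mono (allFin n) (λ i → pointwise (does (i Fin.≟ d)) (member ds i)) ⟩
      ∑ (allFin n) (λ i → 𝟙? (i Fin.≟ d) + 𝟙 (member ds i))
        ≡⟨ ∑-+ (allFin n) _ _ ⟩
      ∑ (allFin n) (λ i → 𝟙? (i Fin.≟ d)) + card (member ds)
        ≤⟨ +-mono-≤ (≤-reflexive (trans (∑-cong (allFin n) (λ i → trans (𝟙?-cong (i Fin.≟ d) (d Fin.≟ i) sym sym) (sym (*-identityʳ _)))) (∑-single d (λ _ → 1)))) (card-member ds) ⟩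
      suc (length ds) ∎

module _ {a} {A : Set a} where

  -- Lists stand in for sets of at most `k` elements: order and repetition inflate the count, but
  -- `(1 + length xs) ^ k` is affordable.
  listsUpTo : ℕ → List A → List (List A)
  listsUpTo zero    xs = [] ∷ []
  listsUpTo (suc k) xs = [] ∷ concatMap (λ x → map (x ∷_) (listsUpTo k xs)) xs

  length-listsUpTo : ∀ k xs → length (listsUpTo k xs) ≤ suc (length xs) ^ k
  length-listsUpTo zero    xs = ≤-refl
  length-listsUpTo (suc k) xs = +-mono-≤ (m^n>0 (suc (length xs)) k) (begin
    length (concatMap (λ x → map (x ∷_) (listsUpTo k xs)) xs)
      ≡⟨ length-concatMap _ xs ⟩
    ∑ xs (λ x → length (map (x ∷_) (listsUpTo k xs)))
      ≡⟨ ∑-cong xs (λ x → length-map (x ∷_) (listsUpTo k xs)) ⟩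
    ∑ xs (λ x → length (listsUpTo k xs))
      ≡⟨ ∑-const xs _ ⟩
    length xs * length (listsUpTo k xs)
      ≤⟨ *-monoʳ-≤ (length xs) (length-listsUpTo k xs) ⟩
    length xs * suc (length xs) ^ k ∎)
    where open ≤-Reasoning

  ∈-listsUpTo : ∀ k xs {ys} → All (_∈ xs) ys → length ys ≤ k → ys ∈ listsUpTo k xs
  ∈-listsUpTo zero    xs []         _         = here refl
  ∈-listsUpTo (suc k) xs []         _         = here refl
  ∈-listsUpTo (suc k) xs (y∈ ∷ ys∈) (s≤s len) =
    there (∈-concatMap⁺ (λ x → map (x ∷_) (listsUpTo k xs)) (lose y∈ (∈-map⁺ (_ ∷_) (∈-listsUpTo k xs ys∈ len))))

  listsUpTo-bounded : ∀ k xs → All (λ ys → length ys ≤ k) (listsUpTo k xs)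
  listsUpTo-bounded zero    xs = z≤n ∷ []
  listsUpTo-bounded (suc k) xs = z≤n ∷ Allₚ.concat⁺ (Allₚ.map⁺ (All.universal
    (λ x → Allₚ.map⁺ (All.map s≤s (listsUpTo-bounded k xs))) xs))

All-concatMap : ∀ {a b p q} {A : Set a} {B : Set b} {P : B → Set p} {Q : A → Set q} (f : A → List B) {xs : List A} →
                (∀ x → Q x → All P (f x)) → All Q xs → All P (concatMap f xs)
All-concatMap f h []       = []
All-concatMap f h (q ∷ qs) = Allₚ.++⁺ (h _ q) (All-concatMap f h qs)

module Graph {n : ℕ} (η : Fin n → Fin n → Bool) where

  deg : Fin n → FinSet n → ℕ
  deg a B = card (λ j → B j ∧ η a j)

  edges : FinSet n → FinSet n → ℕ
  edges A B = ∑ (allFin n) (λ i → 𝟙 (A i) * deg i B)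

-- η is the graph of pairs that the pair of sets to be covered should (almost) avoid.
module Containers {n : ℕ} (η : Fin n → Fin n → Bool) (r₁ g M₀ b₀ : ℕ) where

  r Q : ℕ
  r = suc r₁
  Q = suc n * suc b₀ ^ g

  open Graph η
  Pair : Set
  Pair = FinSet n × FinSet n

  CoveredBy : FinSet n → FinSet n → Pair → Set
  CoveredBy X Y (A , B) = X ⊆ A × Y ⊆ B

  Small : ℕ → Pair → Set
  Small M (A , B) = card A + card B ≤ M

  -- `d` is the number of steps left. A step may remove up to `g` elements of `Y` from the second
  -- side: `g * d < card Y` keeps `Y` nonempty throughout, and restoring the removed elements raises
  -- the size bound by `g * d`.
  record Family (d : ℕ) (A B : FinSet n) : Set where
    field
      members : List Pair
      count   : length members ≤ Q ^ d
      small   : All (Small (M₀ + g * d)) members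
      covers  : ∀ X Y → X ⊆ A → Y ⊆ B → 1 ≤ card X → g * d < card Y →
                (∀ x → X x ≡ true → deg x Y ≤ g) → Any (CoveredBy X Y) members
  open Family

  module Step (d : ℕ) (ih : ∀ A B → r₁ ^ d * (card A * card B) < r ^ d → card B ≤ b₀ → Family d A B)
              (A B : FinSet n) (measure : r₁ ^ suc d * (card A * card B) < r ^ suc d) (B≤b₀ : card B ≤ b₀) where

    High : FinSet n
    High a = A a ∧ does (card B ≤? r * deg a B)

    A⁻ : FinSet n
    A⁻ a = A a ∧ not (does (card B ≤? r * deg a B))

    B⁻ : Fin n → FinSet n
    B⁻ x j = B j ∧ not (η x j)

    left-family : card A ≤ r * card High → Family d A⁻ B
    left-family h = ih A⁻ B (geometric-step r₁ d measure (begin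
      r * (card A⁻ * card B) ≡⟨ sym (*-assoc r (card A⁻) (card B)) ⟩
      r * card A⁻ * card B ≤⟨ *-monoˡ-≤ (card B) (shrink r₁ {card A} {card High} {card A⁻} (card-split A (λ a → does (card B ≤? r * deg a B))) h) ⟩
      r₁ * card A * card B ≡⟨ *-assoc r₁ _ _ ⟩
      r₁ * (card A * card B) ∎)) B≤b₀
      where open ≤-Reasoning

    right-family : ∀ x → High x ≡ true → Family d A (B⁻ x)
    right-family x hx = ih A (B⁻ x) (geometric-step r₁ d measure (begin
      r * (card A * card (B⁻ x)) ≡⟨ *-rotate r (card A) (card (B⁻ x)) ⟩
      card A * (r * card (B⁻ x)) ≤⟨ *-monoʳ-≤ (card A) (shrink r₁ (card-split B (η x)) (does⁻ (card B ≤? r * deg x B) (proj₂ (∧⁻ {A x} hx)))) ⟩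
      card A * (r₁ * card B) ≡⟨ sym (*-rotate r₁ (card A) (card B)) ⟩
      r₁ * (card A * card B) ∎)) (≤-trans (card-mono (λ j p → proj₁ (∧⁻ {B j} p))) B≤b₀)
      where open ≤-Reasoning

    losses : List (List (Fin n))
    losses = listsUpTo g (elems B)

    add : List (Fin n) → Pair → Pair
    add D (A′ , B′) = A′ , (B′ ∪ˡ D)

    children : Fin n → List Pair
    children x with High x Bool.≟ true
    ... | yes hx = concatMap (λ D → map (add D) (members (right-family x hx))) losses
    ... | no _   = []

    length-children : ∀ x → length (children x) ≤ suc b₀ ^ g * Q ^ d
    length-children x with High x Bool.≟ true
    ... | no _   = z≤n
    ... | yes hx = begin
      length (concatMap (λ D → map (add D) F) losses) ≡⟨ length-concatMap _ losses ⟩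
      ∑ losses (λ D → length (map (add D) F)) ≡⟨ ∑-cong losses (λ D → length-map (add D) F) ⟩
      ∑ losses (λ D → length F) ≡⟨ ∑-const losses _ ⟩
      length losses * length F ≤⟨ *-mono-≤ (≤-trans (length-listsUpTo g (elems B)) (^-monoˡ-≤ g (s≤s (≤-trans (≤-reflexive (length-elems B)) B≤b₀)))) (count (right-family x hx)) ⟩
      suc b₀ ^ g * Q ^ d ∎
      where
      open ≤-Reasoning
      F = members (right-family x hx)

    small-children : ∀ x → All (Small (M₀ + g * suc d)) (children x)
    small-children x with High x Bool.≟ true
    ... | no _   = []
    ... | yes hx = All-concatMap {P = Small (M₀ + g * suc d)} (λ D → map (add D) (members (right-family x hx)))
                     (λ D D≤g → Allₚ.map⁺ (All.map (λ {p} → bigger D D≤g {p}) (small (right-family x hx)))) (listsUpTo-bounded g (elems B))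
      where
      open ≤-Reasoning
      bigger : ∀ D → length D ≤ g → ∀ {p} → Small (M₀ + g * d) p → Small (M₀ + g * suc d) (add D p)
      bigger D D≤g {A′ , B′} h = begin
        card A′ + card (B′ ∪ˡ D) ≤⟨ +-monoʳ-≤ (card A′) (card-∪ˡ B′ D) ⟩
        card A′ + (card B′ + length D) ≡⟨ sym (+-assoc (card A′) _ _) ⟩
        card A′ + card B′ + length D ≤⟨ +-mono-≤ h D≤g ⟩
        M₀ + g * d + g ≡⟨ trans (+-assoc M₀ _ g) (cong (M₀ +_) (trans (+-comm (g * d) g) (sym (*-suc g d)))) ⟩
        M₀ + g * suc d ∎

    cover-children : ∀ x X Y → High x ≡ true → X x ≡ true → X ⊆ A → Y ⊆ B → g * suc d < card Y →
                     (∀ x → X x ≡ true → deg x Y ≤ g) → Any (CoveredBy X Y) (children x)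
    cover-children x X Y hx Xx X⊆A Y⊆B big low with High x Bool.≟ true
    ... | no ¬hx = ⊥-elim (¬hx hx)
    ... | yes hx = Anyₚ.concat⁺ (Anyₚ.map⁺ (lose D∈ (Anyₚ.map⁺ (Any.map widen
          (covers (right-family x hx) X Y⁻ X⊆A Y⁻⊆B⁻ (card-pos X Xx) big⁻ low⁻)))))
      where
      open ≤-Reasoning
      Y⁻ : FinSet n
      Y⁻ j = Y j ∧ not (η x j)
      lost : FinSet n
      lost j = Y j ∧ η x j
      D = elems lost
      D∈ : D ∈ losses
      D∈ = ∈-listsUpTo g (elems B) (All.tabulate (λ {j} j∈ → ∈-elems⁺ B (Y⊆B j (proj₁ (∧⁻ {Y j} (∈-elems⁻ lost j∈))))))
             (≤-trans (≤-reflexive (length-elems lost)) (low x Xx))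
      Y⁻⊆B⁻ : Y⁻ ⊆ B⁻ x
      Y⁻⊆B⁻ j p = ∧⁺ (Y⊆B j (proj₁ (∧⁻ {Y j} p))) (proj₂ (∧⁻ {Y j} p))
      big⁻ : g * d < card Y⁻
      big⁻ = +-cancelˡ-< g _ _ (begin-strict
        g + g * d ≡⟨ sym (*-suc g d) ⟩
        g * suc d <⟨ big ⟩
        card Y ≡⟨ card-split Y (η x) ⟩
        deg x Y + card Y⁻ ≤⟨ +-monoˡ-≤ (card Y⁻) (low x Xx) ⟩
        g + card Y⁻ ∎)
      low⁻ : ∀ x → X x ≡ true → deg x Y⁻ ≤ g
      low⁻ x′ Xx′ = ≤-trans (card-mono (λ j p → ∧⁺ (proj₁ (∧⁻ {Y j} (proj₁ (∧⁻ {Y⁻ j} p)))) (proj₂ (∧⁻ {Y⁻ j} p)))) (low x′ Xx′)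
      widen : ∀ {p} → CoveredBy X Y⁻ p → CoveredBy X Y (add D p)
      widen {A′ , B′} (X⊆ , Y⁻⊆) = X⊆ , λ j Yj → either j Yj (η x j) refl
        where
        either : ∀ j → Y j ≡ true → ∀ b → η x j ≡ b → (B′ ∪ˡ D) j ≡ true
        either j Yj true  eq = ∪ˡ⁺₂ B′ (∈-elems⁺ lost (∧⁺ Yj eq))
        either j Yj false eq = ∪ˡ⁺₁ B′ D (Y⁻⊆ j (∧⁺ Yj (cong not eq)))

    -- Either `X` contains no high vertex, and `A` loses all of them, at least the fraction `1/r`;
    -- or `X` contains a high `x`, and `B` loses the neighbours of `x`, again at least this
    -- fraction, of which at most `g` are in `Y`.
    branch : card A ≤ r * card High → Family (suc d) A B
    branch h .members = members (left-family h) ++ concatMap children (allFin n)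
    -- The summand 1 of the factor `suc n` in `Q` pays for the family without high vertices, the
    -- summand `n` for the choice of `x`.
    branch h .count = ≤-trans (≤-reflexive (length-++ (members (left-family h))))
      (≤-trans (+-mono-≤ (count (left-family h)) length-all) (absorb n (suc b₀ ^ g) (Q ^ d) (m^n>0 (suc b₀) g)))
      where
      length-all : length (concatMap children (allFin n)) ≤ n * (suc b₀ ^ g * Q ^ d)
      length-all = ≤-trans (≤-reflexive (length-concatMap children (allFin n)))
        (≤-trans (∑-mono (allFin n) length-children)
          (≤-reflexive (trans (∑-const (allFin n) _) (cong (_* (suc b₀ ^ g * Q ^ d)) (length-tabulate {n = n} id)))))
      absorb : ∀ n y x → 1 ≤ y → x + n * (y * x) ≤ suc n * y * x
      absorb n y x y≥1 = ≤-trans (+-monoˡ-≤ (n * (y * x)) (≤-trans (≤-reflexive (sym (+-identityʳ x))) (*-monoˡ-≤ x y≥1)))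
                                 (≤-reflexive (sym (*-assoc (suc n) y x)))
    branch h .small = Allₚ.++⁺ (All.map (λ {p} → grow {p}) (small (left-family h)))
                               (All-concatMap {P = Small (M₀ + g * suc d)} {Q = λ _ → ⊤} children (λ x _ → small-children x) (All.universal (λ _ → _) (allFin n)))
      where
      grow : ∀ {p} → Small (M₀ + g * d) p → Small (M₀ + g * suc d) p
      grow p = ≤-trans p (+-monoʳ-≤ M₀ (*-monoʳ-≤ g (n≤1+n d)))
    branch h .covers X Y X⊆A Y⊆B X≥1 big low with Finₚ.any? (λ x → (X x ∧ High x) Bool.≟ true)
    ... | yes (x , p) = Anyₚ.++⁺ʳ _ (Anyₚ.concat⁺ (Anyₚ.map⁺ (lose (∈-allFin x)
          (cover-children x X Y (proj₂ (∧⁻ {X x} p)) (proj₁ (∧⁻ {X x} p)) X⊆A Y⊆B big low))))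
    ... | no none = Anyₚ.++⁺ˡ (covers (left-family h) X Y X⊆A⁻ Y⊆B X≥1 (≤-<-trans (*-monoʳ-≤ g (n≤1+n d)) big) low)
      where
      X⊆A⁻ : X ⊆ A⁻
      X⊆A⁻ x Xx = either (does (card B ≤? r * deg x B)) refl
        where
        either : ∀ b → does (card B ≤? r * deg x B) ≡ b → A⁻ x ≡ true
        either false eq = ∧⁺ (X⊆A x Xx) (cong not eq)
        either true  eq = ⊥-elim (none (x , ∧⁺ Xx (∧⁺ (X⊆A x Xx) eq)))

    -- Fewer than `card A / r` vertices are high, with at most `card B` edges each; every other
    -- vertex of `A` has fewer than `card B / r` edges.
    sparse : ¬ card A ≤ r * card High → r * edges A B ≤ 2 * (card A * card B)
    sparse h = begin
      r * edges A B
        ≡⟨ sym (∑-*ˡ (allFin n) r _) ⟩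
      ∑ (allFin n) (λ i → r * (𝟙 (A i) * deg i B))
        ≤⟨ ∑-mono (allFin n) pointwise ⟩
      ∑ (allFin n) (λ i → 𝟙 (High i) * (r * card B) + 𝟙 (A i) * card B)
        ≡⟨ ∑-+ (allFin n) _ _ ⟩
      ∑ (allFin n) (λ i → 𝟙 (High i) * (r * card B)) + ∑ (allFin n) (λ i → 𝟙 (A i) * card B)
        ≡⟨ cong₂ _+_ (∑-*ʳ (allFin n) (r * card B) _) (∑-*ʳ (allFin n) (card B) _) ⟩
      card High * (r * card B) + card A * card B
        ≡⟨ cong (_+ card A * card B) (swap (card High) r (card B)) ⟩
      r * card High * card B + card A * card B
        ≤⟨ +-monoˡ-≤ (card A * card B) (*-monoˡ-≤ (card B) (<⇒≤ (≰⇒> h))) ⟩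
      card A * card B + card A * card B
        ≡⟨ cong (card A * card B +_) (sym (+-identityʳ _)) ⟩
      2 * (card A * card B) ∎
      where
      open ≤-Reasoning
      swap : ∀ p q s → p * (q * s) ≡ q * p * s
      swap = solve-∀
      deg≤ : ∀ i → deg i B ≤ card B
      deg≤ i = card-mono (λ j p → proj₁ (∧⁻ {B j} p))
      pointwise : ∀ i → r * (𝟙 (A i) * deg i B) ≤ 𝟙 (High i) * (r * card B) + 𝟙 (A i) * card B
      pointwise i = either (A i) (card B ≤? r * deg i B)
        where
        either : ∀ a (h : Dec (card B ≤ r * deg i B)) → r * (𝟙 a * deg i B) ≤ 𝟙 (a ∧ does h) * (r * card B) + 𝟙 a * card B
        either false _       = ≤-trans (≤-reflexive (*-zeroʳ r)) z≤n
        either true  (yes _) = ≤-trans (*-monoʳ-≤ r (≤-trans (≤-reflexive (+-identityʳ _)) (deg≤ i)))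
                                       (≤-trans (≤-reflexive (sym (+-identityʳ _))) (m≤m+n _ _))
        either true  (no ¬p) = ≤-trans (*-monoʳ-≤ r (≤-reflexive (+-identityʳ _)))
                                       (≤-trans (<⇒≤ (≰⇒> ¬p)) (≤-reflexive (sym (+-identityʳ _))))

  module _ (leaf : ∀ A B → 1 ≤ card A → 1 ≤ card B → r * edges A B ≤ 2 * (card A * card B) → card A + card B ≤ M₀) where

    Q^d≥1 : ∀ d → 1 ≤ Q ^ d
    Q^d≥1 d = m^n>0 Q ⦃ m*n≢0 (suc n) (suc b₀ ^ g) ⦃ _ ⦄ ⦃ m^n≢0 (suc b₀) g ⦄ ⦄ d

    family : ∀ d A B → r₁ ^ d * (card A * card B) < r ^ d → card B ≤ b₀ → Family d A B
    -- At depth 0 the measure forces `card A * card B = 0`, so no nonempty `X` and `Y` remain to be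
    -- covered.
    family zero A B h B≤ = record
      { members = []
      ; count   = z≤n
      ; small   = []
      ; covers  = λ X Y X⊆A Y⊆B X≥1 Y> _ → ⊥-elim (<⇒≱ h (≤-trans
          (*-mono-≤ (≤-trans X≥1 (card-mono X⊆A)) (≤-trans (≤-trans (s≤s z≤n) Y>) (card-mono Y⊆B))) (≤-reflexive (sym (+-identityʳ _)))))
      }
    family (suc d) A B h B≤ with card A ≤? r * card (Step.High d (family d) A B h B≤)
    ... | yes p = Step.branch d (family d) A B h B≤ p
    ... | no ¬p with 1 ≤? card A | 1 ≤? card B
    ...   | yes A≥1 | yes B≥1 = record
      { members = (A , B) ∷ []
      ; count   = Q^d≥1 (suc d)
      ; small   = ≤-trans (leaf A B A≥1 B≥1 (Step.sparse d (family d) A B h B≤ ¬p)) (m≤m+n _ _) ∷ []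
      ; covers  = λ X Y X⊆A Y⊆B _ _ _ → here (X⊆A , Y⊆B)
      }
    ...   | no A≱1 | _ = record
      { members = [] ; count = z≤n ; small = []
      ; covers = λ X Y X⊆A Y⊆B X≥1 Y> _ → ⊥-elim (A≱1 (≤-trans X≥1 (card-mono X⊆A))) }
    ...   | yes _ | no B≱1 = record
      { members = [] ; count = z≤n ; small = []
      ; covers = λ X Y X⊆A Y⊆B X≥1 Y> _ → ⊥-elim (B≱1 (≤-trans (≤-trans (s≤s z≤n) Y>) (card-mono Y⊆B))) }

-- Sampling

𝟙-∧ : ∀ a b → 𝟙 (a ∧ b) ≡ 𝟙 a * 𝟙 b
𝟙-∧ true  b = sym (+-identityʳ _)
𝟙-∧ false b = refl

-- κ x u names the sum of x and u; the two injectivity properties are cancellation in the group.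
module Sampling {n m : ℕ} (X₁ X₂ : FinSet n) (κ : Fin n → Fin n → Fin m)
  (κ-injʳ : ∀ {x u u′} → X₁ x ≡ true → X₂ u ≡ true → X₂ u′ ≡ true → κ x u ≡ κ x u′ → u ≡ u′)
  (κ-injˡ : ∀ {x x′ u} → X₁ x ≡ true → X₁ x′ ≡ true → X₂ u ≡ true → κ x u ≡ κ x′ u → x ≡ x′)
  (τ g : ℕ) where

  fibre : Fin n → Fin m → FinSet n
  fibre x k u = X₂ u ∧ does (κ x u Fin.≟ k)

  ρ : List (Fin n) → Fin m → ℕ
  ρ T k = ∑ T (λ x → card (fibre x k))

  poor : List (Fin n) → Fin n → ℕ
  poor T x = card (λ u → X₂ u ∧ does (ρ T (κ x u) <? τ))

  -- Representation counts truncated at the popularity threshold `τ`: the bound `m * τ` limits the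
  -- number of greedy choices, each of which gains more than `g`.
  potential : List (Fin n) → ℕ
  potential T = ∑ (allFin m) (λ k → τ ⊓ ρ T k)

  potential≤ : ∀ T → potential T ≤ m * τ
  potential≤ T = ≤-trans (∑-mono (allFin m) (λ k → m⊓n≤m τ (ρ T k)))
    (≤-reflexive (trans (∑-const (allFin m) τ) (cong (_* τ) (length-tabulate {n = m} id))))

  card-fibre : ∀ {x} → X₁ x ≡ true → ∀ k → card (fibre x k) ≤ 1
  card-fibre {x} Xx k with Finₚ.any? (λ u → fibre x k u Bool.≟ true)
  ... | no none = ≤-trans (≤-reflexive (trans (∑-cong (allFin n) (λ u → empty u (fibre x k u) refl)) (∑-zero (allFin n)))) z≤n
    where
    empty : ∀ u b → fibre x k u ≡ b → 𝟙 (fibre x k u) ≡ 0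
    empty u true  eq = ⊥-elim (none (u , eq))
    empty u false eq = cong 𝟙 eq
  ... | yes (u , p) = ≤-trans (∑-mono (allFin n) (λ u′ → unique u′ (fibre x k u′) refl))
                              (≤-reflexive (∑-single u (λ _ → 1)))
    where
    unique : ∀ u′ b → fibre x k u′ ≡ b → 𝟙 (fibre x k u′) ≤ 𝟙? (u Fin.≟ u′) * 1
    unique u′ false eq = ≤-trans (≤-reflexive (cong 𝟙 eq)) z≤n
    unique u′ true  eq = ≤-trans (≤-reflexive (cong 𝟙 eq)) (≤-reflexive (sym (cong (_* 1) (𝟙?-yes (u Fin.≟ u′) u≡u′))))
      where
      u≡u′ : u ≡ u′
      u≡u′ = κ-injʳ Xx (proj₁ (∧⁻ {X₂ u} p)) (proj₁ (∧⁻ {X₂ u′} eq))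
        (trans (does⁻ (κ x u Fin.≟ k) (proj₂ (∧⁻ {X₂ u} p))) (sym (does⁻ (κ x u′ Fin.≟ k) (proj₂ (∧⁻ {X₂ u′} eq)))))

  poor-by-colour : ∀ T x → poor T x ≡ ∑ (allFin m) (λ k → card (fibre x k) * 𝟙? (ρ T k <? τ))
  poor-by-colour T x = begin
    poor T x
      ≡⟨ ∑-cong (allFin n) (λ u → trans (𝟙-∧ (X₂ u) _) (cong (𝟙 (X₂ u) *_) (sym (∑-single (κ x u) low)))) ⟩
    ∑ (allFin n) (λ u → 𝟙 (X₂ u) * ∑ (allFin m) (λ k → 𝟙? (κ x u Fin.≟ k) * low k))
      ≡⟨ ∑-cong (allFin n) (λ u → sym (∑-*ˡ (allFin m) (𝟙 (X₂ u)) _)) ⟩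
    ∑ (allFin n) (λ u → ∑ (allFin m) (λ k → 𝟙 (X₂ u) * (𝟙? (κ x u Fin.≟ k) * low k)))
      ≡⟨ ∑-swap (allFin n) (allFin m) _ ⟩
    ∑ (allFin m) (λ k → ∑ (allFin n) (λ u → 𝟙 (X₂ u) * (𝟙? (κ x u Fin.≟ k) * low k)))
      ≡⟨ ∑-cong (allFin m) (λ k → trans (∑-cong (allFin n) (λ u → trans (sym (*-assoc (𝟙 (X₂ u)) _ _)) (cong (_* low k) (sym (𝟙-∧ (X₂ u) _)))))
                                        (∑-*ʳ (allFin n) (low k) _)) ⟩
    ∑ (allFin m) (λ k → card (fibre x k) * low k) ∎
    where
    open ≡-Reasoning
    low : Fin m → ℕ
    low k = 𝟙? (ρ T k <? τ)

  -- Adding `x` gives each of its unpopular sums a representation below the truncation level, and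
  -- `x` produces each sum at most once.
  gain : ∀ T {x} → X₁ x ≡ true → potential T + poor T x ≤ potential (x ∷ T)
  gain T {x} Xx = begin
    potential T + poor T x
      ≡⟨ cong (potential T +_) (poor-by-colour T x) ⟩
    potential T + ∑ (allFin m) (λ k → card (fibre x k) * 𝟙? (ρ T k <? τ))
      ≡⟨ sym (∑-+ (allFin m) _ _) ⟩
    ∑ (allFin m) (λ k → τ ⊓ ρ T k + card (fibre x k) * 𝟙? (ρ T k <? τ))
      ≤⟨ ∑-mono (allFin m) (λ k → pointwise (card (fibre x k)) (ρ T k) (card-fibre Xx k) (ρ T k <? τ)) ⟩
    potential (x ∷ T) ∎
    where
    open ≤-Reasoning
    pointwise : ∀ c ρ → c ≤ 1 → (h : Dec (ρ < τ)) → τ ⊓ ρ + c * 𝟙? h ≤ τ ⊓ (c + ρ)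
    pointwise c ρ c≤1 (no _) = ≤-trans (≤-reflexive (trans (cong (τ ⊓ ρ +_) (*-zeroʳ c)) (+-identityʳ _))) (⊓-monoʳ-≤ τ (m≤n+m ρ c))
    pointwise c ρ c≤1 (yes ρ<τ) = begin
      τ ⊓ ρ + c * 1 ≡⟨ cong₂ _+_ (m≥n⇒m⊓n≡n (<⇒≤ ρ<τ)) (*-identityʳ c) ⟩
      ρ + c ≡⟨ +-comm ρ c ⟩
      c + ρ ≡⟨ sym (m≥n⇒m⊓n≡n (≤-trans (+-monoˡ-≤ ρ c≤1) ρ<τ)) ⟩
      τ ⊓ (c + ρ) ∎

  record Rich : Set where
    field
      T₁       : List (Fin n)
      distinct : Unique T₁
      inside   : All (λ x → X₁ x ≡ true) T₁
      size     : length T₁ * suc g ≤ m * τ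
      rich     : ∀ x → X₁ x ≡ true → x ∉ T₁ → poor T₁ x ≤ g

  -- As long as some `x` outside `T` has more than `g` unpopular sums, adding it raises the
  -- potential by more than `g`. `fuel` exceeds the room left below `m * τ`, so it cannot run out.
  greedy₁ : ∀ fuel T → Unique T → All (λ x → X₁ x ≡ true) T → length T * suc g ≤ potential T →
            m * τ < potential T + fuel → Rich
  greedy₁ zero T _ _ _ h = ⊥-elim (<⇒≱ h (≤-trans (≤-reflexive (+-identityʳ _)) (potential≤ T)))
  greedy₁ (suc fuel) T dis ins siz h
    with Finₚ.any? (λ x → (X₁ x Bool.≟ true) ×-dec (¬? (any? (x Fin.≟_) T) ×-dec (suc g ≤? poor T x)))
  ... | yes (x , Xx , x∉T , bad) = greedy₁ fuel (x ∷ T) (Allₚ.¬Any⇒All¬ T x∉T ∷ dis) (Xx ∷ ins)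
          (≤-trans (≤-reflexive (+-comm (suc g) _)) (≤-trans (+-mono-≤ siz bad) (gain T Xx)))
          (≤-trans h (≤-trans (≤-reflexive (+-suc (potential T) fuel))
            (+-monoˡ-≤ fuel (≤-trans (≤-reflexive (+-comm 1 (potential T))) (≤-trans (+-monoʳ-≤ (potential T) (≤-trans (s≤s z≤n) bad)) (gain T Xx))))))
  ... | no none = record
    { T₁ = T ; distinct = dis ; inside = ins ; size = ≤-trans siz (potential≤ T)
    ; rich = λ x Xx x∉T → ≤-pred (≰⇒> (λ bad → none (x , Xx , x∉T , bad))) }

  module _ (T₁ : List (Fin n)) (distinct : Unique T₁) (inside : All (λ x → X₁ x ≡ true) T₁) where

    hit : Fin n → Fin m → Bool
    hit u k = does (any? (λ x → κ x u Fin.≟ k) T₁)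

    -- By cancellation, at most one `x` in the repetition-free list `T₁` has `κ x u = k`, so a
    -- representation is determined by its `u`.
    ρ≤hits : ∀ k → ρ T₁ k ≤ card (λ u → X₂ u ∧ hit u k)
    ρ≤hits k = ≤-trans (≤-reflexive (∑-swap T₁ (allFin n) _)) (∑-mono (allFin n) (λ u → pointwise u (X₂ u) refl T₁ distinct inside))
      where
      open ≤-Reasoning
      none : ∀ u T x → X₁ x ≡ true → X₂ u ≡ true → κ x u ≡ k → All (x ≢_) T → All (λ x → X₁ x ≡ true) T →
             ∑ T (λ x → 𝟙 (X₂ u ∧ does (κ x u Fin.≟ k))) ≡ 0
      none u []       x Xx Xu eq []         []        = refl
      none u (y ∷ T)  x Xx Xu eq (x≢y ∷ x∉) (Xy ∷ ins) =
        cong₂ _+_ (trans (𝟙-∧ (X₂ u) _) (trans (cong (𝟙 (X₂ u) *_) (𝟙?-no (κ y u Fin.≟ k) (λ eq′ → x≢y (κ-injˡ Xx Xy Xu (trans eq (sym eq′)))))) (*-zeroʳ (𝟙 (X₂ u)))))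
                  (none u T x Xx Xu eq x∉ ins)
      pointwise : ∀ u b → X₂ u ≡ b → ∀ T → Unique T → All (λ x → X₁ x ≡ true) T →
                  ∑ T (λ x → 𝟙 (X₂ u ∧ does (κ x u Fin.≟ k))) ≤ 𝟙 (X₂ u ∧ does (any? (λ x → κ x u Fin.≟ k) T))
      pointwise u b Xu [] _ _ = z≤n
      pointwise u false Xu (x ∷ T) (_ ∷ dis) (_ ∷ ins) =
        subst (λ c → 𝟙 (c ∧ does (κ x u Fin.≟ k)) + ∑ T (λ x → 𝟙 (c ∧ does (κ x u Fin.≟ k))) ≤ 𝟙 (c ∧ does (any? (λ x → κ x u Fin.≟ k) (x ∷ T))))
              (sym Xu) (≤-reflexive (∑-zero T))
      pointwise u true Xu (x ∷ T) (x∉ ∷ dis) (Xx ∷ ins) with κ x u Fin.≟ k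
      ... | yes eq = begin
        𝟙 (X₂ u ∧ true) + ∑ T (λ x → 𝟙 (X₂ u ∧ does (κ x u Fin.≟ k))) ≡⟨ cong (𝟙 (X₂ u ∧ true) +_) (none u T x Xx Xu eq x∉ ins) ⟩
        𝟙 (X₂ u ∧ true) + 0 ≡⟨ +-identityʳ _ ⟩
        𝟙 (X₂ u ∧ true) ∎
      ... | no _ = begin
        𝟙 (X₂ u ∧ false) + ∑ T (λ x → 𝟙 (X₂ u ∧ does (κ x u Fin.≟ k))) ≡⟨ cong (_+ ∑ T (λ x → 𝟙 (X₂ u ∧ does (κ x u Fin.≟ k)))) (trans (𝟙-∧ (X₂ u) false) (*-zeroʳ (𝟙 (X₂ u)))) ⟩
        ∑ T (λ x → 𝟙 (X₂ u ∧ does (κ x u Fin.≟ k))) ≤⟨ pointwise u true Xu T dis ins ⟩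
        𝟙 (X₂ u ∧ does (any? (λ x → κ x u Fin.≟ k) T)) ∎

    module _ (q₁ : ℕ) (X₂≥1 : 1 ≤ card X₂) (X₂≤ : card X₂ ≤ suc q₁ * τ) where

      -- Every colour in `W` is hit by at least `τ` of the at most `suc q₁ * τ` elements of `X₂`.
      -- Hence an average `u` hits at least the fraction `1 / suc q₁` of `W`, and choosing such
      -- elements shrinks `W` geometrically.
      greedy₂ : ∀ d (W : FinSet m) → (∀ k → W k ≡ true → τ ≤ card (λ u → X₂ u ∧ hit u k)) →
                q₁ ^ d * card W < suc q₁ ^ d →
                ∃ λ T₂ → length T₂ ≤ d × All (λ u → X₂ u ≡ true) T₂ × (∀ k → W k ≡ true → Any (λ u → hit u k ≡ true) T₂)
      greedy₂ zero W heavy h = [] , z≤n , [] , λ k Wk → ⊥-elim (<⇒≱ h (≤-trans (card-pos W Wk) (≤-reflexive (sym (+-identityʳ _)))))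
      greedy₂ (suc d) W heavy h = extend (∑-pick (elems X₂) (λ _ → τ * card W) (λ u → card X₂ * covered u)
                                            (≤-trans X₂≥1 (≤-reflexive (sym (length-elems X₂)))) average)
        where
        open ≤-Reasoning
        covered : Fin n → ℕ
        covered u = card (λ k → W k ∧ hit u k)
        average : ∑ (elems X₂) (λ _ → τ * card W) ≤ ∑ (elems X₂) (λ u → card X₂ * covered u)
        average = begin
          ∑ (elems X₂) (λ _ → τ * card W)
            ≡⟨ trans (∑-const (elems X₂) _) (cong (_* (τ * card W)) (length-elems X₂)) ⟩
          card X₂ * (τ * card W)
            ≤⟨ *-monoʳ-≤ (card X₂) (begin
              τ * card W
                ≡⟨ sym (∑-*ˡ (allFin m) τ _) ⟩
              ∑ (allFin m) (λ k → τ * 𝟙 (W k))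
                ≤⟨ ∑-mono (allFin m) (λ k → weigh k (W k) refl) ⟩
              ∑ (allFin m) (λ k → ∑ (allFin n) (λ u → 𝟙 (X₂ u) * 𝟙 (W k ∧ hit u k)))
                ≡⟨ ∑-swap (allFin m) (allFin n) _ ⟩
              ∑ (allFin n) (λ u → ∑ (allFin m) (λ k → 𝟙 (X₂ u) * 𝟙 (W k ∧ hit u k)))
                ≡⟨ ∑-cong (allFin n) (λ u → ∑-*ˡ (allFin m) (𝟙 (X₂ u)) _) ⟩
              ∑ (allFin n) (λ u → 𝟙 (X₂ u) * covered u)
                ≡⟨ sym (∑-elems X₂ covered) ⟩
              ∑ (elems X₂) covered ∎) ⟩
          card X₂ * ∑ (elems X₂) covered
            ≡⟨ sym (∑-*ˡ (elems X₂) (card X₂) covered) ⟩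
          ∑ (elems X₂) (λ u → card X₂ * covered u) ∎
          where
          weigh : ∀ k b → W k ≡ b → τ * 𝟙 (W k) ≤ ∑ (allFin n) (λ u → 𝟙 (X₂ u) * 𝟙 (W k ∧ hit u k))
          weigh k false eq = ≤-trans (≤-reflexive (trans (cong (λ b → τ * 𝟙 b) eq) (*-zeroʳ τ))) z≤n
          weigh k true  eq = begin
            τ * 𝟙 (W k) ≡⟨ trans (cong (λ b → τ * 𝟙 b) eq) (*-identityʳ τ) ⟩
            τ ≤⟨ heavy k eq ⟩
            card (λ u → X₂ u ∧ hit u k) ≡⟨ ∑-cong (allFin n) (λ u → trans (𝟙-∧ (X₂ u) (hit u k)) (cong (λ b → 𝟙 (X₂ u) * 𝟙 (b ∧ hit u k)) (sym eq))) ⟩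
            ∑ (allFin n) (λ u → 𝟙 (X₂ u) * 𝟙 (W k ∧ hit u k)) ∎
        extend : (∃ λ u → u ∈ elems X₂ × τ * card W ≤ card X₂ * covered u) → _
        extend (u , u∈ , p) with greedy₂ d W⁻ (λ k q → heavy k (proj₁ (∧⁻ {W k} q)))
                                    (geometric-step q₁ d h (shrink q₁ (card-split W (hit u)) most))
          where
          W⁻ : FinSet m
          W⁻ k = W k ∧ not (hit u k)
          most : card W ≤ suc q₁ * covered u
          most = *-cancelˡ-≤ (card X₂) ⦃ >-nonZero X₂≥1 ⦄ (begin
            card X₂ * card W ≤⟨ *-monoˡ-≤ (card W) X₂≤ ⟩
            suc q₁ * τ * card W ≡⟨ *-assoc (suc q₁) τ (card W) ⟩
            suc q₁ * (τ * card W) ≤⟨ *-monoʳ-≤ (suc q₁) p ⟩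
            suc q₁ * (card X₂ * covered u) ≡⟨ *-rotate (suc q₁) (card X₂) (covered u) ⟩
            card X₂ * (suc q₁ * covered u) ∎)
        ... | T₂ , len , ins , cov = u ∷ T₂ , s≤s len , ∈-elems⁻ X₂ u∈ ∷ ins , λ k Wk → decide k Wk (hit u k) refl
          where
          decide : ∀ k → W k ≡ true → ∀ b → hit u k ≡ b → Any (λ u → hit u k ≡ true) (u ∷ T₂)
          decide k Wk true  eq = here eq
          decide k Wk false eq = there (cov k (∧⁺ Wk (cong not eq)))

  record Sample (d : ℕ) : Set where
    field
      T₁ T₂   : List (Fin n)
      inside₁ : All (λ x → X₁ x ≡ true) T₁
      inside₂ : All (λ u → X₂ u ≡ true) T₂
      size₁   : length T₁ * suc g ≤ m * τ
      size₂   : length T₂ ≤ d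
      sparse  : ∀ x (η : FinSet n) → X₁ x ≡ true → x ∉ T₁ →
                (∀ u x′ u′ → X₂ u ≡ true → x′ ∈ T₁ → u′ ∈ T₂ → κ x′ u′ ≡ κ x u → η u ≡ false) →
                card (λ u → X₂ u ∧ η u) ≤ g

  -- `greedy₂` is applied to the popular colours. If `κ x u` is popular, some `x′` in `T₁` and `u′`
  -- in `T₂` have the same colour, and `η u` is false; so only the unpopular sums of `x` count, and
  -- they number at most `g`.
  sample : ∀ q₁ d → 1 ≤ card X₂ → card X₂ ≤ suc q₁ * τ → q₁ ^ d * m < suc q₁ ^ d → Sample d
  sample q₁ d X₂≥1 X₂≤ h with greedy₁ (suc (m * τ)) [] [] [] z≤n (m≤n+m (suc (m * τ)) (potential []))
  ... | record { T₁ = T₁ ; distinct = dis ; inside = ins ; size = siz ; rich = rich }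
    with greedy₂ T₁ dis ins q₁ X₂≥1 X₂≤ d (λ k → does (τ ≤? ρ T₁ k))
           (λ k p → ≤-trans (does⁻ (τ ≤? ρ T₁ k) p) (ρ≤hits T₁ dis ins k))
           (≤-<-trans (*-monoʳ-≤ (q₁ ^ d) (≤-trans (∑-mono (allFin m) (λ k → 𝟙≤1 _)) (≤-reflexive (trans (∑-1 (allFin m)) (length-tabulate {n = m} id))))) h)
  ...   | T₂ , len , ins₂ , cov = record
    { T₁ = T₁ ; T₂ = T₂ ; inside₁ = ins ; inside₂ = ins₂ ; size₁ = siz ; size₂ = len
    ; sparse = λ x η Xx x∉ η-free → ≤-trans (card-mono (λ u p →
        ∧⁺ (proj₁ (∧⁻ {X₂ u} p)) (does⁺ (ρ T₁ (κ x u) <? τ) (≰⇒> (λ τ≤ → uncovered x η u η-free (∧⁻ {X₂ u} p) τ≤))))) (rich x Xx x∉) }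
    where
    uncovered : ∀ x (η : FinSet n) u → (∀ u x′ u′ → X₂ u ≡ true → x′ ∈ T₁ → u′ ∈ T₂ → κ x′ u′ ≡ κ x u → η u ≡ false) →
                X₂ u ≡ true × η u ≡ true → ¬ τ ≤ ρ T₁ (κ x u)
    uncovered x η u η-free (Xu , ηu) τ≤ with find (cov (κ x u) (does⁺ (τ ≤? ρ T₁ (κ x u)) τ≤))
    ... | u′ , u′∈ , p with find (does⁻ (any? (λ y → κ y u′ Fin.≟ κ x u) T₁) p)
    uncovered x η u η-free (Xu , ηu) τ≤ | u′ , u′∈ , p | x′ , x′∈ , eq with trans (sym ηu) (η-free u x′ u′ Xu x′∈ u′∈ eq)
    ... | ()

-- Decidability of finitely generated subgroups up to double negation

module Generated {c ℓ} (G : AbelianGroup c ℓ) where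
  open AbelianGroup G hiding (refl; sym; trans)
  open AbelianGroup G using () renaming (refl to ≈-refl; sym to ≈-sym; trans to ≈-trans)
  open import Algebra.Properties.AbelianGroup G using (∙-cancelˡ; ∙-cancelʳ; inverseˡ-unique; ε⁻¹≈ε)
  open import Algebra.Properties.Monoid.Mult monoid using (×-homo-+; ×-assocˡ; ×-congˡ) renaming (_×_ to _·_)
  open import Relation.Binary.Reasoning.Setoid setoid

  -- The equation says, additively, `x = (p − q) g + y` without negative multiples.
  Gen : List Carrier → Carrier → Set (c ⊔ ℓ)
  Gen []       x = Level.Lift c (x ≈ ε)
  Gen (g ∷ gs) x = ∃ λ p → ∃ λ q → ∃ λ y → Gen gs y × x ∙ (q · g) ≈ (p · g) ∙ y

  gen-resp : ∀ gs {x y} → x ≈ y → Gen gs x → Gen gs y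
  gen-resp []       x≈y (Level.lift x≈ε) = Level.lift (≈-trans (≈-sym x≈y) x≈ε)
  gen-resp (g ∷ gs) x≈y (p , q , z , Gz , eq) = p , q , z , Gz , ≈-trans (∙-congʳ (≈-sym x≈y)) eq

  gen-weaken : ∀ g gs {x} → Gen gs x → Gen (g ∷ gs) x
  gen-weaken g gs {x} Gx = 0 , 0 , x , Gx , comm x ε

  gen-ε : ∀ gs → Gen gs ε
  gen-ε []       = Level.lift ≈-refl
  gen-ε (g ∷ gs) = gen-weaken g gs (gen-ε gs)

  gen-∈ : ∀ {gs g} → g ∈ gs → Gen gs g
  gen-∈ {g ∷ gs} (here refl) = 1 , 0 , ε , gen-ε gs , ∙-congʳ (≈-sym (identityʳ g))
  gen-∈ {g ∷ gs} (there g∈)    = gen-weaken g gs (gen-∈ g∈)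

  gen-∙ : ∀ gs {x y} → Gen gs x → Gen gs y → Gen gs (x ∙ y)
  gen-∙ []       (Level.lift p) (Level.lift q) = Level.lift (≈-trans (∙-cong p q) (identityˡ ε))
  gen-∙ (g ∷ gs) {x} {x′} (p , q , y , Gy , eq) (p′ , q′ , y′ , Gy′ , eq′) =
    p + p′ , q + q′ , y ∙ y′ , gen-∙ gs Gy Gy′ , (begin
      (x ∙ x′) ∙ ((q + q′) · g) ≈⟨ ∙-congˡ (×-homo-+ g q q′) ⟩
      (x ∙ x′) ∙ ((q · g) ∙ (q′ · g)) ≈⟨ interchange commutativeSemigroup x x′ _ _ ⟩
      (x ∙ (q · g)) ∙ (x′ ∙ (q′ · g)) ≈⟨ ∙-cong eq eq′ ⟩
      ((p · g) ∙ y) ∙ ((p′ · g) ∙ y′) ≈⟨ interchange commutativeSemigroup (p · g) y _ _ ⟩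
      ((p · g) ∙ (p′ · g)) ∙ (y ∙ y′) ≈⟨ ∙-congʳ (≈-sym (×-homo-+ g p p′)) ⟩
      ((p + p′) · g) ∙ (y ∙ y′) ∎)

  gen-⁻¹ : ∀ gs {x} → Gen gs x → Gen gs (x ⁻¹)
  gen-⁻¹ []       (Level.lift p) = Level.lift (≈-trans (⁻¹-cong p) ε⁻¹≈ε)
  gen-⁻¹ (g ∷ gs) {x} (p , q , y , Gy , eq) = q , p , y ⁻¹ , gen-⁻¹ gs Gy , (begin
    x ⁻¹ ∙ (p · g) ≈⟨ ∙-congˡ (≈-sym (≈-trans (assoc _ y (y ⁻¹)) (≈-trans (∙-congˡ (inverseʳ y)) (identityʳ _)))) ⟩
    x ⁻¹ ∙ (((p · g) ∙ y) ∙ y ⁻¹) ≈⟨ ∙-congˡ (∙-congʳ (≈-sym eq)) ⟩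
    x ⁻¹ ∙ ((x ∙ (q · g)) ∙ y ⁻¹) ≈⟨ ∙-congˡ (assoc x _ _) ⟩
    x ⁻¹ ∙ (x ∙ ((q · g) ∙ y ⁻¹)) ≈⟨ ≈-sym (assoc (x ⁻¹) x _) ⟩
    (x ⁻¹ ∙ x) ∙ ((q · g) ∙ y ⁻¹) ≈⟨ ≈-trans (∙-congʳ (inverseˡ x)) (identityˡ _) ⟩
    (q · g) ∙ y ⁻¹ ∎)

  gen-· : ∀ gs n {x} → Gen gs x → Gen gs (n · x)
  gen-· gs zero    Gx = gen-ε gs
  gen-· gs (suc n) Gx = gen-∙ gs Gx (gen-· gs n Gx)

  DecidesIdentity : List Carrier → Set (c ⊔ ℓ)
  DecidesIdentity gs = ∀ x → Gen gs x → Dec (x ≈ ε)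

  -- suc r is the order of g modulo the subgroup generated by gs.
  IsOrder : List Carrier → Carrier → ℕ → Set (c ⊔ ℓ)
  IsOrder gs g r = Gen gs (suc r · g) × (∀ t → t < r → ¬ Gen gs (suc t · g))

  -- Membership in the generated subgroup is not known to be decidable, so the least-number
  -- principle is available only under a double negation.
  least : ∀ gs g r → Gen gs (suc r · g) → ¬ ¬ ∃ (IsOrder gs g)
  least gs g = <-rec (λ r → Gen gs (suc r · g) → ¬ ¬ ∃ (IsOrder gs g)) step
    where
    step : ∀ r → (∀ {t} → t < r → Gen gs (suc t · g) → ¬ ¬ ∃ (IsOrder gs g)) → Gen gs (suc r · g) → ¬ ¬ ∃ (IsOrder gs g)
    step r rec Gr k = ¬¬-excluded-middle {A = ∃ λ t → t < r × Gen gs (suc t · g)} λ where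
      (yes (t , t<r , Gt)) → rec t<r Gt k
      (no none)            → k (r , Gr , λ t t<r Gt → none (t , t<r , Gt))

  -- If `x` is the identity, the multiple of `g` by the difference of `p` and `q` lies in the
  -- subgroup generated by `gs`. So `p ≠ q` excludes `x ≈ ε`, and for `p = q` the element `x` is
  -- `y`.
  infinite-order : ∀ gs g → DecidesIdentity gs → ¬ (∃ λ r → Gen gs (suc r · g)) → DecidesIdentity (g ∷ gs)
  infinite-order gs g dec none x (p , q , y , Gy , eq) with <-cmp p q
  ... | tri≈ _ refl _ = map′ (λ y≈ε → ≈-trans x≈y y≈ε) (λ x≈ε → ≈-trans (≈-sym x≈y) x≈ε) (dec y Gy)
    where
    x≈y : x ≈ y
    x≈y = ∙-cancelˡ (p · g) x y (≈-trans (comm _ x) eq)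
  ... | tri< p<q _ _ with m≤n⇒∃[o]m+o≡n p<q
  ...   | t , refl = no λ x≈ε → none (t , gen-resp gs (≈-sym (∙-cancelˡ (p · g) _ _ (begin
            (p · g) ∙ (suc t · g) ≈⟨ ≈-sym (×-homo-+ g p (suc t)) ⟩
            (p + suc t) · g ≈⟨ ×-congˡ (+-suc p t) ⟩
            suc (p + t) · g ≈⟨ ≈-sym (identityˡ _) ⟩
            ε ∙ (suc (p + t) · g) ≈⟨ ∙-congʳ (≈-sym x≈ε) ⟩
            x ∙ (suc (p + t) · g) ≈⟨ eq ⟩
            (p · g) ∙ y ∎))) Gy)
  infinite-order gs g dec none x (p , q , y , Gy , eq) | tri> _ _ q<p with m≤n⇒∃[o]m+o≡n q<p
  ...   | t , refl = no λ x≈ε → none (t , gen-resp gs (≈-sym (inverseˡ-unique _ y (∙-cancelˡ (q · g) _ _ (begin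
            (q · g) ∙ ((suc t · g) ∙ y) ≈⟨ ≈-sym (assoc _ _ y) ⟩
            ((q · g) ∙ (suc t · g)) ∙ y ≈⟨ ∙-congʳ (≈-sym (×-homo-+ g q (suc t))) ⟩
            ((q + suc t) · g) ∙ y ≈⟨ ∙-congʳ (×-congˡ (+-suc q t)) ⟩
            (suc (q + t) · g) ∙ y ≈⟨ ≈-sym eq ⟩
            x ∙ (q · g) ≈⟨ ≈-trans (∙-congʳ x≈ε) (comm ε _) ⟩
            (q · g) ∙ ε ∎)))) (gen-⁻¹ gs Gy))

  -- The coefficient of `g` is reduced modulo the order `suc r`, the rest moving into `y′`. A
  -- nonzero remainder excludes `x ≈ ε` by minimality of the order; if the remainder is 0, then `x`
  -- is `y′`.
  finite-order : ∀ gs g r → IsOrder gs g r → DecidesIdentity gs → DecidesIdentity (g ∷ gs)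
  finite-order gs g r (Gz , min) dec x (p , q , y , Gy , eq) = decide (N % suc r) (m%n<n N (suc r)) x≈
    where
    N : ℕ
    -- `− q` is congruent to `q * r` modulo `suc r`, so `N` is a nonnegative coefficient congruent
    -- to `p − q`.
    N = p + q * r
    z : Carrier
    z = suc r · g
    y′ : Carrier
    y′ = (((N / suc r) · z) ∙ y) ∙ (q · z) ⁻¹
    Gy′ : Gen gs y′
    Gy′ = gen-∙ gs (gen-∙ gs (gen-· gs (N / suc r) Gz) Gy) (gen-⁻¹ gs (gen-· gs q Gz))
    x∙qz : x ∙ (q · z) ≈ (N · g) ∙ y
    x∙qz = begin
      x ∙ (q · z) ≈⟨ ∙-congˡ (≈-trans (×-assocˡ g q (suc r)) (×-congˡ (*-suc q r))) ⟩
      x ∙ ((q + q * r) · g) ≈⟨ ∙-congˡ (×-homo-+ g q (q * r)) ⟩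
      x ∙ ((q · g) ∙ ((q * r) · g)) ≈⟨ ≈-sym (assoc x _ _) ⟩
      (x ∙ (q · g)) ∙ ((q * r) · g) ≈⟨ ∙-congʳ eq ⟩
      ((p · g) ∙ y) ∙ ((q * r) · g) ≈⟨ ≈-trans (assoc _ y _) (≈-trans (∙-congˡ (comm y _)) (≈-sym (assoc _ _ y))) ⟩
      ((p · g) ∙ ((q * r) · g)) ∙ y ≈⟨ ∙-congʳ (≈-sym (×-homo-+ g p (q * r))) ⟩
      (N · g) ∙ y ∎
    x≈ : x ≈ ((N % suc r) · g) ∙ y′
    x≈ = begin
      x ≈⟨ ≈-sym (≈-trans (assoc x _ _) (≈-trans (∙-congˡ (inverseʳ (q · z))) (identityʳ x))) ⟩
      (x ∙ (q · z)) ∙ (q · z) ⁻¹ ≈⟨ ∙-congʳ x∙qz ⟩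
      ((N · g) ∙ y) ∙ (q · z) ⁻¹ ≈⟨ ∙-congʳ (∙-congʳ (×-congˡ (m≡m%n+[m/n]*n N (suc r)))) ⟩
      (((N % suc r + N / suc r * suc r) · g) ∙ y) ∙ (q · z) ⁻¹
        ≈⟨ ∙-congʳ (∙-congʳ (≈-trans (×-homo-+ g (N % suc r) _) (∙-congˡ (≈-sym (×-assocˡ g (N / suc r) (suc r)))))) ⟩
      ((((N % suc r) · g) ∙ ((N / suc r) · z)) ∙ y) ∙ (q · z) ⁻¹
        ≈⟨ ≈-trans (∙-congʳ (assoc _ _ y)) (assoc _ _ _) ⟩
      ((N % suc r) · g) ∙ y′ ∎
    decide : ∀ k → k < suc r → x ≈ (k · g) ∙ y′ → Dec (x ≈ ε)
    decide zero    _         e = map′ (≈-trans (≈-trans e (identityˡ y′))) (≈-trans (≈-sym (≈-trans e (identityˡ y′)))) (dec y′ Gy′)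
    decide (suc t) (s≤s t<r) e = no λ x≈ε → min t t<r (gen-resp gs (≈-sym (inverseˡ-unique _ y′ (≈-trans (≈-sym e) x≈ε))) (gen-⁻¹ gs Gy′))

  -- Each generator costs one case distinction on whether it has finite order modulo the later ones,
  -- and one choice of a least order; finitely many of these can be made under a double negation.
  ¬¬-decidesIdentity : ∀ gs → ¬ ¬ DecidesIdentity gs
  ¬¬-decidesIdentity []       k = k λ { x (Level.lift p) → yes p }
  ¬¬-decidesIdentity (g ∷ gs) k = ¬¬-decidesIdentity gs λ dec →
    ¬¬-excluded-middle {A = ∃ λ r → Gen gs (suc r · g)} λ where
      (no none)      → k (infinite-order gs g dec none)
      (yes (r , Gr)) → least gs g r Gr λ { (r′ , ord) → k (finite-order gs g r′ ord dec) }

  generated : List Carrier → AbelianGroup (c ⊔ ℓ) ℓ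
  generated gs = record
    { Carrier = Σ Carrier (Gen gs)
    ; _≈_     = λ x y → proj₁ x ≈ proj₁ y
    ; _∙_     = λ x y → proj₁ x ∙ proj₁ y , gen-∙ gs (proj₂ x) (proj₂ y)
    ; ε       = ε , gen-ε gs
    ; _⁻¹     = λ x → proj₁ x ⁻¹ , gen-⁻¹ gs (proj₂ x)
    ; isAbelianGroup = record
      { isGroup = record
        { isMonoid = record
          { isSemigroup = record
            { isMagma = record
              { isEquivalence = record { refl = ≈-refl ; sym = ≈-sym ; trans = ≈-trans }
              ; ∙-cong        = ∙-cong }
            ; assoc = λ x y z → assoc (proj₁ x) (proj₁ y) (proj₁ z) }
          ; identity = (λ x → identityˡ (proj₁ x)) , (λ x → identityʳ (proj₁ x)) }
        ; inverse = (λ x → inverseˡ (proj₁ x)) , (λ x → inverseʳ (proj₁ x))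
        ; ⁻¹-cong = ⁻¹-cong }
      ; comm = λ x y → comm (proj₁ x) (proj₁ y) }
    }

  ¬¬-decidable : ∀ gs → ¬ ¬ (∀ x y → Dec (AbelianGroup._≈_ (generated gs) x y))
  ¬¬-decidable gs k = ¬¬-decidesIdentity gs λ dec → k λ where
    (x , Gx) (y , Gy) → map′ (λ p → ∙-cancelʳ (y ⁻¹) x y (≈-trans p (≈-sym (inverseʳ y)))) (λ x≈y → ≈-trans (∙-congʳ x≈y) (inverseʳ y))
                             (dec (x ∙ y ⁻¹) (gen-∙ gs Gx (gen-⁻¹ gs Gy)))

  -- Through this, the maximality in `IsBeta`, a statement on `G`, bounds the subgroups met in the
  -- generated group.
  generated-subgroup : ∀ gs k → HasSubgroupOfSize (generated gs) k → HasSubgroupOfSize G k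
  generated-subgroup gs k (h , inj , one , mul , inv) = (λ i → proj₁ (h i)) , inj , one , mul , inv

-- Binomial coefficients

bin : ℕ → ℕ → ℕ
bin n       zero    = 1
bin zero    (suc k) = 0
bin (suc n) (suc k) = bin n k + bin n (suc k)

bin-absorb : ∀ n k → suc k * bin (suc n) (suc k) ≡ suc n * bin n k
bin-absorb zero    zero    = refl
bin-absorb zero    (suc k) = *-zeroʳ (suc (suc k))
bin-absorb (suc n) zero    = cong suc (trans (+-identityʳ _) (trans (sym (+-identityʳ _)) (bin-absorb n zero)))
bin-absorb (suc n) (suc k) = begin
  suc (suc k) * (bin (suc n) (suc k) + bin (suc n) (suc (suc k)))
    ≡⟨ expand k (bin (suc n) (suc k)) (bin (suc n) (suc (suc k))) ⟩
  bin (suc n) (suc k) + (suc k * bin (suc n) (suc k) + suc (suc k) * bin (suc n) (suc (suc k)))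
    ≡⟨ cong (bin (suc n) (suc k) +_) (cong₂ _+_ (bin-absorb n k) (bin-absorb n (suc k))) ⟩
  bin (suc n) (suc k) + (suc n * bin n k + suc n * bin n (suc k))
    ≡⟨ cong (bin (suc n) (suc k) +_) (sym (*-distribˡ-+ (suc n) (bin n k) (bin n (suc k)))) ⟩
  suc (suc n) * bin (suc n) (suc k) ∎
  where
  open ≡-Reasoning
  expand : ∀ k x y → suc (suc k) * (x + y) ≡ x + (suc k * x + suc (suc k) * y)
  expand = solve-∀

bin-upper : ∀ n k → suc n * bin n k + k * bin (suc n) k ≡ suc n * bin (suc n) k
bin-upper n zero    = +-identityʳ _
bin-upper n (suc k) = begin
  suc n * bin n (suc k) + suc k * bin (suc n) (suc k) ≡⟨ cong (suc n * bin n (suc k) +_) (bin-absorb n k) ⟩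
  suc n * bin n (suc k) + suc n * bin n k ≡⟨ sym (*-distribˡ-+ (suc n) (bin n (suc k)) (bin n k)) ⟩
  suc n * (bin n (suc k) + bin n k) ≡⟨ cong (suc n *_) (+-comm (bin n (suc k)) (bin n k)) ⟩
  suc n * bin (suc n) (suc k) ∎
  where open ≡-Reasoning

bin-next : ∀ n k → suc k * bin n (suc k) ≡ (n ∸ k) * bin n k
bin-next n k = trans (sym (m+n∸n≡m (suc k * bin n (suc k)) (k * bin n k)))
                     (trans (cong (_∸ k * bin n k) (sum n)) (sym (*-distribʳ-∸ (bin n k) n k)))
  where
  sum : ∀ n → suc k * bin n (suc k) + k * bin n k ≡ n * bin n k
  sum zero    = trans (cong (_+ k * bin 0 k) (*-zeroʳ (suc k))) (zero-case k)
    where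
    zero-case : ∀ k → k * bin 0 k ≡ 0
    zero-case zero    = refl
    zero-case (suc k) = *-zeroʳ (suc k)
  sum (suc n) = trans (cong (_+ k * bin (suc n) k) (bin-absorb n k)) (bin-upper n k)

bin-zero : ∀ {n k} → n < k → bin n k ≡ 0
bin-zero {zero}  (s≤s _) = refl
bin-zero {suc n} (s≤s p) = cong₂ _+_ (bin-zero p) (bin-zero (≤-trans p (n≤1+n _)))

bin-diag : ∀ n → bin n n ≡ 1
bin-diag zero    = refl
bin-diag (suc n) = cong₂ _+_ (bin-diag n) (bin-zero (n<1+n n))

-- The left side is one term of the binomial expansion of `(y + 1) ^ n`.
bin-power : ∀ y n k → bin n k * y ^ k ≤ suc y ^ n
bin-power y n       zero    = m^n>0 (suc y) n
bin-power y zero    (suc k) = z≤n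
bin-power y (suc n) (suc k) = begin
  (bin n k + bin n (suc k)) * (y * y ^ k) ≡⟨ expand (bin n k) (bin n (suc k)) y (y ^ k) ⟩
  bin n (suc k) * (y * y ^ k) + y * (bin n k * y ^ k) ≤⟨ +-mono-≤ (bin-power y n (suc k)) (*-monoʳ-≤ y (bin-power y n k)) ⟩
  suc y ^ suc n ∎
  where
  open ≤-Reasoning
  expand : ∀ a b y z → (a + b) * (y * z) ≡ b * (y * z) + y * (a * z)
  expand = solve-∀

module _ (s₁ s₂ : ℕ) where

  -- The quotient of `bin (suc a) s` by `bin a s` is `(a + 1) / (a + 1 − s)`, and the hypothesis
  -- compares these quotients for the two parts; `bin-upper` expresses them without division.
  move : ∀ a₁ a₂ → s₁ * suc a₂ ≤ s₂ * suc a₁ → bin (suc a₁) s₁ * bin a₂ s₂ ≤ bin a₁ s₁ * bin (suc a₂) s₂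
  move a₁ a₂ h = *-cancelˡ-≤ (suc a₁ * suc a₂) ⦃ m*n≢0 (suc a₁) (suc a₂) ⦄ (+-cancelʳ-≤ (s₂ * suc a₁ * (x * y′)) _ _ (begin
    suc a₁ * suc a₂ * (x * y) + s₂ * suc a₁ * (x * y′) ≡⟨ left (suc a₁) (suc a₂) s₂ x y y′ ⟩
    suc a₁ * x * (suc a₂ * y + s₂ * y′) ≡⟨ cong (suc a₁ * x *_) (bin-upper a₂ s₂) ⟩
    suc a₁ * x * (suc a₂ * y′) ≡⟨ cong (_* (suc a₂ * y′)) (sym (bin-upper a₁ s₁)) ⟩
    (suc a₁ * x′ + s₁ * x) * (suc a₂ * y′) ≡⟨ right (suc a₁) (suc a₂) s₁ x x′ y′ ⟩
    suc a₁ * suc a₂ * (x′ * y′) + s₁ * suc a₂ * (x * y′) ≤⟨ +-monoʳ-≤ (suc a₁ * suc a₂ * (x′ * y′)) (*-monoˡ-≤ (x * y′) h) ⟩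
    suc a₁ * suc a₂ * (x′ * y′) + s₂ * suc a₁ * (x * y′) ∎))
    where
    open ≤-Reasoning
    x  = bin (suc a₁) s₁
    x′ = bin a₁ s₁
    y  = bin a₂ s₂
    y′ = bin (suc a₂) s₂
    left : ∀ a b s x y y′ → a * b * (x * y) + s * a * (x * y′) ≡ a * x * (b * y + s * y′)
    left = solve-∀
    right : ∀ a b s x x′ y′ → (a * x′ + s * x) * (b * y′) ≡ a * b * (x′ * y′) + s * b * (x * y′)
    right = solve-∀

  Balanced : (N a₁ a₂ : ℕ) → Set
  Balanced N a₁ a₂ = a₁ * (s₁ + s₂) ≤ s₁ * N × a₂ * (s₁ + s₂) ≤ s₂ * N

  -- If the first part exceeds its share, the strict inequality `a₁ + a₂ < N` leaves the second part
  -- room for one more unit.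
  balance′ : ∀ N a₁ a₂ → a₁ + a₂ < N → a₂ * (s₁ + s₂) ≤ s₂ * N →
             ∃ λ b₁ → ∃ λ b₂ → Balanced N b₁ b₂ × bin a₁ s₁ * bin a₂ s₂ ≤ bin b₁ s₁ * bin b₂ s₂
  balance′ N zero     a₂ _ h₂ = zero , a₂ , (z≤n , h₂) , ≤-refl
  balance′ N (suc a₁) a₂ a<N h₂ with suc a₁ * (s₁ + s₂) ≤? s₁ * N
  ... | yes h₁ = suc a₁ , a₂ , (h₁ , h₂) , ≤-refl
  ... | no h₁ with balance′ N a₁ (suc a₂) (≤-trans (≤-reflexive (cong suc (+-suc a₁ a₂))) a<N) h₂′
    where
    open ≤-Reasoning
    h₂′ : suc a₂ * (s₁ + s₂) ≤ s₂ * N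
    h₂′ = +-cancelˡ-≤ (s₁ * N) _ _ (begin
      s₁ * N + suc a₂ * (s₁ + s₂) ≤⟨ +-monoˡ-≤ (suc a₂ * (s₁ + s₂)) (<⇒≤ (≰⇒> h₁)) ⟩
      suc a₁ * (s₁ + s₂) + suc a₂ * (s₁ + s₂) ≡⟨ collect a₁ a₂ (s₁ + s₂) ⟩
      suc (suc a₁ + a₂) * (s₁ + s₂) ≤⟨ *-monoˡ-≤ (s₁ + s₂) a<N ⟩
      N * (s₁ + s₂) ≡⟨ trans (*-comm N (s₁ + s₂)) (*-distribʳ-+ N s₁ s₂) ⟩
      s₁ * N + s₂ * N ∎)
      where
      collect : ∀ a b s → suc a * s + suc b * s ≡ suc (suc a + b) * s
      collect = solve-∀
  ...   | b₁ , b₂ , bal , le = b₁ , b₂ , bal , ≤-trans (move a₁ a₂ h) le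
    where
    open ≤-Reasoning
    h : s₁ * suc a₂ ≤ s₂ * suc a₁
    h = +-cancelˡ-≤ (s₁ * suc a₁) _ _ (begin
      s₁ * suc a₁ + s₁ * suc a₂ ≡⟨ collect a₁ a₂ s₁ ⟩
      s₁ * suc (suc a₁ + a₂) ≤⟨ *-monoʳ-≤ s₁ a<N ⟩
      s₁ * N ≤⟨ <⇒≤ (≰⇒> h₁) ⟩
      suc a₁ * (s₁ + s₂) ≡⟨ trans (*-comm (suc a₁) (s₁ + s₂)) (*-distribʳ-+ (suc a₁) s₁ s₂) ⟩
      s₁ * suc a₁ + s₂ * suc a₁ ∎)
      where
      collect : ∀ a b s → s * suc a + s * suc b ≡ s * suc (suc a + b)
      collect = solve-∀

-- Moving one unit from an overfull part to the other part never decreases the product.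
balance : ∀ s₁ s₂ N a₁ a₂ → a₁ + a₂ < N →
          ∃ λ b₁ → ∃ λ b₂ → Balanced s₁ s₂ N b₁ b₂ × bin a₁ s₁ * bin a₂ s₂ ≤ bin b₁ s₁ * bin b₂ s₂
balance s₁ s₂ N a₁ a₂ a<N with a₂ * (s₁ + s₂) ≤? s₂ * N
... | yes h = balance′ s₁ s₂ N a₁ a₂ a<N h
... | no h with balance′ s₂ s₁ N a₂ a₁ (≤-trans (≤-reflexive (cong suc (+-comm a₂ a₁))) a<N) h₁
  where
  open ≤-Reasoning
  h₁ : a₁ * (s₂ + s₁) ≤ s₁ * N
  h₁ = +-cancelˡ-≤ (s₂ * N) _ _ (begin
    s₂ * N + a₁ * (s₂ + s₁) ≤⟨ +-monoˡ-≤ (a₁ * (s₂ + s₁)) (<⇒≤ (≰⇒> h)) ⟩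
    a₂ * (s₁ + s₂) + a₁ * (s₂ + s₁) ≡⟨ collect a₁ a₂ s₁ s₂ ⟩
    (a₁ + a₂) * (s₁ + s₂) ≤⟨ *-monoˡ-≤ (s₁ + s₂) (<⇒≤ a<N) ⟩
    N * (s₁ + s₂) ≡⟨ spread N s₁ s₂ ⟩
    s₂ * N + s₁ * N ∎)
    where
    collect : ∀ a b s t → b * (s + t) + a * (t + s) ≡ (a + b) * (s + t)
    collect = solve-∀
    spread : ∀ n s t → n * (s + t) ≡ t * n + s * n
    spread = solve-∀
... | b₂ , b₁ , (bal₂ , bal₁) , le = b₁ , b₂
  , (≤-trans (≤-reflexive (cong (b₁ *_) (+-comm s₁ s₂))) bal₁ , ≤-trans (≤-reflexive (cong (b₂ *_) (+-comm s₁ s₂))) bal₂)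
  , ≤-trans (≤-reflexive (*-comm (bin a₁ s₁) (bin a₂ s₂))) (≤-trans le (≤-reflexive (*-comm (bin b₂ s₂) (bin b₁ s₁))))

-- pr p S k = p (p − S) ⋯ (p − (k − 1) S), so that the generalised binomial coefficient of p / S is pr p S k / (k! Sᵏ).
pr : ℕ → ℕ → ℕ → ℕ
pr p S zero    = 1
pr p S (suc k) = pr p S k * (p ∸ k * S)

bin-pr : ∀ a k → bin a k * k ! ≡ pr a 1 k
bin-pr a zero    = refl
bin-pr a (suc k) = begin
  bin a (suc k) * (suc k * k !) ≡⟨ rotate (bin a (suc k)) (suc k) (k !) ⟩
  suc k * bin a (suc k) * k ! ≡⟨ cong (_* k !) (bin-next a k) ⟩
  (a ∸ k) * bin a k * k ! ≡⟨ rotate′ (a ∸ k) (bin a k) (k !) ⟩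
  bin a k * k ! * (a ∸ k) ≡⟨ cong₂ _*_ (bin-pr a k) (cong (a ∸_) (sym (*-identityʳ k))) ⟩
  pr a 1 (suc k) ∎
  where
  open ≡-Reasoning
  rotate : ∀ x y z → x * (y * z) ≡ y * x * z
  rotate = solve-∀
  rotate′ : ∀ x y z → x * y * z ≡ y * z * x
  rotate′ = solve-∀

pr-scale : ∀ {a p S} → a * S ≤ p → ∀ k → bin a k * (k ! * S ^ k) ≤ pr p S k
pr-scale {a} {p} {S} h k = ≤-trans (≤-reflexive (trans (sym (*-assoc (bin a k) _ _)) (cong (_* S ^ k) (bin-pr a k)))) (scale k)
  where
  open ≤-Reasoning
  scale : ∀ k → pr a 1 k * S ^ k ≤ pr p S k
  scale zero    = ≤-refl
  scale (suc k) = begin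
    pr a 1 k * (a ∸ k * 1) * (S * S ^ k) ≡⟨ rotate (pr a 1 k) (a ∸ k * 1) S (S ^ k) ⟩
    pr a 1 k * S ^ k * ((a ∸ k * 1) * S) ≤⟨ *-mono-≤ (scale k) (≤-trans (≤-reflexive (trans (*-distribʳ-∸ S a (k * 1)) (cong (λ j → a * S ∸ j * S) (*-identityʳ k)))) (∸-monoˡ-≤ (k * S) h)) ⟩
    pr p S k * (p ∸ k * S) ∎
    where
    rotate : ∀ x y z w → x * y * (z * w) ≡ x * w * (y * z)
    rotate = solve-∀

-- Factor by factor: since `S ≤ P`, the factor `s * P − i * S` is at least `(s − i) * P`, so adding
-- `s * D ≤ h * P` multiplies it by at most `(s − i + h) / (s − i)`. The product of these quotients
-- is `bin (s + h) s`.
pr-ratio : ∀ {s S P D h} → S ≤ P → s * D ≤ h * P → pr (s * (P + D)) S s ≤ pr (s * P) S s * bin (s + h) s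
pr-ratio {s} {S} {P} {D} {h} S≤P hyp = *-cancelʳ-≤ _ _ (s !) ⦃ s !≢0 ⦄ (begin
  pr (s * (P + D)) S s * s ! ≡⟨ cong (pr (s * (P + D)) S s *_) (trans (sym (+-identityʳ (s !))) (trans (cong (_* s !) (sym (bin-diag s))) (bin-pr s s))) ⟩
  pr (s * (P + D)) S s * pr s 1 s ≤⟨ partial s ≤-refl ⟩
  pr (s * P) S s * pr (s + h) 1 s ≡⟨ cong (pr (s * P) S s *_) (sym (bin-pr (s + h) s)) ⟩
  pr (s * P) S s * (bin (s + h) s * s !) ≡⟨ sym (*-assoc (pr (s * P) S s) _ _) ⟩
  pr (s * P) S s * bin (s + h) s * s ! ∎)
  where
  open ≤-Reasoning
  factor : ∀ i j → s ≡ i + j → (s * (P + D) ∸ i * S) * j ≤ (s * P ∸ i * S) * (j + h)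
  factor i j refl = begin
    ((i + j) * (P + D) ∸ i * S) * j ≡⟨ cong (_* j) (trans (cong (_∸ i * S) spread) (m+n∸n≡m (R + (i + j) * D) (i * S))) ⟩
    (R + (i + j) * D) * j ≡⟨ *-distribʳ-+ j R ((i + j) * D) ⟩
    R * j + (i + j) * D * j ≤⟨ +-monoʳ-≤ (R * j) (*-monoˡ-≤ j hyp) ⟩
    R * j + h * P * j ≡⟨ cong (R * j +_) (rotate h P j) ⟩
    R * j + j * P * h ≤⟨ +-monoʳ-≤ (R * j) (*-monoˡ-≤ h R≥) ⟩
    R * j + R * h ≡⟨ sym (*-distribˡ-+ R j h) ⟩
    R * (j + h) ∎
    where
    R : ℕ
    R = (i + j) * P ∸ i * S
    iS≤ : i * S ≤ (i + j) * P
    iS≤ = *-mono-≤ (m≤m+n i j) S≤P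
    R-eq : R + i * S ≡ (i + j) * P
    R-eq = m∸n+n≡m iS≤
    spread : (i + j) * (P + D) ≡ R + (i + j) * D + i * S
    spread = trans (*-distribˡ-+ (i + j) P D) (trans (cong (_+ (i + j) * D) (sym R-eq)) (shuffle R (i * S) ((i + j) * D)))
      where
      shuffle : ∀ x y z → x + y + z ≡ x + z + y
      shuffle = solve-∀
    rotate : ∀ x y z → x * y * z ≡ z * y * x
    rotate = solve-∀
    R≥ : j * P ≤ R
    R≥ = m+n≤o⇒m≤o∸n (j * P) (begin
      j * P + i * S ≤⟨ +-monoʳ-≤ (j * P) (*-monoʳ-≤ i S≤P) ⟩
      j * P + i * P ≡⟨ trans (+-comm (j * P) (i * P)) (sym (*-distribʳ-+ P i j)) ⟩
      (i + j) * P ∎)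
  partial : ∀ k → k ≤ s → pr (s * (P + D)) S k * pr s 1 k ≤ pr (s * P) S k * pr (s + h) 1 k
  partial zero    _   = ≤-refl
  partial (suc k) k<s = begin
    pr (s * (P + D)) S k * (s * (P + D) ∸ k * S) * (pr s 1 k * (s ∸ k * 1))
      ≡⟨ *-interchange (pr (s * (P + D)) S k) _ (pr s 1 k) _ ⟩
    pr (s * (P + D)) S k * pr s 1 k * ((s * (P + D) ∸ k * S) * (s ∸ k * 1))
      ≤⟨ *-mono-≤ (partial k (<⇒≤ k<s)) (begin
        (s * (P + D) ∸ k * S) * (s ∸ k * 1) ≡⟨ cong (λ j → (s * (P + D) ∸ k * S) * (s ∸ j)) (*-identityʳ k) ⟩
        (s * (P + D) ∸ k * S) * (s ∸ k) ≤⟨ factor k (s ∸ k) (sym (m+[n∸m]≡n (<⇒≤ k<s))) ⟩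
        (s * P ∸ k * S) * (s ∸ k + h) ≡⟨ cong ((s * P ∸ k * S) *_) (trans (sym (+-∸-comm h (<⇒≤ k<s))) (cong (s + h ∸_) (sym (*-identityʳ k)))) ⟩
        (s * P ∸ k * S) * (s + h ∸ k * 1) ∎) ⟩
    pr (s * P) S k * pr (s + h) 1 k * ((s * P ∸ k * S) * (s + h ∸ k * 1))
      ≡⟨ sym (*-interchange (pr (s * P) S k) _ (pr (s + h) 1 k) _) ⟩
    pr (s * P) S (suc k) * pr (s + h) 1 (suc k) ∎

*-^ : ∀ x y k → (x * y) ^ k ≡ x ^ k * y ^ k
*-^ x y zero    = refl
*-^ x y (suc k) = trans (cong (x * y *_) (*-^ x y k)) (*-interchange x y (x ^ k) (y ^ k))

-- By induction, `(1 + 1/(2u)) ^ k ≤ 1 + k/u` for `k ≤ u`; the claim is the case `k = u`.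
half-power : ∀ u → suc (2 * u) ^ u ≤ 2 * (2 * u) ^ u
half-power zero      = s≤s z≤n
half-power u@(suc _) = *-cancelʳ-≤ _ _ u (≤-trans (go u ≤-refl) (≤-reflexive (shape u ((2 * u) ^ u))))
  where
  open ≤-Reasoning
  shape : ∀ u z → (u + u) * z ≡ 2 * z * u
  shape = solve-∀
  go : ∀ k → k ≤ u → suc (2 * u) ^ k * u ≤ (u + k) * (2 * u) ^ k
  go zero    _   = ≤-reflexive (trans (+-identityʳ u) (sym (trans (*-identityʳ _) (+-identityʳ u))))
  go (suc k) k<u = begin
    suc (2 * u) * suc (2 * u) ^ k * u ≡⟨ *-assoc (suc (2 * u)) (suc (2 * u) ^ k) u ⟩
    suc (2 * u) * (suc (2 * u) ^ k * u) ≤⟨ *-monoʳ-≤ (suc (2 * u)) (go k (<⇒≤ k<u)) ⟩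
    suc (2 * u) * ((u + k) * (2 * u) ^ k) ≡⟨ sym (*-assoc (suc (2 * u)) (u + k) _) ⟩
    suc (2 * u) * (u + k) * (2 * u) ^ k ≤⟨ *-monoˡ-≤ ((2 * u) ^ k) (begin
      suc (2 * u) * (u + k) ≡⟨ e₁ u k ⟩
      u + k + 2 * u * (u + k) ≤⟨ +-monoˡ-≤ (2 * u * (u + k)) (+-monoʳ-≤ u (<⇒≤ k<u)) ⟩
      u + u + 2 * u * (u + k) ≡⟨ e₂ u k ⟩
      (u + suc k) * (2 * u) ∎) ⟩
    (u + suc k) * (2 * u) * (2 * u) ^ k ≡⟨ *-assoc (u + suc k) (2 * u) _ ⟩
    (u + suc k) * (2 * u) ^ suc k ∎
    where
    e₁ : ∀ u k → suc (2 * u) * (u + k) ≡ u + k + 2 * u * (u + k)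
    e₁ = solve-∀
    e₂ : ∀ u k → u + u + 2 * u * (u + k) ≡ (u + suc k) * (2 * u)
    e₂ = solve-∀

-- `bin-power` at `y = 2 * u` leaves `y ^ h * (1 + 1/y) ^ (s + h)`, where every block of `u` factors
-- `1 + 1/y` is at most 2 by `half-power`.
bin-small : ∀ u s h e → 1 ≤ u → s + h ≤ u * e → bin (s + h) s ≤ 2 ^ e * (2 * u) ^ h
bin-small u s h e u≥1 s+h≤ = *-cancelʳ-≤ _ _ (y ^ s) ⦃ m^n≢0 y s ⦃ y≢0 ⦄ ⦄ (begin
  bin (s + h) s * y ^ s ≤⟨ bin-power y (s + h) s ⟩
  -- Both sides are padded to the exponent `u * e`, a whole number of blocks.
  suc y ^ (s + h) ≤⟨ *-cancelʳ-≤ _ _ (y ^ (u * e ∸ (s + h))) ⦃ m^n≢0 y (u * e ∸ (s + h)) ⦃ y≢0 ⦄ ⦄ (begin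
    suc y ^ (s + h) * y ^ (u * e ∸ (s + h)) ≤⟨ *-monoʳ-≤ (suc y ^ (s + h)) (^-monoˡ-≤ (u * e ∸ (s + h)) (n≤1+n y)) ⟩
    suc y ^ (s + h) * suc y ^ (u * e ∸ (s + h)) ≡⟨ sym (^-distribˡ-+-* (suc y) (s + h) _) ⟩
    suc y ^ (s + h + (u * e ∸ (s + h))) ≡⟨ cong (suc y ^_) (m+[n∸m]≡n s+h≤) ⟩
    suc y ^ (u * e) ≡⟨ sym (^-*-assoc (suc y) u e) ⟩
    (suc y ^ u) ^ e ≤⟨ ^-monoˡ-≤ e (half-power u) ⟩
    (2 * y ^ u) ^ e ≡⟨ *-^ 2 (y ^ u) e ⟩
    2 ^ e * (y ^ u) ^ e ≡⟨ cong (2 ^ e *_) (^-*-assoc y u e) ⟩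
    2 ^ e * y ^ (u * e) ≡⟨ cong (λ k → 2 ^ e * y ^ k) (sym (m+[n∸m]≡n s+h≤)) ⟩
    2 ^ e * y ^ (s + h + (u * e ∸ (s + h))) ≡⟨ cong (2 ^ e *_) (^-distribˡ-+-* y (s + h) _) ⟩
    2 ^ e * (y ^ (s + h) * y ^ (u * e ∸ (s + h))) ≡⟨ sym (*-assoc (2 ^ e) _ _) ⟩
    2 ^ e * y ^ (s + h) * y ^ (u * e ∸ (s + h)) ∎) ⟩
  2 ^ e * y ^ (s + h) ≡⟨ cong (2 ^ e *_) (trans (^-distribˡ-+-* y s h) (*-comm (y ^ s) (y ^ h))) ⟩
  2 ^ e * (y ^ h * y ^ s) ≡⟨ sym (*-assoc (2 ^ e) _ _) ⟩
  2 ^ e * y ^ h * y ^ s ∎)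
  where
  open ≤-Reasoning
  y = 2 * u
  y≢0 : NonZero y
  y≢0 = >-nonZero (≤-trans u≥1 (m≤m+n u _))

-- Enumeration of the subsets of a given size

subsets : ∀ {n} → FinSet n → ℕ → List (Subset n)
with-zero : ∀ {n} → Bool → FinSet n → ℕ → List (Subset (suc n))
subsets {zero}  A zero    = [] ∷ []
subsets {zero}  A (suc s) = []
subsets {suc n} A s       = map (false ∷_) (subsets (A ∘ suc) s) ++ with-zero (A zero) (A ∘ suc) s
with-zero false A s       = []
with-zero true  A zero    = []
with-zero true  A (suc s) = map (true ∷_) (subsets A s)

length-subsets : ∀ {n} (A : FinSet n) s → length (subsets A s) ≡ bin (card A) s
length-subsets {zero}  A zero    = refl
length-subsets {zero}  A (suc s) = refl
length-subsets {suc n} A s = begin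
  length (map (false ∷_) (subsets (A ∘ suc) s) ++ with-zero (A zero) (A ∘ suc) s)
    ≡⟨ length-++ (map (false ∷_) (subsets (A ∘ suc) s)) ⟩
  length (map (false ∷_) (subsets (A ∘ suc) s)) + length (with-zero (A zero) (A ∘ suc) s)
    ≡⟨ cong (_+ length (with-zero (A zero) (A ∘ suc) s)) (trans (length-map {B = Subset (suc n)} (false ∷_) (subsets (A ∘ suc) s)) (length-subsets (A ∘ suc) s)) ⟩
  bin (card (A ∘ suc)) s + length (with-zero (A zero) (A ∘ suc) s)
    ≡⟨ pascal (A zero) s ⟩
  bin (𝟙 (A zero) + card (A ∘ suc)) s
    ≡⟨ cong (λ k → bin k s) (sym (∑-allFin-suc (𝟙 ∘ A))) ⟩
  bin (card A) s ∎
  where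
  open ≡-Reasoning
  pascal : ∀ b s → bin (card (A ∘ suc)) s + length (with-zero b (A ∘ suc) s) ≡ bin (𝟙 b + card (A ∘ suc)) s
  pascal false s       = +-identityʳ _
  pascal true  zero    = refl
  pascal true  (suc s) = trans (cong (bin (card (A ∘ suc)) (suc s) +_) (trans (length-map (true ∷_) (subsets (A ∘ suc) s)) (length-subsets (A ∘ suc) s)))
                               (+-comm (bin (card (A ∘ suc)) (suc s)) _)

∈-subsets : ∀ {n} (A : FinSet n) (X : Subset n) → Vec.lookup X ⊆ A → X ∈ subsets A ∣ X ∣
∈-subsets A []          X⊆A = here refl
∈-subsets A (false ∷ X) X⊆A = ∈-++⁺ˡ (∈-map⁺ (false ∷_) (∈-subsets (A ∘ suc) X (λ i → X⊆A (suc i))))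
∈-subsets A (true ∷ X)  X⊆A = ∈-++⁺ʳ (map (false ∷_) (subsets (A ∘ suc) (suc ∣ X ∣))) (here-zero (A zero) (X⊆A zero refl))
  where
  here-zero : ∀ b → b ≡ true → (true ∷ X) ∈ with-zero b (A ∘ suc) (suc ∣ X ∣)
  here-zero true refl = ∈-map⁺ (true ∷_) (∈-subsets (A ∘ suc) X (λ i → X⊆A (suc i)))

card-lookup : ∀ {n} (X : Subset n) → card (Vec.lookup X) ≡ ∣ X ∣
card-lookup []          = refl
card-lookup (false ∷ X) = trans (∑-allFin-suc (𝟙 ∘ Vec.lookup (false ∷ X))) (card-lookup X)
card-lookup (true ∷ X)  = trans (∑-allFin-suc (𝟙 ∘ Vec.lookup (true ∷ X))) (cong suc (card-lookup X))

-- Generalised binomial coefficients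

fromℚᵘ-homo-* : ∀ p q → fromℚᵘ p ℚ.* fromℚᵘ q ≡ fromℚᵘ (p ℚᵘ.* q)
fromℚᵘ-homo-* p q = ℚₚ.toℚᵘ-injective (ℚᵘₚ.≃-trans (ℚₚ.toℚᵘ-homo-* (fromℚᵘ p) (fromℚᵘ q))
  (ℚᵘₚ.≃-trans (ℚᵘₚ.*-cong (ℚₚ.toℚᵘ-fromℚᵘ p) (ℚₚ.toℚᵘ-fromℚᵘ q)) (ℚᵘₚ.≃-sym (ℚₚ.toℚᵘ-fromℚᵘ (p ℚᵘ.* q)))))

fromℚᵘ-homo-+ : ∀ p q → fromℚᵘ p ℚ.+ fromℚᵘ q ≡ fromℚᵘ (p ℚᵘ.+ q)
fromℚᵘ-homo-+ p q = ℚₚ.toℚᵘ-injective (ℚᵘₚ.≃-trans (ℚₚ.toℚᵘ-homo-+ (fromℚᵘ p) (fromℚᵘ q))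
  (ℚᵘₚ.≃-trans (ℚᵘₚ.+-cong (ℚₚ.toℚᵘ-fromℚᵘ p) (ℚₚ.toℚᵘ-fromℚᵘ q)) (ℚᵘₚ.≃-sym (ℚₚ.toℚᵘ-fromℚᵘ (p ℚᵘ.+ q)))))

ℕtoℚ-* : ∀ a b → ℕtoℚ (a * b) ≡ ℕtoℚ a ℚ.* ℕtoℚ b
ℕtoℚ-* a b = sym (trans (fromℚᵘ-homo-* (mkℚᵘ (ℤ.+ a) 0) (mkℚᵘ (ℤ.+ b) 0)) (cong (λ i → fromℚᵘ (mkℚᵘ i 0)) (sym (ℤₚ.pos-* a b))))

ℕtoℚ-+ : ∀ a b → ℕtoℚ (a + b) ≡ ℕtoℚ a ℚ.+ ℕtoℚ b
ℕtoℚ-+ a b = sym (trans (fromℚᵘ-homo-+ (mkℚᵘ (ℤ.+ a) 0) (mkℚᵘ (ℤ.+ b) 0))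
  (cong (λ i → fromℚᵘ (mkℚᵘ i 0)) (cong₂ ℤ._+_ (ℤₚ.*-identityʳ (ℤ.+ a)) (ℤₚ.*-identityʳ (ℤ.+ b)))))

ℕtoℚ-mono : ∀ {a b} → a ≤ b → ℕtoℚ a ℚ.≤ ℕtoℚ b
ℕtoℚ-mono {a} {b} a≤b = ℚₚ.toℚᵘ-cancel-≤ (ℚᵘₚ.≤-respˡ-≃ (ℚᵘₚ.≃-sym (ℚₚ.toℚᵘ-fromℚᵘ (mkℚᵘ (ℤ.+ a) 0)))
  (ℚᵘₚ.≤-respʳ-≃ (ℚᵘₚ.≃-sym (ℚₚ.toℚᵘ-fromℚᵘ (mkℚᵘ (ℤ.+ b) 0))) (*≤* (ℤₚ.*-monoʳ-≤-nonNeg (ℤ.+ 1) (ℤ.+≤+ a≤b)))))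

ℕtoℚ-pos : ∀ a .{{_ : NonZero a}} → Positive (ℕtoℚ a)
ℕtoℚ-pos a = ℚₚ.normalize-pos a 1

fraction-* : ∀ a b → ((ℤ.+ a) ℚ./ suc b) ℚ.* ℕtoℚ (suc b) ≡ ℕtoℚ a
fraction-* a b = trans (fromℚᵘ-homo-* (mkℚᵘ (ℤ.+ a) b) (mkℚᵘ (ℤ.+ suc b) 0)) (ℚₚ.fromℚᵘ-cong {mkℚᵘ (ℤ.+ a) b ℚᵘ.* mkℚᵘ (ℤ.+ suc b) 0} {mkℚᵘ (ℤ.+ a) 0} (*≡* eq))
  where
  eq : (ℤ.+ a ℤ.* ℤ.+ suc b) ℤ.* ℤ.+ 1 ≡ ℤ.+ a ℤ.* ℤ.+ (suc b * 1)
  eq = trans (ℤₚ.*-identityʳ _) (cong (λ k → ℤ.+ a ℤ.* ℤ.+ k) (sym (*-identityʳ (suc b))))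

ratio-* : ∀ a S → 1 ≤ S → ratio a S ℚ.* ℕtoℚ S ≡ ℕtoℚ a
ratio-* a (suc S) _ = fraction-* a S

ℕtoℚ-∸ : ∀ {a b} → b ≤ a → ℕtoℚ (a ∸ b) ≡ ℕtoℚ a ℚ.- ℕtoℚ b
ℕtoℚ-∸ {a} {b} b≤a = begin
  ℕtoℚ (a ∸ b) ≡⟨ solve 2 (λ x y → x := x :+ y :- y) refl (ℕtoℚ (a ∸ b)) (ℕtoℚ b) ⟩
  ℕtoℚ (a ∸ b) ℚ.+ ℕtoℚ b ℚ.- ℕtoℚ b ≡⟨ cong (ℚ._- ℕtoℚ b) (trans (sym (ℕtoℚ-+ (a ∸ b) b)) (cong ℕtoℚ (m∸n+n≡m b≤a))) ⟩
  ℕtoℚ a ℚ.- ℕtoℚ b ∎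
  where
  open ≡-Reasoning
  open ℚSolver.+-*-Solver

-- Multiplying each factor by `S` clears the denominators; `k * S ≤ p` keeps the truncated
-- subtractions in `pr` exact.
genBin-pr : ∀ x p S → x ℚ.* ℕtoℚ S ≡ ℕtoℚ p → ∀ k → k * S ≤ p →
            genBin x k ℚ.* ℕtoℚ (k ! * S ^ k) ≡ ℕtoℚ (pr p S k)
genBin-pr x p S hx zero    _ = refl
genBin-pr x p S hx (suc k) h = begin
  genBin x k ℚ.* (x ℚ.- ℕtoℚ k) ℚ.* c ℚ.* ℕtoℚ (suc k ! * S ^ suc k)
    ≡⟨ cong (genBin x k ℚ.* (x ℚ.- ℕtoℚ k) ℚ.* c ℚ.*_) scale ⟩
  genBin x k ℚ.* (x ℚ.- ℕtoℚ k) ℚ.* c ℚ.* (ℕtoℚ (suc k) ℚ.* ℕtoℚ S ℚ.* ℕtoℚ (k ! * S ^ k))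
    ≡⟨ solve 7 (λ g x k c k′ s f → g :* (x :- k) :* c :* (k′ :* s :* f) := (g :* f) :* (x :* s :- k :* s) :* (c :* k′)) refl
         (genBin x k) x (ℕtoℚ k) c (ℕtoℚ (suc k)) (ℕtoℚ S) (ℕtoℚ (k ! * S ^ k)) ⟩
  (genBin x k ℚ.* ℕtoℚ (k ! * S ^ k)) ℚ.* (x ℚ.* ℕtoℚ S ℚ.- ℕtoℚ k ℚ.* ℕtoℚ S) ℚ.* (c ℚ.* ℕtoℚ (suc k))
    ≡⟨ cong₂ ℚ._*_ (cong₂ ℚ._*_ (genBin-pr x p S hx k kS≤p) difference) (fraction-* 1 k) ⟩
  ℕtoℚ (pr p S k) ℚ.* ℕtoℚ (p ∸ k * S) ℚ.* 1ℚ
    ≡⟨ trans (ℚₚ.*-identityʳ _) (sym (ℕtoℚ-* (pr p S k) _)) ⟩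
  ℕtoℚ (pr p S (suc k)) ∎
  where
  open ≡-Reasoning
  open ℚSolver.+-*-Solver
  c : ℚ
  c = (ℤ.+ 1) ℚ./ suc k
  kS≤p : k * S ≤ p
  kS≤p = ≤-trans (m≤n+m _ S) h
  scale : ℕtoℚ (suc k ! * S ^ suc k) ≡ ℕtoℚ (suc k) ℚ.* ℕtoℚ S ℚ.* ℕtoℚ (k ! * S ^ k)
  scale = trans (cong ℕtoℚ (*-interchange (suc k) (k !) S (S ^ k)))
                (trans (ℕtoℚ-* (suc k * S) _) (cong (ℚ._* ℕtoℚ (k ! * S ^ k)) (ℕtoℚ-* (suc k) S)))
  difference : x ℚ.* ℕtoℚ S ℚ.- ℕtoℚ k ℚ.* ℕtoℚ S ≡ ℕtoℚ (p ∸ k * S)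
  difference = trans (cong₂ ℚ._-_ hx (sym (ℕtoℚ-* k S))) (sym (ℕtoℚ-∸ kS≤p))

pairBound : (c s₁ s₂ P : ℕ) → ℚ
pairBound c s₁ s₂ P = ℕtoℚ c ℚ.* genBin (ratio s₁ (s₁ + s₂) ℚ.* ℕtoℚ P) s₁ ℚ.* genBin (ratio s₂ (s₁ + s₂) ℚ.* ℕtoℚ P) s₂

genBin-bound : ∀ s₁ s₂ P c len → 1 ≤ s₁ + s₂ → s₁ + s₂ ≤ P →
  len * ((s₁ ! * (s₁ + s₂) ^ s₁) * (s₂ ! * (s₁ + s₂) ^ s₂)) ≤
    c * (pr (s₁ * P) (s₁ + s₂) s₁ * pr (s₂ * P) (s₁ + s₂) s₂) →
  ℕtoℚ len ℚ.≤ pairBound c s₁ s₂ P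
genBin-bound s₁ s₂ P c len S≥1 S≤P h = ℚₚ.*-cancelʳ-≤-pos (ℕtoℚ (f₁ * f₂)) ⦃ ℕtoℚ-pos (f₁ * f₂) ⦃ f≢0 ⦄ ⦄
  (subst₂ ℚ._≤_ (ℕtoℚ-* len (f₁ * f₂)) right (ℕtoℚ-mono h))
  where
  open ℚSolver.+-*-Solver
  S = s₁ + s₂
  f₁ = s₁ ! * S ^ s₁
  f₂ = s₂ ! * S ^ s₂
  S≢0 : NonZero S
  S≢0 = >-nonZero S≥1
  f≢0 : NonZero (f₁ * f₂)
  f≢0 = m*n≢0 f₁ f₂ ⦃ m*n≢0 (s₁ !) (S ^ s₁) ⦃ s₁ !≢0 ⦄ ⦃ m^n≢0 S s₁ ⦃ S≢0 ⦄ ⦄ ⦄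
                         ⦃ m*n≢0 (s₂ !) (S ^ s₂) ⦃ s₂ !≢0 ⦄ ⦃ m^n≢0 S s₂ ⦃ S≢0 ⦄ ⦄ ⦄
  g₁ = genBin (ratio s₁ S ℚ.* ℕtoℚ P) s₁
  g₂ = genBin (ratio s₂ S ℚ.* ℕtoℚ P) s₂
  argument : ∀ s → ratio s S ℚ.* ℕtoℚ P ℚ.* ℕtoℚ S ≡ ℕtoℚ (s * P)
  argument s = trans (solve 3 (λ x y z → x :* y :* z := x :* z :* y) refl (ratio s S) (ℕtoℚ P) (ℕtoℚ S))
    (trans (cong (ℚ._* ℕtoℚ P) (ratio-* s S S≥1)) (sym (ℕtoℚ-* s P)))
  eq₁ : g₁ ℚ.* ℕtoℚ f₁ ≡ ℕtoℚ (pr (s₁ * P) S s₁)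
  eq₁ = genBin-pr _ (s₁ * P) S (argument s₁) s₁ (*-monoʳ-≤ s₁ S≤P)
  eq₂ : g₂ ℚ.* ℕtoℚ f₂ ≡ ℕtoℚ (pr (s₂ * P) S s₂)
  eq₂ = genBin-pr _ (s₂ * P) S (argument s₂) s₂ (*-monoʳ-≤ s₂ S≤P)
  right : ℕtoℚ (c * (pr (s₁ * P) S s₁ * pr (s₂ * P) S s₂)) ≡ ℕtoℚ c ℚ.* g₁ ℚ.* g₂ ℚ.* ℕtoℚ (f₁ * f₂)
  right = trans (ℕtoℚ-* c _) (trans (cong (ℕtoℚ c ℚ.*_) (trans (ℕtoℚ-* (pr (s₁ * P) S s₁) _) (cong₂ ℚ._*_ (sym eq₁) (sym eq₂))))
    (trans (solve 5 (λ c x f y g → c :* ((x :* f) :* (y :* g)) := c :* x :* y :* (f :* g)) refl (ℕtoℚ c) g₁ (ℕtoℚ f₁) g₂ (ℕtoℚ f₂))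
      (cong (ℕtoℚ c ℚ.* g₁ ℚ.* g₂ ℚ.*_) (sym (ℕtoℚ-* f₁ f₂)))))

-- Links the natural number `K`, up to which Pollard's theorem must know the subgroup orders, to the
-- rational threshold in `IsBeta`.
slack-bound : ∀ v m j K → j ≤ K → suc v * K ≤ (suc v + 3) * m → ℕtoℚ j ℚ.≤ (ℚ.1ℚ ℚ.+ ratio 3 (suc v)) ℚ.* ℕtoℚ m
slack-bound v m j K j≤K h = ℚₚ.*-cancelʳ-≤-pos (ℕtoℚ (suc v)) ⦃ ℕtoℚ-pos (suc v) ⦄
  (subst₂ ℚ._≤_ (ℕtoℚ-* j (suc v)) right (ℕtoℚ-mono (≤-trans (≤-trans (*-monoˡ-≤ (suc v) j≤K) (≤-reflexive (*-comm K (suc v)))) h)))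
  where
  open ℚSolver.+-*-Solver
  right : ℕtoℚ ((suc v + 3) * m) ≡ (ℚ.1ℚ ℚ.+ ratio 3 (suc v)) ℚ.* ℕtoℚ m ℚ.* ℕtoℚ (suc v)
  right = trans (ℕtoℚ-* (suc v + 3) m) (trans (cong (ℚ._* ℕtoℚ m) (trans (ℕtoℚ-+ (suc v) 3) (cong (ℕtoℚ (suc v) ℚ.+_) (sym (fraction-* 3 v)))))
    (solve 3 (λ x d m → (x :+ d :* x) :* m := (con ℚ.1ℚ :+ d) :* m :* x) refl (ℕtoℚ (suc v)) (ratio 3 (suc v)) (ℕtoℚ m)))

-- Containers for sumsets

product-≤ : ∀ {a b c} → a ≤ c → b ≤ c → a * b ≤ (a ⊓ b) * c
product-≤ {a} {b} {c} a≤c b≤c with ⊓-sel a b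
... | inj₁ eq = subst (λ k → a * b ≤ k * c) (sym eq) (*-monoʳ-≤ a b≤c)
... | inj₂ eq = subst (λ k → a * b ≤ k * c) (sym eq) (≤-trans (≤-reflexive (*-comm a b)) (*-monoʳ-≤ b a≤c))

module Sumsets {c ℓ} (G : AbelianGroup c ℓ) (_≟_ : ∀ x y → Dec (AbelianGroup._≈_ G x y))
               {n : ℕ} (F₁ F₂ : Fin n → AbelianGroup.Carrier G)
               (inj₁′ : InjectiveEnum G F₁) (inj₂′ : InjectiveEnum G F₂) where
  open AbelianGroup G using (Carrier; _≈_; _∙_; comm; reflexive) renaming (refl to ≈-refl; sym to ≈-sym; trans to ≈-trans)
  open import Algebra.Properties.AbelianGroup G using (∙-cancelˡ; ∙-cancelʳ)
  open DecidableGroup G _≟_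

  IsSet-image : (F : Fin n → Carrier) → InjectiveEnum G F → ∀ A → IsSet (map F (elems A))
  IsSet-image F inj A z = ≤-trans (≤-reflexive (trans (∑-map F (elems A) _) (∑-elems A _)))
    (≤-trans (∑-mono (allFin n) (λ i → ≤-trans (*-monoˡ-≤ (δ (F i) z) (𝟙≤1 (A i))) (≤-reflexive (+-identityʳ _)))) (at-most-one (Finₚ.any? (λ i → F i ≟ z))))
    where
    at-most-one : Dec (∃ λ i → F i ≈ z) → ∑ (allFin n) (λ i → δ (F i) z) ≤ 1
    at-most-one (no none) = ≤-trans (≤-reflexive (trans (∑-cong (allFin n) (λ i → 𝟙?-no (F i ≟ z) (λ p → none (i , p)))) (∑-zero (allFin n)))) z≤n
    at-most-one (yes (j , p)) = ≤-trans (∑-mono (allFin n) (λ i → ≤-trans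
        (𝟙?-mono (F i ≟ z) (j Fin.≟ i) (λ q → inj j i (≈-trans p (≈-sym q)))) (≤-reflexive (sym (*-identityʳ _))))) (≤-reflexive (∑-single j (λ _ → 1)))

  dedup : List Carrier → List Carrier
  dedup []       = []
  dedup (x ∷ xs) with x ∈ˢ? dedup xs
  ... | yes _ = dedup xs
  ... | no _  = x ∷ dedup xs

  dedup-set : ∀ xs → IsSet (dedup xs)
  dedup-set []       z = z≤n
  dedup-set (x ∷ xs) z with x ∈ˢ? dedup xs
  ... | yes _ = dedup-set xs z
  ... | no x∉ with x ≟ z
  ...   | no _    = dedup-set xs z
  ...   | yes x≈z = s≤s (≤-trans (≤-reflexive (sym (μ-cong (dedup xs) x≈z))) (≤-pred (≰⇒> x∉)))

  dedup⁺ : ∀ {xs z} → z ∈ xs → z ∈ˢ dedup xs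
  dedup⁺ {x ∷ xs} z∈ with x ∈ˢ? dedup xs
  dedup⁺ {x ∷ xs} (here refl) | yes x∈ = x∈
  dedup⁺ {x ∷ xs} (there z∈)  | yes x∈ = dedup⁺ z∈
  dedup⁺ {x ∷ xs} {z} (here refl) | no _ = ∈⇒∈ˢ {x ∷ dedup xs} (here refl)
  dedup⁺ {x ∷ xs} {z} (there z∈)  | no _ = ≤-trans (dedup⁺ z∈) (m≤n+m _ (δ x z))

  dedup⁻ : ∀ {xs z} → z ∈ dedup xs → z ∈ xs
  dedup⁻ {x ∷ xs} z∈ with x ∈ˢ? dedup xs
  dedup⁻ {x ∷ xs} z∈          | yes _ = there (dedup⁻ z∈)
  dedup⁻ {x ∷ xs} (here refl) | no _  = here refl
  dedup⁻ {x ∷ xs} (there z∈)  | no _  = there (dedup⁻ z∈)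

  sums : List (Fin n) → List (Fin n) → List Carrier
  sums T₁ T₂ = concatMap (λ x → map (λ u → F₁ x ∙ F₂ u) T₂) T₁

  sums⁻ : ∀ T₁ T₂ {z} → z ∈ sums T₁ T₂ → ∃ λ x → ∃ λ u → x ∈ T₁ × u ∈ T₂ × z ≡ F₁ x ∙ F₂ u
  sums⁻ T₁ T₂ z∈ with find (∈-concatMap⁻ (λ x → map (λ u → F₁ x ∙ F₂ u) T₂) z∈)
  ... | x , x∈ , z∈′ with ∈-map⁻ (λ u → F₁ x ∙ F₂ u) z∈′
  ...   | u , u∈ , eq = x , u , x∈ , u∈ , eq

  module Fixed (T₁ T₂ : List (Fin n)) where

    C : List Carrier
    C = dedup (sums T₁ T₂)

    w : Carrier → ℕ
    w z = 𝟙 (not (does (z ∈ˢ? C)))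

    η : Fin n → Fin n → Bool
    η x u = not (does ((F₁ x ∙ F₂ u) ∈ˢ? C))

    w-resp : ∀ {x y} → x ≈ y → w x ≡ w y
    w-resp x≈y = cong (λ k → 𝟙 (not (does (1 ≤? k)))) (μ-cong C x≈y)

    capacity : ∀ m → length C ≤ m → ∀ A → IsSet A → length A ≤ m + ∑ A w
    capacity m C≤m A set = begin
      length A ≡⟨ sym (∑-1 A) ⟩
      ∑ A (λ _ → 1) ≡⟨ ∑-cong A (λ a → one (does (a ∈ˢ? C))) ⟩
      ∑ A (λ a → 𝟙? (a ∈ˢ? C) * 1 + w a) ≡⟨ ∑-+ A _ w ⟩
      ∑ A (λ a → 𝟙? (a ∈ˢ? C) * 1) + ∑ A w ≡⟨ cong (_+ ∑ A w) (trans (sym (∑-filter (_∈ˢ? C) A (λ _ → 1))) (∑-1 (filter (_∈ˢ? C) A))) ⟩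
      length (filter (_∈ˢ? C) A) + ∑ A w ≤⟨ +-monoˡ-≤ (∑ A w) (≤-trans (length-≤ (filter (_∈ˢ? C) A) C (IsSet-filter (_∈ˢ? C) A set) inside) C≤m) ⟩
      m + ∑ A w ∎
      where
      open ≤-Reasoning
      one : ∀ b → 1 ≡ 𝟙 b * 1 + 𝟙 (not b)
      one true  = refl
      one false = refl
      inside : ∀ z → z ∈ˢ filter (_∈ˢ? C) A → z ∈ˢ C
      inside z z∈ with ∈ˢ⇒∈ {filter (_∈ˢ? C) A} z∈
      ... | a , a∈ , a≈z = ∈ˢ-resp C a≈z (proj₂ (∈-filter⁻ (_∈ˢ? C) {xs = A} a∈))

    η-free : ∀ {x u x′ u′} → x′ ∈ T₁ → u′ ∈ T₂ → F₁ x′ ∙ F₂ u′ ≈ F₁ x ∙ F₂ u → η x u ≡ false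
    η-free {x} {u} {x′} {u′} x′∈ u′∈ eq = cong not (does⁺ ((F₁ x ∙ F₂ u) ∈ˢ? C) (∈ˢ-resp C eq
      (dedup⁺ (∈-concatMap⁺ (λ x → map (λ u → F₁ x ∙ F₂ u) T₂) (lose x′∈ (∈-map⁺ (λ u → F₁ x′ ∙ F₂ u) u′∈))))))

    module Leaf (m K β z r₁ M₀ : ℕ) (C≤m : length C ≤ m)
                (bound : ∀ k → HasSubgroupOfSize G k → k ≤ K → k ≤ β)
                (r≡ : suc r₁ ≡ 2 * (z * z)) (z≥2 : 2 ≤ z)
                (K-large : z * m + 2 * m < z * K) (M₀-large : z * (m + β) + 4 * m + z < z * suc M₀) where
      open Pollard w w-resp m (capacity m C≤m) K β bound

      E-comm : ∀ A B → E A B ≡ E B A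
      E-comm A B = trans (∑-swap A B _) (∑-cong B (λ b → ∑-cong A (λ a → w-resp (comm a b))))

      -- By `E-lower`, the excess of `A` over `m`, taken `length B` times, is at most `E`, here at
      -- most half of `length A * length B`.
      half-bound : ∀ A B → IsSet A → 1 ≤ length B → 2 * E A B ≤ length A * length B → length A ≤ 2 * m
      half-bound A B set B≥1 h = *-cancelˡ-≤ (length B) ⦃ >-nonZero B≥1 ⦄ (+-cancelʳ-≤ (length B * length A) _ _ (begin
        length B * length A + length B * length A ≡⟨ cong (length B * length A +_) (sym (+-identityʳ _)) ⟩
        2 * (length B * length A) ≤⟨ *-monoʳ-≤ 2 (E-lower A B set) ⟩
        2 * (length B * m + E A B) ≡⟨ spread (length B) m (E A B) ⟩
        length B * (2 * m) + 2 * E A B ≤⟨ +-monoʳ-≤ (length B * (2 * m)) (≤-trans h (≤-reflexive (*-comm (length A) (length B)))) ⟩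
        length B * (2 * m) + length B * length A ∎))
        where
        open ≤-Reasoning
        spread : ∀ b m e → 2 * (b * m + e) ≡ b * (2 * m) + 2 * e
        spread = solve-∀

      -- After division by `t`, the error `E` costs at most `2m/z` and the term `t * t` at most
      -- `2m/z + 1`. The first alternative would give `K ≤ m + 2m/z`, against `K-large`.
      conclude : ∀ a b t E → 1 ≤ t → z * E ≤ t * (2 * m) → z * t ≤ 2 * m + z → PollardBound m K β t a b E → a + b ≤ M₀
      conclude a b t E t≥1 zE zt (inj₁ p) = ⊥-elim (<⇒≱ K-large (*-cancelˡ-≤ t ⦃ >-nonZero t≥1 ⦄ (begin
        t * (z * K) ≡⟨ *-rotate t z K ⟩
        z * (t * K) ≤⟨ *-monoʳ-≤ z p ⟩
        z * (t * m + E) ≡⟨ *-distribˡ-+ z (t * m) E ⟩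
        z * (t * m) + z * E ≤⟨ +-monoʳ-≤ (z * (t * m)) zE ⟩
        z * (t * m) + t * (2 * m) ≡⟨ collect z t m ⟩
        t * (z * m + 2 * m) ∎)))
        where
        open ≤-Reasoning
        collect : ∀ z t m → z * (t * m) + t * (2 * m) ≡ t * (z * m + 2 * m)
        collect = solve-∀
      conclude a b t E t≥1 zE zt (inj₂ p) = ≤-pred (*-cancelˡ-< z _ _ (begin-strict
        z * (a + b) ≤⟨ *-cancelˡ-≤ t ⦃ >-nonZero t≥1 ⦄ (begin
          t * (z * (a + b)) ≡⟨ *-rotate t z (a + b) ⟩
          z * (t * (a + b)) ≤⟨ *-monoʳ-≤ z p ⟩
          z * (t * m + E + t * t + t * β) ≡⟨ spread z t m E β ⟩
          z * E + t * (z * (m + β) + z * t) ≤⟨ +-mono-≤ zE (*-monoʳ-≤ t (+-monoʳ-≤ (z * (m + β)) zt)) ⟩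
          t * (2 * m) + t * (z * (m + β) + (2 * m + z)) ≡⟨ collect z t m (z * (m + β)) ⟩
          t * (z * (m + β) + 4 * m + z) ∎) ⟩
        z * (m + β) + 4 * m + z <⟨ M₀-large ⟩
        z * suc M₀ ∎))
        where
        open ≤-Reasoning
        spread : ∀ z t m E β → z * (t * m + E + t * t + t * β) ≡ z * E + t * (z * (m + β) + z * t)
        spread = solve-∀
        collect : ∀ z t m x → t * (2 * m) + t * (x + (2 * m + z)) ≡ t * (x + 4 * m + z)
        collect = solve-∀

      -- Pollard's theorem is applied with `t` just above `lo / z`, where `lo` is the smaller size.
      -- Such a `t` is at most `2m/z + 1`, yet large enough that `E`, at most
      -- `length A * length B / z²`, is at most `t * (2m/z)`.
      sparse-pair : ∀ A B → IsSet A → IsSet B → 1 ≤ length A → 1 ≤ length B →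
                    z * z * E A B ≤ length A * length B → length A + length B ≤ M₀
      sparse-pair A B setA setB A≥1 B≥1 h =
        conclude (length A) (length B) t (E A B) (s≤s z≤n) zE zt
          (pollard t A B setA setB (s≤s z≤n) (≤-trans t≤lo (m⊓n≤m _ _)) (≤-trans t≤lo (m⊓n≤n (length A) _)))
        where
        open ≤-Reasoning
        instance
          z≢0 : NonZero z
          z≢0 = >-nonZero (≤-trans (s≤s z≤n) z≥2)
        lo t : ℕ
        lo = length A ⊓ length B
        t  = suc (lo / z)
        2E≤ : 2 * E A B ≤ length A * length B
        2E≤ = ≤-trans (*-monoˡ-≤ (E A B) (≤-trans z≥2 (m≤m*n z z))) h
        A≤2m : length A ≤ 2 * m
        A≤2m = half-bound A B setA B≥1 2E≤
        B≤2m : length B ≤ 2 * m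
        B≤2m = half-bound B A setB A≥1 (≤-trans (*-monoʳ-≤ 2 (≤-reflexive (E-comm B A))) (≤-trans 2E≤ (≤-reflexive (*-comm (length A) (length B)))))
        lo<tz : lo ≤ z * t
        lo<tz = begin
          lo ≡⟨ m≡m%n+[m/n]*n lo z ⟩
          lo % z + lo / z * z ≤⟨ +-monoˡ-≤ (lo / z * z) (<⇒≤ (m%n<n lo z)) ⟩
          z + lo / z * z ≡⟨ *-comm t z ⟩
          z * t ∎
        zt : z * t ≤ 2 * m + z
        zt = begin
          z * t ≡⟨ *-comm z t ⟩
          z + lo / z * z ≤⟨ +-monoʳ-≤ z (≤-trans (m/n*n≤m lo z) (≤-trans (m⊓n≤m _ _) A≤2m)) ⟩
          z + 2 * m ≡⟨ +-comm z _ ⟩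
          2 * m + z ∎
        zE : z * E A B ≤ t * (2 * m)
        zE = *-cancelˡ-≤ z (begin
          z * (z * E A B) ≡⟨ sym (*-assoc z z _) ⟩
          z * z * E A B ≤⟨ h ⟩
          length A * length B ≤⟨ product-≤ A≤2m B≤2m ⟩
          lo * (2 * m) ≤⟨ *-monoˡ-≤ (2 * m) lo<tz ⟩
          z * t * (2 * m) ≡⟨ *-assoc z t _ ⟩
          z * (t * (2 * m)) ∎)
        t≤lo : t ≤ lo
        t≤lo = small lo (⊓-glb A≥1 B≥1) (lo / z) (≤-trans (≤-reflexive (*-comm z (lo / z))) (m/n*n≤m lo z))
          where
          small : ∀ lo → 1 ≤ lo → ∀ q → z * q ≤ lo → suc q ≤ lo
          small lo lo≥1 zero    _ = lo≥1
          -- A positive quotient plus 1 is at most twice the quotient, and `z ≥ 2`.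
          small lo lo≥1 (suc q) p =
            ≤-trans (≤-trans (≤-reflexive (+-comm 1 (suc q))) (+-monoʳ-≤ (suc q) (s≤s z≤n))) (≤-trans (*-monoˡ-≤ (suc q) z≥2) p)

      leaf : ∀ A B → 1 ≤ card A → 1 ≤ card B →
             suc r₁ * Graph.edges η A B ≤ 2 * (card A * card B) → card A + card B ≤ M₀
      leaf A B A≥1 B≥1 h = subst (_≤ M₀) (cong₂ _+_ lenA lenB)
        (sparse-pair LA LB (IsSet-image F₁ inj₁′ A) (IsSet-image F₂ inj₂′ B) (subst (1 ≤_) (sym lenA) A≥1) (subst (1 ≤_) (sym lenB) B≥1)
          (*-cancelˡ-≤ 2 (begin
            2 * (z * z * E LA LB) ≡⟨ trans (sym (*-assoc 2 (z * z) _)) (cong₂ _*_ (sym r≡) E≡) ⟩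
            suc r₁ * Graph.edges η A B ≤⟨ h ⟩
            2 * (card A * card B) ≡⟨ cong (2 *_) (sym (cong₂ _*_ lenA lenB)) ⟩
            2 * (length LA * length LB) ∎)))
        where
        open ≤-Reasoning
        LA = map F₁ (elems A)
        LB = map F₂ (elems B)
        lenA : length LA ≡ card A
        lenA = trans (length-map F₁ (elems A)) (length-elems A)
        lenB : length LB ≡ card B
        lenB = trans (length-map F₂ (elems B)) (length-elems B)
        E≡ : E LA LB ≡ Graph.edges η A B
        E≡ = trans (∑-map F₁ (elems A) _) (trans (∑-elems A _) (∑-cong (allFin n) (λ i → cong (𝟙 (A i) *_)
               (trans (∑-map F₂ (elems B) _) (trans (∑-elems B _) (∑-cong (allFin n) (λ j → sym (𝟙-∧ (B j) (η i j)))))))))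

  -- T₁, T₂ have at most t₁, t₂ elements; g bounds the number of elements lost in each step of the
  -- container algorithm, whose depth is d.
  record Parameters (m K β : ℕ) : Set where
    field
      z r₁ M₀ g d p τ t₁ t₂ : ℕ
      r≡       : suc r₁ ≡ 2 * (z * z)
      z≥2      : 2 ≤ z
      K-large  : z * m + 2 * m < z * K
      M₀-large : z * (m + β) + 4 * m + z < z * suc M₀
      depth    : r₁ ^ d * (n * m) < suc r₁ ^ d
      t₁-large : ∀ t → t * suc g ≤ m * τ → t ≤ t₁
      t₂-large : p ^ t₂ * m < suc p ^ t₂

  -- The colours name the elements that cover the sumset. Only this implication is available, as one
  -- sum may have several names.
  Colouring : ∀ {m} → FinSet n → FinSet n → (Fin n → Fin n → Fin m) → Set ℓ
  Colouring X₁ X₂ κ = ∀ {x u x′ u′} → X₁ x ≡ true → X₂ u ≡ true → X₁ x′ ≡ true → X₂ u′ ≡ true →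
                      κ x u ≡ κ x′ u′ → F₁ x ∙ F₂ u ≈ F₁ x′ ∙ F₂ u′

  module Assembly (m K β : ℕ) (bound : ∀ k → HasSubgroupOfSize G k → k ≤ K → k ≤ β) (params : Parameters m K β) where
    open Parameters params

    Pair : Set
    Pair = FinSet n × FinSet n

    CoveredBy : FinSet n → FinSet n → Pair → Set
    CoveredBy X Y (A , B) = X ⊆ A × Y ⊆ B

    -- The summands of `M` beyond `M₀` are what is put back: the losses of the `d` steps, the sample
    -- `T₁`, and the elements of `X₂` lost at the starting vertex.
    Q M : ℕ
    Q = suc n * suc m ^ g
    M = M₀ + g * d + t₁ + g

    Small : Pair → Set
    Small (A , B) = card A + card B ≤ M

    indices : List (Fin n)
    indices = allFin n

    length-indices : length indices ≡ n
    length-indices = length-tabulate {n = n} id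

    module FromSample (T₁ T₂ : List (Fin n)) (T₁≤ : length T₁ ≤ t₁) (C≤m : length (Fixed.C T₁ T₂) ≤ m) where
      open Fixed T₁ T₂
      open Graph η
      module Tree = Containers η r₁ g M₀ m
      open Tree.Family

      opposite : Fin n → FinSet n
      opposite x u = not (η x u)

      -- The sums of `x` with these indices are distinct elements of `C`. This lets the algorithm
      -- start with a second side of at most `m` indices, among which all its later losses are
      -- chosen.
      card-opposite : ∀ x → card (opposite x) ≤ m
      card-opposite x = begin
        card (opposite x) ≡⟨ sym (length-elems (opposite x)) ⟩
        length (elems (opposite x)) ≡⟨ sym (length-map F (elems (opposite x))) ⟩
        length (map F (elems (opposite x))) ≤⟨ capacity m C≤m (map F (elems (opposite x))) (IsSet-image F F-inj (opposite x)) ⟩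
        m + ∑ (map F (elems (opposite x))) w ≡⟨ cong (m +_) (trans (∑-map F (elems (opposite x)) w) (trans (∑-elems (opposite x) (w ∘ F))
                                                            (trans (∑-cong indices (λ u → vanish (does (F u ∈ˢ? C)))) (∑-zero indices)))) ⟩
        m + 0 ≡⟨ +-identityʳ m ⟩
        m ∎
        where
        open ≤-Reasoning
        F : Fin n → Carrier
        F u = F₁ x ∙ F₂ u
        F-inj : InjectiveEnum G F
        F-inj i j eq = inj₂′ i j (∙-cancelˡ (F₁ x) _ _ eq)
        vanish : ∀ b → 𝟙 (not (not b)) * 𝟙 (not b) ≡ 0
        vanish true  = refl
        vanish false = refl

      everything : FinSet n
      everything _ = true

      tree : ∀ x → Tree.Family d everything (opposite x)
      tree x = Tree.family (Leaf.leaf m K β z r₁ M₀ C≤m bound r≡ z≥2 K-large M₀-large) d everything (opposite x)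
        (≤-<-trans (*-monoʳ-≤ (r₁ ^ d) (*-mono-≤ (≤-reflexive (trans (∑-1 indices) length-indices)) (card-opposite x))) depth)
        (card-opposite x)

      add : List (Fin n) → Pair → Pair
      add D (A , B) = (A ∪ˡ T₁) , (B ∪ˡ D)

      losses : List (List (Fin n))
      losses = listsUpTo g indices

      from : Fin n → List Pair
      from x = concatMap (λ D → map (add D) (members (tree x))) losses

      containers : List Pair
      containers = concatMap from indices

      length-containers : length containers ≤ n * (suc n ^ g * Q ^ d)
      length-containers = begin
        length containers
          ≡⟨ length-concatMap from indices ⟩
        ∑ indices (λ x → length (from x))
          ≤⟨ ∑-mono indices each ⟩
        ∑ indices (λ _ → suc n ^ g * Q ^ d)
          ≡⟨ trans (∑-const indices _) (cong (_* (suc n ^ g * Q ^ d)) length-indices) ⟩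
        n * (suc n ^ g * Q ^ d) ∎
        where
        open ≤-Reasoning
        each : ∀ x → length (from x) ≤ suc n ^ g * Q ^ d
        each x = begin
          length (from x)
            ≡⟨ length-concatMap (λ D → map (add D) (members (tree x))) losses ⟩
          ∑ losses (λ D → length (map (add D) (members (tree x))))
            ≡⟨ ∑-cong losses (λ D → length-map (add D) (members (tree x))) ⟩
          ∑ losses (λ _ → length (members (tree x)))
            ≡⟨ ∑-const losses _ ⟩
          length losses * length (members (tree x))
            ≤⟨ *-mono-≤ (≤-trans (length-listsUpTo g indices) (≤-reflexive (cong (λ k → suc k ^ g) length-indices))) (count (tree x)) ⟩
          suc n ^ g * Q ^ d ∎

      small-containers : All Small containers
      small-containers = All-concatMap {P = Small} {Q = λ _ → ⊤} from
        (λ x _ → All-concatMap {P = Small} (λ D → map (add D) (members (tree x)))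
          (λ D D≤g → Allₚ.map⁺ (All.map (λ {p} → bigger D D≤g {p}) (small (tree x)))) (listsUpTo-bounded g indices))
        (All.universal (λ _ → _) indices)
        where
        open ≤-Reasoning
        bigger : ∀ D → length D ≤ g → ∀ {p} → Tree.Small (M₀ + g * d) p → Small (add D p)
        bigger D D≤g {A , B} h = begin
          card (A ∪ˡ T₁) + card (B ∪ˡ D) ≤⟨ +-mono-≤ (card-∪ˡ A T₁) (card-∪ˡ B D) ⟩
          card A + length T₁ + (card B + length D) ≡⟨ shuffle (card A) (length T₁) (card B) (length D) ⟩
          card A + card B + length T₁ + length D ≤⟨ +-mono-≤ (+-mono-≤ h T₁≤) D≤g ⟩
          M ∎
          where
          shuffle : ∀ a t b d → a + t + (b + d) ≡ a + b + t + d
          shuffle = solve-∀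

      module Cover (X₁ X₂ : FinSet n) (X₂-large : g * d + g < card X₂)
                   (low : ∀ x → X₁ x ≡ true → x ∉ T₁ → deg x X₂ ≤ g) where
        open ≤-Reasoning

        X₁⁻ : FinSet n
        X₁⁻ x = X₁ x ∧ not (member T₁ x)

        in-X₁ : ∀ {x} → X₁⁻ x ≡ true → X₁ x ≡ true
        in-X₁ {x} p = proj₁ (∧⁻ {X₁ x} p)

        not-T₁ : ∀ {x} → X₁⁻ x ≡ true → x ∉ T₁
        not-T₁ {x} p x∈ with trans (sym (proj₂ (∧⁻ {X₁ x} p))) (cong not (member⁺ x∈))
        ... | ()

        X₁⁻≥1 : t₁ < card X₁ → 1 ≤ card X₁⁻
        X₁⁻≥1 X₁-large = +-cancelˡ-< t₁ _ _ (begin-strict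
          t₁ + 0 ≡⟨ +-identityʳ t₁ ⟩
          t₁ <⟨ X₁-large ⟩
          card X₁ ≤⟨ card-mono covered ⟩
          card (X₁⁻ ∪ˡ T₁) ≤⟨ card-∪ˡ X₁⁻ T₁ ⟩
          card X₁⁻ + length T₁ ≤⟨ +-monoʳ-≤ (card X₁⁻) T₁≤ ⟩
          card X₁⁻ + t₁ ≡⟨ +-comm (card X₁⁻) t₁ ⟩
          t₁ + card X₁⁻ ∎)
          where
          either : ∀ b {a} → a ≡ true → (a ∧ not b) ∨ b ≡ true
          either true  {true} refl = refl
          either false {true} refl = refl
          covered : X₁ ⊆ (X₁⁻ ∪ˡ T₁)
          covered x Xx = either (member T₁ x) Xx

        module At (x₀ : Fin n) (x₀∈ : X₁⁻ x₀ ≡ true) where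

          -- The algorithm starts from `opposite x₀`, which contains `X₂⁻` but nothing of `lost`;
          -- the latter is listed in `D` and restored by `add`.
          X₂⁻ lost : FinSet n
          X₂⁻ u  = X₂ u ∧ not (η x₀ u)
          lost u = X₂ u ∧ η x₀ u

          lost≤ : card lost ≤ g
          lost≤ = low x₀ (in-X₁ x₀∈) (not-T₁ x₀∈)

          D : List (Fin n)
          D = elems lost

          D∈ : D ∈ losses
          D∈ = ∈-listsUpTo g indices (All.universal ∈-allFin D) (≤-trans (≤-reflexive (length-elems lost)) lost≤)

          X₂⁻-large : g * d < card X₂⁻
          X₂⁻-large = +-cancelʳ-< g _ _ (begin-strict
            g * d + g <⟨ X₂-large ⟩
            card X₂ ≡⟨ card-split X₂ (η x₀) ⟩
            card lost + card X₂⁻ ≤⟨ +-monoˡ-≤ (card X₂⁻) lost≤ ⟩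
            g + card X₂⁻ ≡⟨ +-comm g _ ⟩
            card X₂⁻ + g ∎)

          low⁻ : ∀ x → X₁⁻ x ≡ true → deg x X₂⁻ ≤ g
          low⁻ x p = ≤-trans (card-mono (λ u q → ∧⁺ (proj₁ (∧⁻ {X₂ u} (proj₁ (∧⁻ {X₂⁻ u} q)))) (proj₂ (∧⁻ {X₂⁻ u} q)))) (low x (in-X₁ p) (not-T₁ p))

          widen : ∀ {p} → Tree.CoveredBy X₁⁻ X₂⁻ p → CoveredBy X₁ X₂ (add D p)
          widen {A , B} (⊆A , ⊆B) = left , right
            where
            left : X₁ ⊆ (A ∪ˡ T₁)
            left x Xx = either (member T₁ x) refl
              where
              either : ∀ b → member T₁ x ≡ b → (A ∪ˡ T₁) x ≡ true
              either true  eq = ∪ˡ⁺₂ A (does⁻ (any? (x Fin.≟_) T₁) eq)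
              either false eq = ∪ˡ⁺₁ A T₁ (⊆A x (∧⁺ Xx (cong not eq)))
            right : X₂ ⊆ (B ∪ˡ D)
            right u Xu = either (η x₀ u) refl
              where
              either : ∀ b → η x₀ u ≡ b → (B ∪ˡ D) u ≡ true
              either true  eq = ∪ˡ⁺₂ B (∈-elems⁺ lost (∧⁺ Xu eq))
              either false eq = ∪ˡ⁺₁ B D (⊆B u (∧⁺ Xu (cong not eq)))

          covered : 1 ≤ card X₁⁻ → Any (CoveredBy X₁ X₂) (map (add D) (members (tree x₀)))
          covered ≥1 = Anyₚ.map⁺ (Any.map (λ {p} → widen {p})
            (covers (tree x₀) X₁⁻ X₂⁻ (λ _ _ → refl) (λ u p → proj₂ (∧⁻ {X₂ u} p)) ≥1 X₂⁻-large low⁻))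

        cover-at : 1 ≤ card X₁⁻ → (∃ λ x → X₁⁻ x ≡ true) → Any (CoveredBy X₁ X₂) containers
        cover-at ≥1 (x₀ , x₀∈) =
          Anyₚ.concatMap⁺ from {P = CoveredBy X₁ X₂} {xs = indices}
            (lose (∈-allFin x₀) (Anyₚ.concatMap⁺ (λ D → map (add D) (members (tree x₀))) {P = CoveredBy X₁ X₂} {xs = losses}
              (lose (At.D∈ x₀ x₀∈) (At.covered x₀ x₀∈ ≥1))))

      cover : ∀ X₁ X₂ → t₁ < card X₁ → g * d + g < card X₂ →
              (∀ x → X₁ x ≡ true → x ∉ T₁ → deg x X₂ ≤ g) → Any (CoveredBy X₁ X₂) containers
      cover X₁ X₂ X₁-large X₂-large low = cover-at ≥1 (card-witness X₁⁻ ≥1)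
        where
        open Cover X₁ X₂ X₂-large low
        ≥1 : 1 ≤ card X₁⁻
        ≥1 = X₁⁻≥1 X₁-large

    -- The samples of the pairs to be covered pass both tests; lists that fail one of them
    -- contribute nothing.
    sampled : List (Fin n) → List (Fin n) → List Pair
    sampled T₁ T₂ with length T₁ ≤? t₁ | length (Fixed.C T₁ T₂) ≤? m
    ... | yes T₁≤ | yes C≤m = FromSample.containers T₁ T₂ T₁≤ C≤m
    ... | yes _   | no _    = []
    ... | no _    | _       = []

    length-sampled : ∀ T₁ T₂ → length (sampled T₁ T₂) ≤ n * (suc n ^ g * Q ^ d)
    length-sampled T₁ T₂ with length T₁ ≤? t₁ | length (Fixed.C T₁ T₂) ≤? m
    ... | yes T₁≤ | yes C≤m = FromSample.length-containers T₁ T₂ T₁≤ C≤m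
    ... | yes _   | no _    = z≤n
    ... | no _    | _       = z≤n

    small-sampled : ∀ T₁ T₂ → All Small (sampled T₁ T₂)
    small-sampled T₁ T₂ with length T₁ ≤? t₁ | length (Fixed.C T₁ T₂) ≤? m
    ... | yes T₁≤ | yes C≤m = FromSample.small-containers T₁ T₂ T₁≤ C≤m
    ... | yes _   | no _    = []
    ... | no _    | _       = []

    cover-sampled : ∀ T₁ T₂ → length T₁ ≤ t₁ → length (Fixed.C T₁ T₂) ≤ m →
                    ∀ X₁ X₂ → t₁ < card X₁ → g * d + g < card X₂ →
                    (∀ x → X₁ x ≡ true → x ∉ T₁ → Graph.deg (Fixed.η T₁ T₂) x X₂ ≤ g) → Any (CoveredBy X₁ X₂) (sampled T₁ T₂)
    cover-sampled T₁ T₂ T₁≤ C≤m with length T₁ ≤? t₁ | length (Fixed.C T₁ T₂) ≤? m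
    ... | yes T₁≤′ | yes C≤m′ = FromSample.cover T₁ T₂ T₁≤′ C≤m′
    ... | yes _    | no C≰m   = ⊥-elim (C≰m C≤m)
    ... | no T₁≰   | _        = ⊥-elim (T₁≰ T₁≤)

    containers : List Pair
    containers = concatMap (λ T₁ → concatMap (sampled T₁) (listsUpTo t₂ indices)) (listsUpTo t₁ indices)

    length-containers : length containers ≤ suc n ^ t₁ * (suc n ^ t₂ * (n * (suc n ^ g * Q ^ d)))
    length-containers = begin
      length containers
        ≡⟨ length-concatMap (λ T₁ → concatMap (sampled T₁) (listsUpTo t₂ indices)) (listsUpTo t₁ indices) ⟩
      ∑ (listsUpTo t₁ indices) (λ T₁ → length (concatMap (sampled T₁) (listsUpTo t₂ indices)))
        ≤⟨ ∑-mono (listsUpTo t₁ indices) (λ T₁ → ≤-trans (≤-reflexive (length-concatMap (sampled T₁) (listsUpTo t₂ indices)))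
             (≤-trans (∑-mono (listsUpTo t₂ indices) (length-sampled T₁)) (lists t₂ (n * (suc n ^ g * Q ^ d))))) ⟩
      ∑ (listsUpTo t₁ indices) (λ _ → suc n ^ t₂ * (n * (suc n ^ g * Q ^ d)))
        ≤⟨ lists t₁ _ ⟩
      suc n ^ t₁ * (suc n ^ t₂ * (n * (suc n ^ g * Q ^ d))) ∎
      where
      open ≤-Reasoning
      lists : ∀ t k → ∑ (listsUpTo t indices) (λ _ → k) ≤ suc n ^ t * k
      lists t k = ≤-trans (≤-reflexive (∑-const (listsUpTo t indices) k))
        (*-monoˡ-≤ k (≤-trans (length-listsUpTo t indices) (≤-reflexive (cong (λ j → suc j ^ t) length-indices))))

    small-containers : All Small containers
    small-containers = All-concatMap {P = Small} {Q = λ _ → ⊤} (λ T₁ → concatMap (sampled T₁) (listsUpTo t₂ indices))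
      (λ T₁ _ → All-concatMap {P = Small} {Q = λ _ → ⊤} (sampled T₁) (λ T₂ _ → small-sampled T₁ T₂) (All.universal (λ _ → _) (listsUpTo t₂ indices)))
      (All.universal (λ _ → _) (listsUpTo t₁ indices))

    module FromColouring (X₁ X₂ : FinSet n) (κ : Fin n → Fin n → Fin m) (colouring : Colouring X₁ X₂ κ) where

      open Sampling X₁ X₂ κ
        (λ Xx Xu Xu′ eq → inj₂′ _ _ (∙-cancelˡ _ _ _ (colouring Xx Xu Xx Xu′ eq)))
        (λ Xx Xx′ Xu eq → inj₁′ _ _ (∙-cancelʳ _ _ _ (colouring Xx Xu Xx′ Xu eq))) τ g public

      module _ (S : Sample t₂) where
        open Sample S
        open Fixed T₁ T₂

        Origin : Fin (length C) → Set c
        Origin i = ∃ λ x → ∃ λ u → x ∈ T₁ × u ∈ T₂ × lookup C i ≡ F₁ x ∙ F₂ u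

        origin : ∀ i → Origin i
        origin i = sums⁻ T₁ T₂ (dedup⁻ (∈-lookup {xs = C} i))

        colour : ∀ {i} → Origin i → Fin m
        colour (x , u , _) = κ x u

        same : ∀ {i j} (o : Origin i) (o′ : Origin j) → colour o ≡ colour o′ → lookup C i ≈ lookup C j
        same (x , u , x∈ , u∈ , eqᵢ) (x′ , u′ , x′∈ , u′∈ , eqⱼ) eq =
          ≈-trans (reflexive eqᵢ) (≈-trans
            (colouring (All.lookup inside₁ x∈) (All.lookup inside₂ u∈) (All.lookup inside₁ x′∈) (All.lookup inside₂ u′∈) eq)
            (≈-sym (reflexive eqⱼ)))

        -- Every element of `C` is a sum from `X₁` and `X₂`, and the colour of such a sum determines
        -- it.
        C≤m : length C ≤ m
        C≤m = Finₚ.injective⇒≤ {f = λ i → colour (origin i)}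
          (λ {i} {j} eq → lookup-injective C (dedup-set (sums T₁ T₂)) i j (same (origin i) (origin j) eq))

        low : ∀ x → X₁ x ≡ true → x ∉ T₁ → Graph.deg η x X₂ ≤ g
        low x Xx x∉ = sparse x (η x) Xx x∉ (λ u x′ u′ Xu x′∈ u′∈ eq →
          η-free x′∈ u′∈ (colouring (All.lookup inside₁ x′∈) (All.lookup inside₂ u′∈) Xx Xu eq))

        cover-from : t₁ < card X₁ → g * d + g < card X₂ → Any (CoveredBy X₁ X₂) containers
        cover-from X₁-large X₂-large =
          Anyₚ.concatMap⁺ (λ T₁ → concatMap (sampled T₁) (listsUpTo t₂ indices)) {P = CoveredBy X₁ X₂} {xs = listsUpTo t₁ indices}
            (lose (∈-listsUpTo t₁ indices (All.universal ∈-allFin T₁) T₁≤)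
              (Anyₚ.concatMap⁺ (sampled T₁) {P = CoveredBy X₁ X₂} {xs = listsUpTo t₂ indices}
                (lose (∈-listsUpTo t₂ indices (All.universal ∈-allFin T₂) size₂)
                  (cover-sampled T₁ T₂ T₁≤ C≤m X₁ X₂ X₁-large X₂-large low))))
          where
          T₁≤ : length T₁ ≤ t₁
          T₁≤ = t₁-large (length T₁) size₁

    cover : ∀ X₁ X₂ (κ : Fin n → Fin n → Fin m) → Colouring X₁ X₂ κ →
            t₁ < card X₁ → g * d + g < card X₂ → card X₂ ≤ suc p * τ → Any (CoveredBy X₁ X₂) containers
    cover X₁ X₂ κ colouring X₁-large X₂-large X₂≤ =
      cover-from (sample p t₂ (≤-trans (s≤s z≤n) X₂-large) X₂≤ t₂-large) X₁-large X₂-large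
      where open FromColouring X₁ X₂ κ colouring

-- Numerical estimates

open +-*-Solver using (solve; _:+_; _:*_; _:^_; _:=_; con)

m<n*[1+m/n] : ∀ m n .{{_ : NonZero n}} → m < n * suc (m / n)
m<n*[1+m/n] m n = begin-strict
  m ≡⟨ m≡m%n+[m/n]*n m n ⟩
  m % n + m / n * n <⟨ +-monoˡ-< (m / n * n) (m%n<n m n) ⟩
  n + m / n * n ≡⟨ cong (n +_) (*-comm (m / n) n) ⟩
  n + n * (m / n) ≡⟨ sym (*-suc n (m / n)) ⟩
  n * suc (m / n) ∎
  where open ≤-Reasoning

n*[m/n]≤m : ∀ m n .{{_ : NonZero n}} → n * (m / n) ≤ m
n*[m/n]≤m m n = ≤-trans (≤-reflexive (*-comm n (m / n))) (m/n*n≤m m n)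

≤-/ : ∀ {x y} n .{{_ : NonZero n}} → n * x ≤ y → x ≤ y / n
≤-/ {x} {y} n h = ≤-trans (≤-reflexive (sym (m*n/n≡m x n))) (/-monoˡ-≤ n (≤-trans (≤-reflexive (*-comm x n)) h))

n≤2^n : ∀ n → n ≤ 2 ^ n
n≤2^n zero    = z≤n
n≤2^n (suc n) = ≤-trans (+-mono-≤ (m^n>0 2 n) (n≤2^n n)) (≤-reflexive (cong (2 ^ n +_) (sym (+-identityʳ (2 ^ n)))))

-- The inequality `(1 + 1/p) ^ k ≥ 1 + k/p`, multiplied by `p ^ (k + 1)`.
bernoulli : ∀ p k → p ^ k * (p + k) ≤ suc p ^ k * p
bernoulli p zero    = ≤-reflexive (cong (_+ 0) (+-identityʳ p))
bernoulli p (suc k) = begin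
  p * p ^ k * (p + suc k) ≡⟨ cong (p * p ^ k *_) (+-suc p k) ⟩
  p * p ^ k * suc (p + k) ≡⟨ solve 3 (λ p q x → p :* q :* (con 1 :+ x) := p :* (q :* x) :+ p :* q) refl p (p ^ k) (p + k) ⟩
  p * (p ^ k * (p + k)) + p * p ^ k ≤⟨ +-monoʳ-≤ _ (≤-trans (≤-reflexive (*-comm p (p ^ k))) (*-monoʳ-≤ (p ^ k) (m≤m+n p k))) ⟩
  p * (p ^ k * (p + k)) + p ^ k * (p + k) ≡⟨ +-comm (p * (p ^ k * (p + k))) _ ⟩
  suc p * (p ^ k * (p + k)) ≤⟨ *-monoʳ-≤ (suc p) (bernoulli p k) ⟩
  suc p * (suc p ^ k * p) ≡⟨ sym (*-assoc (suc p) (suc p ^ k) p) ⟩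
  suc p ^ suc k * p ∎
  where open ≤-Reasoning

double-power : ∀ p → 2 * p ^ suc p ≤ suc p ^ suc p
double-power zero      = z≤n
double-power p@(suc _) = *-cancelʳ-≤ _ _ p (begin
  2 * p ^ suc p * p ≡⟨ solve 2 (λ x p → con 2 :* x :* p := x :* (p :+ p)) refl (p ^ suc p) p ⟩
  p ^ suc p * (p + p) ≤⟨ *-monoʳ-≤ (p ^ suc p) (+-monoʳ-≤ p (n≤1+n p)) ⟩
  p ^ suc p * (p + suc p) ≤⟨ bernoulli p (suc p) ⟩
  suc p ^ suc p * p ∎)
  where open ≤-Reasoning

-- By `double-power`, `suc p` steps at least halve, and `j` halvings bring `M` below 1. This yields
-- both the depth of the container algorithm and the length of `T₂`.
geometric-decay : ∀ p j M → suc M ≤ 2 ^ j → p ^ (suc p * j) * M < suc p ^ (suc p * j)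
geometric-decay p j M h with p ^ (suc p * j) in eq
... | zero  = m^n>0 (suc p) (suc p * j)
... | suc x = begin-strict
  suc x * M <⟨ *-monoʳ-< (suc x) (n<1+n M) ⟩
  suc x * suc M ≤⟨ *-monoʳ-≤ (suc x) h ⟩
  suc x * 2 ^ j ≡⟨ cong (_* 2 ^ j) (sym eq) ⟩
  p ^ (suc p * j) * 2 ^ j ≡⟨ trans (*-comm (p ^ (suc p * j)) (2 ^ j)) (cong (2 ^ j *_) (sym (^-*-assoc p (suc p) j))) ⟩
  2 ^ j * (p ^ suc p) ^ j ≡⟨ sym (*-^ 2 (p ^ suc p) j) ⟩
  (2 * p ^ suc p) ^ j ≤⟨ ^-monoˡ-≤ j (double-power p) ⟩
  (suc p ^ suc p) ^ j ≡⟨ ^-*-assoc (suc p) (suc p) j ⟩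
  suc p ^ (suc p * j) ∎
  where open ≤-Reasoning

module Numerics (n s₁ s m v L ℓ : ℕ)
  (v≥2 : 2 ≤ v) (s≥2 : 2 ≤ s) (s₁≤s : s₁ ≤ s) (s₁+s≤m : s₁ + s ≤ m) (s≤vs₁ : s ≤ v * s₁)
  (L≥1 : 1 ≤ L) (L≤ℓ : L ≤ ℓ) (n-log : suc n ≤ 2 ^ (2 * ℓ)) (m-log : suc m ≤ 2 ^ (4 * L))
  (hyp : v ^ 20 * (m * (L ^ 4 * ℓ ^ 3)) ≤ s ^ 2) where

  open ≤-Reasoning

  instance
    v≢0 : NonZero v
    v≢0 = >-nonZero (≤-trans (s≤s z≤n) v≥2)
    s≢0 : NonZero s
    s≢0 = >-nonZero (≤-trans (s≤s z≤n) s≥2)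
    L≢0 : NonZero L
    L≢0 = >-nonZero L≥1
    ℓ≢0 : NonZero ℓ
    ℓ≢0 = >-nonZero (≤-trans L≥1 L≤ℓ)

  s≤m : s ≤ m
  s≤m = ≤-trans (m≤n+m s s₁) s₁+s≤m

  m≥1 : 1 ≤ m
  m≥1 = ≤-trans (s≤s z≤n) (≤-trans s≥2 s≤m)

  -- The estimates below reduce to monomials in `v`, `L` and `ℓ` that the hypothesis dominates, all
  -- three bases being positive.
  fact₂ : ∀ a b c {_ : True (a ≤? 20)} {_ : True (b ≤? 4)} {_ : True (c ≤? 3)} → v ^ a * (m * (L ^ b * ℓ ^ c)) ≤ s * s
  fact₂ a b c {pa} {pb} {pc} = begin
    v ^ a * (m * (L ^ b * ℓ ^ c)) ≤⟨ *-mono-≤ (^-monoʳ-≤ v (toWitness pa)) (*-monoʳ-≤ m (*-mono-≤ (^-monoʳ-≤ L (toWitness pb)) (^-monoʳ-≤ ℓ (toWitness pc)))) ⟩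
    v ^ 20 * (m * (L ^ 4 * ℓ ^ 3)) ≤⟨ hyp ⟩
    s ^ 2 ≡⟨ cong (s *_) (*-identityʳ s) ⟩
    s * s ∎

  fact₁ : ∀ a b c {_ : True (a ≤? 20)} {_ : True (b ≤? 4)} {_ : True (c ≤? 3)} → v ^ a * (L ^ b * ℓ ^ c) ≤ s
  fact₁ a b c {pa} {pb} {pc} = *-cancelˡ-≤ s (begin
    s * (v ^ a * (L ^ b * ℓ ^ c)) ≤⟨ *-monoˡ-≤ _ s≤m ⟩
    m * (v ^ a * (L ^ b * ℓ ^ c)) ≡⟨ solve 3 (λ m x y → m :* (x :* y) := x :* (m :* y)) refl m (v ^ a) (L ^ b * ℓ ^ c) ⟩
    v ^ a * (m * (L ^ b * ℓ ^ c)) ≤⟨ fact₂ a b c {pa} {pb} {pc} ⟩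
    s * s ∎)

  -- A sampled element costs `2 * ℓ` bits, so `t₁` and `t₂` must be small against `s / ℓ`: this
  -- fixes `t₁`, and `τ` is chosen to make `t₂`, about `4 * L * s / τ`, small enough. The
  -- requirement `t₁-large` then dictates `g`. The depth `d` is what reduces `n * m < 2 ^ (6 * ℓ)`
  -- below 1.
  z τ p g t₁ t₂ r r₁ d : ℕ
  z  = v ^ 3
  τ  = v * L * ℓ
  instance
    z≢0 : NonZero z
    z≢0 = m^n≢0 v 3
    τ≢0 : NonZero τ
    τ≢0 = m*n≢0 (v * L) ℓ ⦃ m*n≢0 v L ⦄
    zℓ≢0 : NonZero (z * ℓ)
    zℓ≢0 = m*n≢0 z ℓ
  p  = s / τ
  g  = m * τ * z * ℓ / s
  t₁ = s / (z * ℓ)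
  t₂ = suc p * (4 * L)
  r  = 2 * (z * z)
  r₁ = pred r
  d  = r * (6 * ℓ)

  r≡ : suc r₁ ≡ r
  r≡ = suc-pred r ⦃ m*n≢0 2 (z * z) ⦃ _ ⦄ ⦃ m*n≢0 z z ⦄ ⦄

  z≥v : v ≤ z
  z≥v = m≤m*n v (v ^ 2) ⦃ m^n≢0 v 2 ⦄

  z≥2 : 2 ≤ z
  z≥2 = ≤-trans v≥2 z≥v

  16≤v⁴ : 16 ≤ v ^ 4
  16≤v⁴ = ^-monoˡ-≤ 4 v≥2

  τ≤s : τ ≤ s
  τ≤s = ≤-trans (≤-reflexive (solve 3 (λ v L l → v :* L :* l := v :^ 1 :* (L :^ 1 :* l :^ 1)) refl v L ℓ)) (fact₁ 1 1 1)

  s≤[1+p]τ : s ≤ suc p * τ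
  s≤[1+p]τ = ≤-trans (<⇒≤ (m<n*[1+m/n] s τ)) (≤-reflexive (*-comm τ (suc p)))

  depth : r₁ ^ d * (n * m) < suc r₁ ^ d
  depth = subst (λ k → r₁ ^ (k * (6 * ℓ)) * (n * m) < suc r₁ ^ (k * (6 * ℓ))) r≡ (geometric-decay r₁ (6 * ℓ) (n * m) (begin
    suc (n * m) ≤⟨ s≤s (m≤m+n (n * m) (n + m)) ⟩
    suc (n * m + (n + m)) ≡⟨ solve 2 (λ n m → con 1 :+ (n :* m :+ (n :+ m)) := (con 1 :+ n) :* (con 1 :+ m)) refl n m ⟩
    suc n * suc m ≤⟨ *-mono-≤ n-log m-log ⟩
    2 ^ (2 * ℓ) * 2 ^ (4 * L) ≡⟨ sym (^-distribˡ-+-* 2 (2 * ℓ) (4 * L)) ⟩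
    2 ^ (2 * ℓ + 4 * L) ≤⟨ ^-monoʳ-≤ 2 (+-monoʳ-≤ (2 * ℓ) (*-monoʳ-≤ 4 L≤ℓ)) ⟩
    2 ^ (2 * ℓ + 4 * ℓ) ≡⟨ cong (2 ^_) (sym (*-distribʳ-+ ℓ 2 4)) ⟩
    2 ^ (6 * ℓ) ∎))

  t₂-large : p ^ t₂ * m < suc p ^ t₂
  t₂-large = geometric-decay p (4 * L) m m-log

  t₁-bound : z * ℓ * t₁ ≤ s
  t₁-bound = n*[m/n]≤m s (z * ℓ)

  t₁-large : ∀ t → t * suc g ≤ m * τ → t ≤ t₁
  t₁-large t h = ≤-/ (z * ℓ) (*-cancelˡ-≤ (m * τ) ⦃ m*n≢0 m τ ⦃ >-nonZero m≥1 ⦄ ⦄ (begin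
    m * τ * (z * ℓ * t) ≡⟨ solve 4 (λ x z l t → x :* (z :* l :* t) := t :* (x :* z :* l)) refl (m * τ) z ℓ t ⟩
    t * (m * τ * z * ℓ) ≤⟨ *-monoʳ-≤ t (<⇒≤ (m<n*[1+m/n] (m * τ * z * ℓ) s)) ⟩
    t * (s * suc g) ≡⟨ solve 3 (λ t s g → t :* (s :* g) := t :* g :* s) refl t s (suc g) ⟩
    t * suc g * s ≤⟨ *-monoˡ-≤ s h ⟩
    m * τ * s ∎))

  g-bound : ∀ c → c * (m * τ * z * ℓ) ≤ s * s → c * g ≤ s
  g-bound c h = *-cancelˡ-≤ s (begin
    s * (c * g) ≡⟨ solve 3 (λ s c g → s :* (c :* g) := c :* (s :* g)) refl s c g ⟩
    c * (s * g) ≤⟨ *-monoʳ-≤ c (n*[m/n]≤m (m * τ * z * ℓ) s) ⟩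
    c * (m * τ * z * ℓ) ≤⟨ h ⟩
    s * s ∎)

  suc-d≤ : suc d ≤ 13 * (z * z * ℓ)
  suc-d≤ = begin
    1 + d ≤⟨ +-mono-≤ (>-nonZero⁻¹ (z * z * ℓ) ⦃ m*n≢0 (z * z) ℓ ⦃ m*n≢0 z z ⦄ ⦄) (≤-reflexive (solve 2 (λ z l → con 2 :* (z :* z) :* (con 6 :* l) := con 12 :* (z :* z :* l)) refl z ℓ)) ⟩
    z * z * ℓ + 12 * (z * z * ℓ) ≡⟨⟩
    13 * (z * z * ℓ) ∎

  -- This estimate consumes the exponent 20: `z * z` gives `v ^ 6`, `suc d` gives `v ^ 6` and, for
  -- its constant 13, another `v ^ 4`, and `m * τ * z * ℓ` gives `v ^ 4`.
  loss : z * z * suc d * g ≤ s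
  loss = g-bound (z * z * suc d) (begin
    z * z * suc d * (m * τ * z * ℓ)
      ≤⟨ *-monoˡ-≤ (m * τ * z * ℓ) (*-monoʳ-≤ (z * z) (≤-trans suc-d≤ (*-monoˡ-≤ (z * z * ℓ) (≤-trans (m≤m+n 13 3) 16≤v⁴)))) ⟩
    z * z * (v ^ 4 * (z * z * ℓ)) * (m * τ * z * ℓ)
      ≡⟨ solve 4 (λ v m L l → v :^ 3 :* v :^ 3 :* (v :^ 4 :* (v :^ 3 :* v :^ 3 :* l)) :* (m :* (v :* L :* l) :* v :^ 3 :* l) := v :^ 20 :* (m :* (L :^ 1 :* l :^ 3))) refl v m L ℓ ⟩
    v ^ 20 * (m * (L ^ 1 * ℓ ^ 3))
      ≤⟨ fact₂ 20 1 3 ⟩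
    s * s ∎)

  gd+g : g * d + g ≡ suc d * g
  gd+g = solve 2 (λ g d → g :* d :+ g := (con 1 :+ d) :* g) refl g d

  z-loss : z * (g * d + g) ≤ s
  z-loss = begin
    z * (g * d + g) ≡⟨ cong (z *_) gd+g ⟩
    z * (suc d * g) ≤⟨ *-monoʳ-≤ z (m≤n*m (suc d * g) z) ⟩
    z * (z * (suc d * g)) ≡⟨ solve 3 (λ z d g → z :* (z :* (d :* g)) := z :* z :* d :* g) refl z (suc d) g ⟩
    z * z * suc d * g ≤⟨ loss ⟩
    s ∎

  double-< : ∀ {x y} → 1 ≤ y → 2 * x ≤ y → x < y
  double-< {zero}  y≥1 _ = y≥1
  double-< {suc x} _   h = <-≤-trans (m<m+n (suc x) (s≤s z≤n)) h

  s-large : g * d + g < s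
  s-large = double-< (≤-trans (s≤s z≤n) s≥2) (≤-trans (*-monoˡ-≤ (g * d + g) z≥2) z-loss)

  z-t₁ : z * t₁ ≤ s
  z-t₁ = ≤-trans (*-monoˡ-≤ t₁ (m≤m*n z ℓ)) t₁-bound

  s₁≥1 : 1 ≤ s₁
  s₁≥1 with 1 ≤? s₁
  ... | yes p = p
  ... | no ¬p = ⊥-elim (<⇒≱ (≤-trans (s≤s z≤n) s≥2) (≤-trans s≤vs₁ (≤-trans (*-monoʳ-≤ v (≤-pred (≰⇒> ¬p))) (≤-reflexive (*-zeroʳ v)))))

  -- `z = v ^ 3` leaves the factor `v * v ≥ 2` after one factor `v` is spent on `s≤vs₁`.
  s₁-large : t₁ < s₁
  s₁-large = double-< s₁≥1 (*-cancelˡ-≤ v (begin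
    v * (2 * t₁) ≤⟨ *-monoʳ-≤ v (*-monoˡ-≤ t₁ (≤-trans v≥2 (m≤m*n v v))) ⟩
    v * (v * v * t₁) ≡⟨ solve 2 (λ v t → v :* (v :* v :* t) := v :^ 3 :* t) refl v t₁ ⟩
    z * t₁ ≤⟨ z-t₁ ⟩
    s ≤⟨ s≤vs₁ ⟩
    v * s₁ ∎))

  -- The least number satisfying `K-large`.
  K : ℕ
  K = m + suc (2 * m / z)

  K-large : z * m + 2 * m < z * K
  K-large = begin-strict
    z * m + 2 * m <⟨ +-monoʳ-< (z * m) (m<n*[1+m/n] (2 * m) z) ⟩
    z * m + z * suc (2 * m / z) ≡⟨ sym (*-distribˡ-+ z m _) ⟩
    z * K ∎

  v≤m : v ≤ m
  v≤m = ≤-trans (≤-trans (≤-reflexive (solve 1 (λ v → v := v :^ 1 :* (con 1 :* con 1)) refl v)) (fact₁ 1 0 0)) s≤m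

  K-small : v * K ≤ (v + 3) * m
  K-small = begin
    v * (m + (1 + 2 * m / z)) ≡⟨ solve 3 (λ v m q → v :* (m :+ (con 1 :+ q)) := v :* m :+ (v :+ v :* q)) refl v m (2 * m / z) ⟩
    v * m + (v + v * (2 * m / z)) ≤⟨ +-monoʳ-≤ (v * m) (+-mono-≤ v≤m (≤-trans (*-monoˡ-≤ (2 * m / z) z≥v) (n*[m/n]≤m (2 * m) z))) ⟩
    v * m + (m + 2 * m) ≡⟨ solve 2 (λ v m → v :* m :+ (m :+ con 2 :* m) := (v :+ con 3) :* m) refl v m ⟩
    (v + 3) * m ∎

  -- By `suc-M`, the two sizes of a container add up to less than `m + β + D`; the final 1 makes
  -- this strict, as `balance` demands.
  D : ℕ
  D = suc (4 * m / z) + g * d + t₁ + g + 1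

  module _ (β : ℕ) where

    M₀ : ℕ
    M₀ = m + β + suc (4 * m / z)

    M₀-large : z * (m + β) + 4 * m + z < z * suc M₀
    M₀-large = begin-strict
      z * (m + β) + 4 * m + z <⟨ +-monoˡ-< z (+-monoʳ-< (z * (m + β)) (m<n*[1+m/n] (4 * m) z)) ⟩
      z * (m + β) + z * suc (4 * m / z) + z ≡⟨ solve 3 (λ z x y → z :* x :+ z :* y :+ z := z :* (con 1 :+ (x :+ y))) refl z (m + β) (suc (4 * m / z)) ⟩
      z * suc M₀ ∎

    suc-M : suc (M₀ + g * d + t₁ + g) ≡ m + β + D
    suc-M = solve 5 (λ P q x t g → con 1 :+ (P :+ q :+ x :+ t :+ g) := P :+ (q :+ x :+ t :+ g :+ con 1)) refl (m + β) (suc (4 * m / z)) (g * d) t₁ g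

  D-bound : z * D ≤ 7 * m
  D-bound = begin
    z * D ≡⟨ solve 5 (λ z q x t g → z :* (con 1 :+ q :+ x :+ t :+ g :+ con 1) := z :* q :+ z :* con 2 :+ z :* (x :+ g) :+ z :* t) refl z (4 * m / z) (g * d) t₁ g ⟩
    z * (4 * m / z) + z * 2 + z * (g * d + g) + z * t₁ ≤⟨ +-mono-≤ (+-mono-≤ (+-mono-≤ (n*[m/n]≤m (4 * m) z) 2z≤s) z-loss) z-t₁ ⟩
    4 * m + s + s + s ≤⟨ +-mono-≤ (+-mono-≤ (+-monoʳ-≤ (4 * m) s≤m) s≤m) s≤m ⟩
    4 * m + m + m + m ≡⟨ solve 1 (λ m → con 4 :* m :+ m :+ m :+ m := con 7 :* m) refl m ⟩
    7 * m ∎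
    where
    2z≤s : z * 2 ≤ s
    2z≤s = ≤-trans (*-monoʳ-≤ z v≥2) (≤-trans (≤-reflexive (solve 1 (λ v → v :^ 3 :* v := v :^ 4 :* (con 1 :* con 1)) refl v)) (fact₁ 4 0 0))

  -- `h` is least with `7 * s < z * h`, so that `D-bound` yields the hypothesis of `pr-ratio`; `e`
  -- is least with `s + h < v * e`, which serves `bin-small` at `u = v`.
  h e : ℕ
  h = suc (7 * s / z)
  e = suc ((s + h) / v)

  ratio-bound : ∀ β s′ → s′ ≤ s → s′ * D ≤ h * (m + β)
  ratio-bound β s′ s′≤s = *-cancelˡ-≤ z (begin
    z * (s′ * D) ≡⟨ solve 3 (λ z s D → z :* (s :* D) := s :* (z :* D)) refl z s′ D ⟩
    s′ * (z * D) ≤⟨ *-mono-≤ s′≤s D-bound ⟩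
    s * (7 * m) ≡⟨ solve 2 (λ s m → s :* (con 7 :* m) := con 7 :* s :* m) refl s m ⟩
    7 * s * m ≤⟨ *-mono-≤ (<⇒≤ (m<n*[1+m/n] (7 * s) z)) (m≤m+n m β) ⟩
    z * h * (m + β) ≡⟨ *-assoc z h _ ⟩
    z * (h * (m + β)) ∎)

  e-bound : ∀ s′ → s′ ≤ s → s′ + h ≤ v * e
  e-bound s′ s′≤s = ≤-trans (+-monoˡ-≤ h s′≤s) (<⇒≤ (m<n*[1+m/n] (s + h) v))

  -- The price of lowering `m + β + D` to `m + β`. As `h` is of order `s / v ^ 3`, the exponent is
  -- of order `s / v`.
  binomial-bound : ∀ s′ → s′ ≤ s → bin (s′ + h) s′ ≤ 2 ^ (e + 2 * v * h)
  binomial-bound s′ s′≤s = begin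
    bin (s′ + h) s′ ≤⟨ bin-small v s′ h e (≤-trans (s≤s z≤n) v≥2) (e-bound s′ s′≤s) ⟩
    2 ^ e * (2 * v) ^ h ≤⟨ *-monoʳ-≤ (2 ^ e) (^-monoˡ-≤ h (n≤2^n (2 * v))) ⟩
    2 ^ e * (2 ^ (2 * v)) ^ h ≡⟨ cong (2 ^ e *_) (^-*-assoc 2 (2 * v) h) ⟩
    2 ^ e * 2 ^ (2 * v * h) ≡⟨ sym (^-distribˡ-+-* 2 e (2 * v * h)) ⟩
    2 ^ (e + 2 * v * h) ∎

  -- The three summands are the bits for the sample, the starting vertex and the losses there; for
  -- the `d` steps of the algorithm; and for the two factors bounded by `binomial-bound`. The
  -- constant 146 adds up the bounds `b₁` to `b₈` with their multiplicities.
  exponent k : ℕ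
  exponent = 2 * ℓ * (t₁ + t₂ + 1 + g) + (2 * ℓ + 4 * L * g) * d + 2 * (e + 2 * v * h)
  k = 146 * s / v

  exponent≤k : exponent ≤ k
  exponent≤k = ≤-/ v (begin
    v * exponent
      ≡⟨ solve 9 (λ v l t₁ t₂ g L e h d → v :* (con 2 :* l :* (t₁ :+ t₂ :+ con 1 :+ g) :+ (con 2 :* l :+ con 4 :* L :* g) :* d :+ con 2 :* (e :+ con 2 :* v :* h)) :=
           con 2 :* (v :* l :* t₁) :+ con 2 :* (v :* l :* t₂) :+ con 2 :* (v :* l) :+ con 2 :* (v :* l :* g) :+ con 2 :* (v :* l :* d) :+ con 4 :* (v :* L :* d :* g) :+ con 2 :* (v :* e) :+ con 4 :* (v :* v :* h)) refl v ℓ t₁ t₂ g L e h d ⟩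
    2 * (v * ℓ * t₁) + 2 * (v * ℓ * t₂) + 2 * (v * ℓ) + 2 * (v * ℓ * g) + 2 * (v * ℓ * d) + 4 * (v * L * d * g) + 2 * (v * e) + 4 * (v * v * h)
      ≤⟨ +-mono-≤ (+-mono-≤ (+-mono-≤ (+-mono-≤ (+-mono-≤ (+-mono-≤ (+-mono-≤ (*-monoʳ-≤ 2 b₁) (*-monoʳ-≤ 2 b₂)) (*-monoʳ-≤ 2 b₃)) (*-monoʳ-≤ 2 b₄)) (*-monoʳ-≤ 2 b₅)) (*-monoʳ-≤ 4 b₆)) (*-monoʳ-≤ 2 b₇)) (*-monoʳ-≤ 4 b₈) ⟩
    2 * s + 2 * (8 * s) + 2 * s + 2 * s + 2 * (12 * s) + 4 * (12 * s) + 2 * (10 * s) + 4 * (8 * s)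
      ≡⟨ solve 1 (λ s → con 2 :* s :+ con 2 :* (con 8 :* s) :+ con 2 :* s :+ con 2 :* s :+ con 2 :* (con 12 :* s) :+ con 4 :* (con 12 :* s) :+ con 2 :* (con 10 :* s) :+ con 4 :* (con 8 :* s) := con 146 :* s) refl s ⟩
    146 * s ∎)
    where
    b₁ : v * ℓ * t₁ ≤ s
    b₁ = ≤-trans (*-monoˡ-≤ t₁ (*-monoˡ-≤ ℓ z≥v)) t₁-bound
    b₂ : v * ℓ * t₂ ≤ 8 * s
    b₂ = begin
      v * ℓ * (suc p * (4 * L)) ≡⟨ solve 4 (λ v l p L → v :* l :* ((con 1 :+ p) :* (con 4 :* L)) := con 4 :* (v :* L :* l :+ (v :* L :* l) :* p)) refl v ℓ p L ⟩
      4 * (τ + τ * p) ≤⟨ *-monoʳ-≤ 4 (+-mono-≤ τ≤s (n*[m/n]≤m s τ)) ⟩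
      4 * (s + s) ≡⟨ solve 1 (λ s → con 4 :* (s :+ s) := con 8 :* s) refl s ⟩
      8 * s ∎
    b₃ : v * ℓ ≤ s
    b₃ = ≤-trans (≤-reflexive (solve 2 (λ v l → v :* l := v :^ 1 :* (con 1 :* l :^ 1)) refl v ℓ)) (fact₁ 1 0 1)
    b₄ : v * ℓ * g ≤ s
    b₄ = g-bound (v * ℓ) (≤-trans (≤-reflexive (solve 4 (λ v m L l → v :* l :* (m :* (v :* L :* l) :* v :^ 3 :* l) := v :^ 5 :* (m :* (L :^ 1 :* l :^ 3))) refl v m L ℓ)) (fact₂ 5 1 3))
    b₅ : v * ℓ * d ≤ 12 * s
    b₅ = ≤-trans (≤-reflexive (solve 2 (λ v l → v :* l :* (con 2 :* (v :^ 3 :* v :^ 3) :* (con 6 :* l)) := con 12 :* (v :^ 7 :* (con 1 :* l :^ 2))) refl v ℓ)) (*-monoʳ-≤ 12 (fact₁ 7 0 2))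
    b₆ : v * L * d * g ≤ 12 * s
    b₆ = begin
      v * L * d * g ≡⟨ solve 5 (λ v L z l g → v :* L :* (con 2 :* (z :* z) :* (con 6 :* l)) :* g := con 12 :* (v :* L :* (z :* z) :* l :* g)) refl v L z ℓ g ⟩
      12 * (v * L * (z * z) * ℓ * g) ≤⟨ *-monoʳ-≤ 12 (g-bound (v * L * (z * z) * ℓ) (≤-trans (≤-reflexive
        (solve 4 (λ v m L l → v :* L :* (v :^ 3 :* v :^ 3) :* l :* (m :* (v :* L :* l) :* v :^ 3 :* l) := v :^ 11 :* (m :* (L :^ 2 :* l :^ 3))) refl v m L ℓ)) (fact₂ 11 2 3))) ⟩
      12 * s ∎
    z≤s : z ≤ s
    z≤s = ≤-trans (≤-reflexive (solve 1 (λ v → v :^ 3 := v :^ 3 :* (con 1 :* con 1)) refl v)) (fact₁ 3 0 0)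
    zh : z * h ≤ 8 * s
    zh = begin
      z * (1 + 7 * s / z) ≡⟨ *-suc z (7 * s / z) ⟩
      z + z * (7 * s / z) ≤⟨ +-mono-≤ z≤s (n*[m/n]≤m (7 * s) z) ⟩
      s + 7 * s ≡⟨⟩
      8 * s ∎
    b₇ : v * e ≤ 10 * s
    b₇ = begin
      v * (1 + (s + h) / v) ≡⟨ *-suc v ((s + h) / v) ⟩
      v + v * ((s + h) / v) ≤⟨ +-mono-≤ (≤-trans z≥v z≤s) (n*[m/n]≤m (s + h) v) ⟩
      s + (s + h) ≤⟨ +-monoʳ-≤ s (+-monoʳ-≤ s (≤-trans (m≤n*m h z) zh)) ⟩
      s + (s + 8 * s) ≡⟨⟩
      10 * s ∎
    b₈ : v * v * h ≤ 8 * s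
    b₈ = ≤-trans (*-monoˡ-≤ h (≤-trans (m≤n*m (v * v) v) (≤-reflexive (solve 1 (λ v → v :* (v :* v) := v :^ 3) refl v)))) zh

  container-count : suc n ^ t₁ * (suc n ^ t₂ * (n * (suc n ^ g * (suc n * suc m ^ g) ^ d))) * (bin (s₁ + h) s₁ * bin (s + h) s) ≤ 2 ^ k
  container-count = begin
    suc n ^ t₁ * (suc n ^ t₂ * (n * (suc n ^ g * (suc n * suc m ^ g) ^ d))) * (bin (s₁ + h) s₁ * bin (s + h) s)
      ≤⟨ *-mono-≤ (*-mono-≤ (power t₁) (*-mono-≤ (power t₂) (*-mono-≤ (≤-trans (n≤1+n n) (≤-trans n-log (≤-reflexive (cong (2 ^_) (sym (*-identityʳ (2 * ℓ))))))) (*-mono-≤ (power g) tree))))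
                  (*-mono-≤ (binomial-bound s₁ s₁≤s) (binomial-bound s ≤-refl)) ⟩
    2 ^ (2 * ℓ * t₁) * (2 ^ (2 * ℓ * t₂) * (2 ^ (2 * ℓ * 1) * (2 ^ (2 * ℓ * g) * 2 ^ ((2 * ℓ + 4 * L * g) * d)))) * (2 ^ (e + 2 * v * h) * 2 ^ (e + 2 * v * h))
      ≡⟨ collapse ⟩
    2 ^ exponent
      ≤⟨ ^-monoʳ-≤ 2 exponent≤k ⟩
    2 ^ k ∎
    where
    power : ∀ t → suc n ^ t ≤ 2 ^ (2 * ℓ * t)
    power t = ≤-trans (^-monoˡ-≤ t n-log) (≤-reflexive (^-*-assoc 2 (2 * ℓ) t))
    tree : (suc n * suc m ^ g) ^ d ≤ 2 ^ ((2 * ℓ + 4 * L * g) * d)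
    tree = ≤-trans (^-monoˡ-≤ d (≤-trans (*-mono-≤ n-log (≤-trans (^-monoˡ-≤ g m-log) (≤-reflexive (^-*-assoc 2 (4 * L) g))))
                                          (≤-reflexive (sym (^-distribˡ-+-* 2 (2 * ℓ) (4 * L * g))))))
                   (≤-reflexive (^-*-assoc 2 (2 * ℓ + 4 * L * g) d))
    add-exponents : ∀ a b → 2 ^ a * 2 ^ b ≡ 2 ^ (a + b)
    add-exponents a b = sym (^-distribˡ-+-* 2 a b)
    merge : ∀ a b c x y w → 2 ^ a * (2 ^ b * (2 ^ c * (2 ^ x * 2 ^ y))) * (2 ^ w * 2 ^ w) ≡ 2 ^ (a + (b + (c + (x + y))) + (w + w))
    merge a b c x y w
      rewrite add-exponents x y | add-exponents c (x + y) | add-exponents b (c + (x + y)) | add-exponents a (b + (c + (x + y))) | add-exponents w w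
      = add-exponents (a + (b + (c + (x + y)))) (w + w)
    collapse : 2 ^ (2 * ℓ * t₁) * (2 ^ (2 * ℓ * t₂) * (2 ^ (2 * ℓ * 1) * (2 ^ (2 * ℓ * g) * 2 ^ ((2 * ℓ + 4 * L * g) * d)))) * (2 ^ (e + 2 * v * h) * 2 ^ (e + 2 * v * h)) ≡ 2 ^ exponent
    collapse = trans (merge (2 * ℓ * t₁) (2 * ℓ * t₂) (2 * ℓ * 1) (2 * ℓ * g) ((2 * ℓ + 4 * L * g) * d) (e + 2 * v * h))
      (cong (2 ^_) (solve 6 (λ l t₁ t₂ g y x → l :* t₁ :+ (l :* t₂ :+ (l :* con 1 :+ (l :* g :+ y))) :+ (x :+ x) := l :* (t₁ :+ t₂ :+ con 1 :+ g) :+ y :+ con 2 :* x) refl (2 * ℓ) t₁ t₂ g ((2 * ℓ + 4 * L * g) * d) (e + 2 * v * h)))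

-- Counting

unique-lookup : ∀ {a} {A : Set a} {xs : List A} → Unique xs → ∀ i j → lookup xs i ≡ lookup xs j → i ≡ j
unique-lookup {xs = _ ∷ _} (_  ∷ _)  zero    zero    _  = refl
unique-lookup {xs = _ ∷ xs} (x∉ ∷ _)  zero    (suc j) eq = ⊥-elim (All.lookup x∉ (∈-lookup {xs = xs} j) eq)
unique-lookup {xs = _ ∷ xs} (x∉ ∷ _)  (suc i) zero    eq = ⊥-elim (All.lookup x∉ (∈-lookup {xs = xs} i) (sym eq))
unique-lookup {xs = _ ∷ _} (_  ∷ un) (suc i) (suc j) eq = cong suc (unique-lookup un i j eq)

unique-length : ∀ {a} {A : Set a} {xs ys : List A} → Unique xs → (∀ {x} → x ∈ xs → x ∈ ys) → length xs ≤ length ys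
unique-length {xs = xs} {ys} un sub = Finₚ.injective⇒≤ {f = position} λ {i} {j} eq →
  unique-lookup un i j (trans (Anyₚ.lookup-index (sub (∈-lookup i))) (trans (cong (lookup ys) eq) (sym (Anyₚ.lookup-index (sub (∈-lookup j))))))
  where
  position : Fin (length xs) → Fin (length ys)
  position i = Any.index (sub (∈-lookup i))

module _ {n : ℕ} (s₁ s₂ : ℕ) where

  subset-pairs : FinSet n × FinSet n → List (Subset n × Subset n)
  subset-pairs (A , B) = concatMap (λ X → map (X ,_) (subsets B s₂)) (subsets A s₁)

  length-subset-pairs : ∀ A B → length (subset-pairs (A , B)) ≡ bin (card A) s₁ * bin (card B) s₂
  length-subset-pairs A B = begin
    length (subset-pairs (A , B))
      ≡⟨ length-concatMap (λ X → map (X ,_) (subsets B s₂)) (subsets A s₁) ⟩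
    ∑ (subsets A s₁) (λ X → length (map (X ,_) (subsets B s₂)))
      ≡⟨ ∑-cong (subsets A s₁) (λ X → trans (length-map (X ,_) (subsets B s₂)) (length-subsets B s₂)) ⟩
    ∑ (subsets A s₁) (λ _ → bin (card B) s₂)
      ≡⟨ trans (∑-const (subsets A s₁) _) (cong (_* bin (card B) s₂) (length-subsets A s₁)) ⟩
    bin (card A) s₁ * bin (card B) s₂ ∎
    where open ≡-Reasoning

  count-covered : (Λ : List (FinSet n × FinSet n)) (L : List (Subset n × Subset n)) → Unique L →
    (∀ {X₁ X₂} → (X₁ , X₂) ∈ L → ∣ X₁ ∣ ≡ s₁ × ∣ X₂ ∣ ≡ s₂ ×
       Any (λ p → Vec.lookup X₁ ⊆ proj₁ p × Vec.lookup X₂ ⊆ proj₂ p) Λ) →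
    length L ≤ ∑ Λ (λ p → bin (card (proj₁ p)) s₁ * bin (card (proj₂ p)) s₂)
  count-covered Λ L un h = ≤-trans (unique-length un inside)
    (≤-reflexive (trans (length-concatMap subset-pairs Λ) (∑-cong Λ (λ p → length-subset-pairs (proj₁ p) (proj₂ p)))))
    where
    inside : ∀ {p} → p ∈ L → p ∈ concatMap subset-pairs Λ
    inside {X₁ , X₂} p∈ with h p∈
    ... | refl , refl , cov = ∈-concatMap⁺ subset-pairs (Any.map (λ {q} c → pair q c) cov)
      where
      pair : ∀ q → Vec.lookup X₁ ⊆ proj₁ q × Vec.lookup X₂ ⊆ proj₂ q → (X₁ , X₂) ∈ subset-pairs q
      pair (A , B) (⊆A , ⊆B) = ∈-concatMap⁺ (λ X → map (X ,_) (subsets B ∣ X₂ ∣))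
        (lose (∈-subsets A X₁ ⊆A) (∈-map⁺ (X₁ ,_) (∈-subsets B X₂ ⊆B)))

-- After balancing, both parts are within their shares of `P + D`, so each binomial coefficient is
-- at most the generalised one at its share; `pr-ratio` lowers `P + D` to `P`.
product-bound : ∀ s₁ s₂ P D h a₁ a₂ → a₁ + a₂ < P + D → s₁ + s₂ ≤ P → s₁ * D ≤ h * P → s₂ * D ≤ h * P →
  bin a₁ s₁ * bin a₂ s₂ * ((s₁ ! * (s₁ + s₂) ^ s₁) * (s₂ ! * (s₁ + s₂) ^ s₂)) ≤
    (bin (s₁ + h) s₁ * bin (s₂ + h) s₂) * (pr (s₁ * P) (s₁ + s₂) s₁ * pr (s₂ * P) (s₁ + s₂) s₂)
product-bound s₁ s₂ P D h a₁ a₂ a<N S≤P h₁ h₂ with balance s₁ s₂ (P + D) a₁ a₂ a<N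
... | b₁ , b₂ , (bal₁ , bal₂) , le = begin
  bin a₁ s₁ * bin a₂ s₂ * (f₁ * f₂)
    ≤⟨ *-monoˡ-≤ (f₁ * f₂) le ⟩
  bin b₁ s₁ * bin b₂ s₂ * (f₁ * f₂)
    ≡⟨ *-interchange (bin b₁ s₁) (bin b₂ s₂) f₁ f₂ ⟩
  (bin b₁ s₁ * f₁) * (bin b₂ s₂ * f₂)
    ≤⟨ *-mono-≤ (≤-trans (pr-scale bal₁ s₁) (pr-ratio {s₁} {S} {P} {D} {h} S≤P h₁)) (≤-trans (pr-scale bal₂ s₂) (pr-ratio {s₂} {S} {P} {D} {h} S≤P h₂)) ⟩
  (pr (s₁ * P) S s₁ * bin (s₁ + h) s₁) * (pr (s₂ * P) S s₂ * bin (s₂ + h) s₂)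
    ≡⟨ trans (*-interchange (pr (s₁ * P) S s₁) _ _ _) (*-comm (pr (s₁ * P) S s₁ * pr (s₂ * P) S s₂) _) ⟩
  (bin (s₁ + h) s₁ * bin (s₂ + h) s₂) * (pr (s₁ * P) S s₁ * pr (s₂ * P) S s₂) ∎
  where
  open ≤-Reasoning
  S f₁ f₂ : ℕ
  S  = s₁ + s₂
  f₁ = s₁ ! * S ^ s₁
  f₂ = s₂ ! * S ^ s₂

log-positive : ∀ n → 2 ≤ n → 1 ≤ ⌊log₂ n ⌋
log-positive n n≥2 = ≤-trans (≤-reflexive (sym (⌊log₂[2^n]⌋≡n 1))) (⌊log₂⌋-mono-≤ n≥2)

-- With `l` the rounded logarithm, `suc n ≤ 2 ^ (l + 1)`, and `l ≥ 1` absorbs the added 1 into the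
-- factor 2.
log-upper : ∀ n → 2 ≤ n → suc n ≤ 2 ^ (2 * ⌊log₂ n ⌋)
log-upper n n≥2 = ≤-trans below (^-monoʳ-≤ 2 (≤-trans (≤-reflexive (+-comm 1 l)) (≤-trans (+-monoʳ-≤ l (log-positive n n≥2)) (≤-reflexive (cong (λ k → l + k) (sym (+-identityʳ l)))))))
  where
  l : ℕ
  l = ⌊log₂ n ⌋
  below : suc n ≤ 2 ^ suc l
  below with 2 ^ suc l ≤? n
  ... | no ¬p = ≰⇒> ¬p
  ... | yes p = ⊥-elim (<⇒≱ (n<1+n l) (≤-trans (≤-reflexive (sym (⌊log₂[2^n]⌋≡n (suc l)))) (⌊log₂⌋-mono-≤ p)))

-- v measures how far the hypotheses m = o(…) and s₁ = Ω(s₂) are satisfied at a given n.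
Admissible : (n s₁ s₂ m v : ℕ) → Set
Admissible n s₁ s₂ m v = 2 ≤ v × s₂ ≤ v * s₁ × v ^ 20 * (m * (⌊log₂ s₂ ⌋ ^ 4 * ⌊log₂ n ⌋ ^ 3)) ≤ s₂ ^ 2

module Finite (n s₁ s₂ m v : ℕ) (s₂≥2 : 2 ≤ s₂) (s₁≤s₂ : s₁ ≤ s₂) (s₂≤n : s₂ ≤ n) (S≤m : s₁ + s₂ ≤ m)
              (adm : Admissible n s₁ s₂ m v) where

  L ℓ : ℕ
  L = ⌊log₂ s₂ ⌋
  ℓ = ⌊log₂ n ⌋

  L≥1 : 1 ≤ L
  L≥1 = log-positive s₂ s₂≥2

  L≤ℓ : L ≤ ℓ
  L≤ℓ = ⌊log₂⌋-mono-≤ s₂≤n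

  m≤s₂² : m ≤ s₂ ^ 2
  m≤s₂² = ≤-trans (≤-trans (m≤m*n m (L ^ 4 * ℓ ^ 3) ⦃ m*n≢0 (L ^ 4) (ℓ ^ 3) ⦃ m^n≢0 L 4 ⦃ >-nonZero L≥1 ⦄ ⦄ ⦃ m^n≢0 ℓ 3 ⦃ >-nonZero (≤-trans L≥1 L≤ℓ) ⦄ ⦄ ⦄)
                                (m≤n*m (m * (L ^ 4 * ℓ ^ 3)) (v ^ 20) ⦃ m^n≢0 v 20 ⦃ >-nonZero (≤-trans (s≤s z≤n) (proj₁ adm)) ⦄ ⦄))
                       (proj₂ (proj₂ adm))

  -- `m ≤ s₂ ^ 2` makes `log m` of order `log s₂`; hence `4 * L` bits suffice for a loss chosen
  -- among `m` indices.
  m-log : suc m ≤ 2 ^ (4 * L)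
  m-log = begin
    suc m ≤⟨ s≤s m≤s₂² ⟩
    suc (s₂ ^ 2) ≤⟨ s≤s (m≤m+n (s₂ ^ 2) (2 * s₂)) ⟩
    suc (s₂ ^ 2 + 2 * s₂) ≡⟨ solve 1 (λ s → con 1 :+ (s :^ 2 :+ con 2 :* s) := (con 1 :+ s) :* (con 1 :+ s)) refl s₂ ⟩
    suc s₂ * suc s₂ ≤⟨ *-mono-≤ (log-upper s₂ s₂≥2) (log-upper s₂ s₂≥2) ⟩
    2 ^ (2 * L) * 2 ^ (2 * L) ≡⟨ sym (^-distribˡ-+-* 2 (2 * L) (2 * L)) ⟩
    2 ^ (2 * L + 2 * L) ≡⟨ cong (2 ^_) (sym (*-distribʳ-+ L 2 2)) ⟩
    2 ^ (4 * L) ∎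
    where open ≤-Reasoning

  open Numerics n s₁ s₂ m v L ℓ (proj₁ adm) s₂≥2 s₁≤s₂ S≤m (proj₁ (proj₂ adm)) L≥1 L≤ℓ
                (log-upper n (≤-trans s₂≥2 s₂≤n)) m-log (proj₂ (proj₂ adm)) public

  module _ {c ℓ′} (G : AbelianGroup c ℓ′) (_≟_ : ∀ x y → Dec (AbelianGroup._≈_ G x y))
           (F₁ F₂ : Fin n → AbelianGroup.Carrier G) (injective₁ : InjectiveEnum G F₁) (injective₂ : InjectiveEnum G F₂)
           (β : ℕ) (bound : ∀ j → HasSubgroupOfSize G j → j ≤ K → j ≤ β) where
    open Sumsets G _≟_ F₁ F₂ injective₁ injective₂

    parameters : Parameters m K β
    parameters = record
      { z = z ; r₁ = r₁ ; M₀ = M₀ β ; g = g ; d = d ; p = p ; τ = τ ; t₁ = t₁ ; t₂ = t₂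
      ; r≡ = r≡ ; z≥2 = z≥2 ; K-large = K-large ; M₀-large = M₀-large β
      ; depth = depth ; t₁-large = t₁-large ; t₂-large = t₂-large }

    open Assembly m K β bound parameters using (containers; length-containers; small-containers; cover; M; Small)

    Coloured : Subset n × Subset n → Set ℓ′
    Coloured (X₁ , X₂) = ∣ X₁ ∣ ≡ s₁ × ∣ X₂ ∣ ≡ s₂ × ∃ λ (κ : Fin n → Fin n → Fin m) → Colouring (Vec.lookup X₁) (Vec.lookup X₂) κ

    finite-bound : (Ls : List (Subset n × Subset n)) → Unique Ls → All Coloured Ls →
      ℕtoℚ (length Ls) ℚ.≤ pairBound (2 ^ k) s₁ s₂ (m + β)
    finite-bound Ls un good = genBin-bound s₁ s₂ (m + β) (2 ^ k) (length Ls)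
      (≤-trans (≤-trans (s≤s z≤n) s₂≥2) (m≤n+m s₂ s₁)) S≤P (begin
        length Ls * F
          ≤⟨ *-monoˡ-≤ F (count-covered s₁ s₂ containers Ls un covered) ⟩
        ∑ containers weight * F
          ≡⟨ sym (∑-*ʳ containers F weight) ⟩
        ∑ containers (λ q → weight q * F)
          ≤⟨ ∑-mono∈ containers (λ q q∈ → weight-bound q (All.lookup small-containers q∈)) ⟩
        ∑ containers (λ _ → B * W)
          ≡⟨ ∑-const containers (B * W) ⟩
        length containers * (B * W)
          ≡⟨ sym (*-assoc (length containers) B W) ⟩
        length containers * B * W
          ≤⟨ *-monoˡ-≤ W (≤-trans (*-monoˡ-≤ B length-containers) container-count) ⟩
        2 ^ k * W ∎)
      where
      open ≤-Reasoning
      S≤P : s₁ + s₂ ≤ m + β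
      S≤P = ≤-trans S≤m (m≤m+n m β)
      F B W : ℕ
      F = (s₁ ! * (s₁ + s₂) ^ s₁) * (s₂ ! * (s₁ + s₂) ^ s₂)
      B = bin (s₁ + h) s₁ * bin (s₂ + h) s₂
      W = pr (s₁ * (m + β)) (s₁ + s₂) s₁ * pr (s₂ * (m + β)) (s₁ + s₂) s₂
      weight : FinSet n × FinSet n → ℕ
      weight q = bin (card (proj₁ q)) s₁ * bin (card (proj₂ q)) s₂
      weight-bound : ∀ q → Small q → weight q * F ≤ B * W
      weight-bound (A₁ , A₂) sm = product-bound s₁ s₂ (m + β) D h (card A₁) (card A₂)
        (≤-trans (s≤s sm) (≤-reflexive (suc-M β))) S≤P (ratio-bound β s₁ s₁≤s₂) (ratio-bound β s₂ ≤-refl)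
      covered : ∀ {X₁ X₂} → (X₁ , X₂) ∈ Ls → ∣ X₁ ∣ ≡ s₁ × ∣ X₂ ∣ ≡ s₂ ×
                Any (λ q → Vec.lookup X₁ ⊆ proj₁ q × Vec.lookup X₂ ⊆ proj₂ q) containers
      covered {X₁} {X₂} X∈ with All.lookup good X∈
      ... | eq₁ , eq₂ , κ , colouring = eq₁ , eq₂ , cover (Vec.lookup X₁) (Vec.lookup X₂) κ colouring
        (≤-trans s₁-large (≤-reflexive (sym (trans (card-lookup X₁) eq₁))))
        (≤-trans s-large (≤-reflexive (sym (trans (card-lookup X₂) eq₂))))
        (≤-trans (≤-reflexive (trans (card-lookup X₂) eq₂)) s≤[1+p]τ)

-- Asymptotics

admissible? : ∀ n s₁ s₂ m v → Dec (Admissible n s₁ s₂ m v)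
admissible? n s₁ s₂ m v =
  (2 ≤? v) ×-dec ((s₂ ≤? v * s₁) ×-dec (v ^ 20 * (m * (⌊log₂ s₂ ⌋ ^ 4 * ⌊log₂ n ⌋ ^ 3)) ≤? s₂ ^ 2))

module _ {p} {P : ℕ → Set p} (P? : ∀ v → Dec (P v)) where

  -- 0 if no v ≤ b satisfies P.
  greatest : ℕ → ℕ
  greatest zero    = 0
  greatest (suc b) with P? (suc b)
  ... | yes _ = suc b
  ... | no _  = greatest b

  greatest-satisfies : ∀ b {v} → greatest b ≡ suc v → P (suc v)
  greatest-satisfies (suc b) eq with P? (suc b)
  greatest-satisfies (suc b) refl | yes q = q
  ... | no _ = greatest-satisfies b eq

  greatest-maximal : ∀ b {v} → v ≤ b → P v → v ≤ greatest b
  greatest-maximal zero    v≤b q = v≤b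
  greatest-maximal (suc b) {v} v≤b q with P? (suc b)
  ... | yes _ = v≤b
  ... | no ¬q with m≤n⇒m<n∨m≡n v≤b
  ...   | inj₁ v<  = greatest-maximal b (≤-pred v<) q
  ...   | inj₂ refl = ⊥-elim (¬q q)

exponentFor : ℕ → ℕ → ℕ
exponentFor s zero    = 0
exponentFor s (suc v) = 146 * s / suc v

-- The value −1 makes the bound on the subgroups vacuous where no v is admissible.
slackFor : ℕ → ℚ
slackFor zero    = ℚ.- ℚ.1ℚ
slackFor (suc v) = ratio 3 (suc v)

exponentFor-small : ∀ s v j → 146 * j < v → j * exponentFor s v ≤ s
exponentFor-small s (suc v) j h = *-cancelˡ-≤ (suc v) (begin
  suc v * (j * (146 * s / suc v)) ≡⟨ *-rotate (suc v) j _ ⟩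
  j * (suc v * (146 * s / suc v)) ≤⟨ *-monoʳ-≤ j (n*[m/n]≤m (146 * s) (suc v)) ⟩
  j * (146 * s) ≡⟨ shift j s ⟩
  146 * j * s ≤⟨ *-monoˡ-≤ s (<⇒≤ h) ⟩
  suc v * s ∎)
  where
  open ≤-Reasoning
  shift : ∀ j s → j * (146 * s) ≡ 146 * j * s
  shift = solve 2 (λ j s → j :* (con 146 :* s) := con 146 :* j :* s) refl

slackFor-small : ∀ v j → 3 * suc j ≤ v → ℚ.∣ slackFor v ∣ ℚ.≤ ((ℤ.+ 1) ℚ./ suc j)
slackFor-small (suc v) j h = subst (ℚ._≤ ((ℤ.+ 1) ℚ./ suc j)) (sym (ℚₚ.0≤p⇒∣p∣≡p nonneg)) upper
  where
  compare : ∀ a b c d → a * suc d ≤ c * suc b → ((ℤ.+ a) ℚ./ suc b) ℚ.≤ ((ℤ.+ c) ℚ./ suc d)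
  compare a b c d p = ℚₚ.toℚᵘ-cancel-≤ (ℚᵘₚ.≤-respˡ-≃ (ℚᵘₚ.≃-sym (ℚₚ.toℚᵘ-fromℚᵘ (mkℚᵘ (ℤ.+ a) b)))
    (ℚᵘₚ.≤-respʳ-≃ (ℚᵘₚ.≃-sym (ℚₚ.toℚᵘ-fromℚᵘ (mkℚᵘ (ℤ.+ c) d)))
      (*≤* (subst₂ ℤ._≤_ (ℤₚ.pos-* a (suc d)) (ℤₚ.pos-* c (suc b)) (ℤ.+≤+ p)))))
  nonneg : ℚ.0ℚ ℚ.≤ ((ℤ.+ 3) ℚ./ suc v)
  nonneg = compare 0 0 3 v z≤n
  upper : ((ℤ.+ 3) ℚ./ suc v) ℚ.≤ ((ℤ.+ 1) ℚ./ suc j)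
  upper = compare 3 v 1 j (≤-trans h (≤-reflexive (sym (+-identityʳ (suc v)))))

-- The threshold is 0, whereas a subgroup contains the identity.
no-beta : ∀ {c ℓ} (G : AbelianGroup c ℓ) m b → ¬ IsBeta G ((ℚ.1ℚ ℚ.+ ℚ.- ℚ.1ℚ) ℚ.* ℕtoℚ m) b
no-beta G m zero    (((_ , _ , (() , _) , _) , _) , _)
no-beta G m (suc b) ((_ , b≤) , _) = ℚₚ.<-irrefl refl (ℚₚ.<-≤-trans (ℚₚ.positive⁻¹ (ℕtoℚ (suc b)) ⦃ ℕtoℚ-pos (suc b) ⦄)
  (ℚₚ.≤-trans b≤ (ℚₚ.≤-reflexive (ℚₚ.*-zeroˡ (ℕtoℚ m)))))

-- The bound for an arbitrary abelian group at a fixed `n`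

module _ {c ℓ} (G : AbelianGroup c ℓ) {n : ℕ} (F₁ F₂ : Fin n → AbelianGroup.Carrier G)
         (injective₁ : InjectiveEnum G F₁) (injective₂ : InjectiveEnum G F₂) where
  open AbelianGroup G using (Carrier; _≈_; _∙_) renaming (sym to ≈-sym; trans to ≈-trans; reflexive to ≈-reflexive)
  open Generated G

  gens : List Carrier
  gens = tabulate F₁ ++ tabulate F₂

  F₁′ F₂′ : Fin n → Σ Carrier (Gen gens)
  F₁′ i = F₁ i , gen-∈ (∈-++⁺ˡ (∈-tabulate⁺ {f = F₁} i))
  F₂′ i = F₂ i , gen-∈ (∈-++⁺ʳ (tabulate F₁) (∈-tabulate⁺ {f = F₂} i))

  -- The covering of the sumset names no element outside `X₁` and `X₂`; `default` fills the gap
  -- there, where no equation is claimed.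
  colour : ∀ {m} (X₁ X₂ : Subset n) → Fin m → SumsetAtMost G F₁ F₂ X₁ X₂ m →
           ∃ λ (κ : Fin n → Fin n → Fin m) → ∀ {x u x′ u′} →
             Vec.lookup X₁ x ≡ true → Vec.lookup X₂ u ≡ true → Vec.lookup X₁ x′ ≡ true → Vec.lookup X₂ u′ ≡ true →
             κ x u ≡ κ x′ u′ → F₁ x ∙ F₂ u ≈ F₁ x′ ∙ F₂ u′
  colour {m} X₁ X₂ default (w , sums) = κ , λ Xx Xu Xx′ Xu′ eq →
    ≈-trans (κ-sum Xx Xu) (≈-trans (≈-reflexive (cong w eq)) (≈-sym (κ-sum Xx′ Xu′)))
    where
    κ : Fin n → Fin n → Fin m
    κ x u with Vec.lookup X₁ x Bool.≟ true | Vec.lookup X₂ u Bool.≟ true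
    ... | yes Xx | yes Xu = proj₁ (sums x u (lookup⇒[]= x X₁ Xx) (lookup⇒[]= u X₂ Xu))
    ... | yes _  | no _   = default
    ... | no _   | _      = default
    κ-sum : ∀ {x u} → Vec.lookup X₁ x ≡ true → Vec.lookup X₂ u ≡ true → F₁ x ∙ F₂ u ≈ w (κ x u)
    κ-sum {x} {u} Xx Xu with Vec.lookup X₁ x Bool.≟ true | Vec.lookup X₂ u Bool.≟ true
    ... | yes p | yes q = proj₂ (sums x u (lookup⇒[]= x X₁ p) (lookup⇒[]= u X₂ q))
    ... | yes _ | no ¬q = ⊥-elim (¬q Xu)
    ... | no ¬p | _     = ⊥-elim (¬p Xx)

  module _ (s₁ s₂ m v : ℕ) (s₂≥2 : 2 ≤ s₂) (s₁≤s₂ : s₁ ≤ s₂) (s₂≤n : s₂ ≤ n) (S≤m : s₁ + s₂ ≤ m)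
           (adm : Admissible n s₁ s₂ m (suc v)) (b : ℕ) (β : IsBeta G ((ℚ.1ℚ ℚ.+ slackFor (suc v)) ℚ.* ℕtoℚ m) b) where
    module Bounds = Finite n s₁ s₂ m (suc v) s₂≥2 s₁≤s₂ s₂≤n S≤m adm

    first-colour : Fin m
    first-colour = Fin.fromℕ< Bounds.m≥1

    -- Equality in G need not be decidable, but the claim is a decidable inequality, hence stable.
    count : CountAtMost (GoodPair G F₁ F₂ s₁ s₂ m) (pairBound (2 ^ exponentFor s₂ (suc v)) s₁ s₂ (m + b))
    count Ls unique good = decidable-stable (_ ℚₚ.≤? _) λ ¬goal → ¬¬-decidable gens λ dec → ¬goal
      (Bounds.finite-bound (generated gens) dec F₁′ F₂′ injective₁ injective₂ b
        (λ j sub j≤K → proj₂ β j (generated-subgroup gens j sub) (slack-bound v m j Bounds.K j≤K Bounds.K-small))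
        Ls unique (All.map (λ { {X₁ , X₂} (eq₁ , eq₂ , sums) → eq₁ , eq₂ , colour X₁ X₂ first-colour sums }) good))

theorem1p2 : ∀ {c ℓ} (G : AbelianGroup c ℓ) (s₁ s₂ m : ℕ → ℕ) (N₀ : ℕ) →
    (∀ n → N₀ ≤ n → 2 ≤ s₂ n × s₁ n ≤ s₂ n × s₂ n ≤ n × s₁ n + s₂ n ≤ m n) →
    IsBigOmega s₁ s₂ →
    IsLittleO (λ n → m n * (⌊log₂ s₂ n ⌋ ^ 4 * ⌊log₂ n ⌋ ^ 3)) (λ n → s₂ n ^ 2) →
    ∃ λ (k : ℕ → ℕ) → ∃ λ (δ : ℕ → ℚ) →
      IsLittleO k s₂ × TendsToZero δ ×
      (∀ n → N₀ ≤ n →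
        (F₁ F₂ : Fin n → AbelianGroup.Carrier G) →
        InjectiveEnum G F₁ → InjectiveEnum G F₂ →
        (b : ℕ) → IsBeta G ((ℚ.1ℚ ℚ.+ δ n) ℚ.* ℕtoℚ (m n)) b →
        CountAtMost (GoodPair G F₁ F₂ (s₁ n) (s₂ n) (m n))
          (ℕtoℚ (2 ^ k n)
            ℚ.* genBin (ratio (s₁ n) (s₁ n + s₂ n) ℚ.* ℕtoℚ (m n + b)) (s₁ n)
            ℚ.* genBin (ratio (s₂ n) (s₁ n + s₂ n) ℚ.* ℕtoℚ (m n + b)) (s₂ n)))
theorem1p2 G s₁ s₂ m N₀ hyp (C , N₁ , omega) little =
  (λ n → exponentFor (s₂ n) (v n)) , (λ n → slackFor (v n)) ,
  (λ j → proj₁ (eventually (suc (146 * j))) , λ n N≤n → exponentFor-small (s₂ n) (v n) j (proj₂ (eventually (suc (146 * j))) n N≤n)) ,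
  (λ j → proj₁ (eventually (3 * suc j)) , λ n N≤n → slackFor-small (v n) j (proj₂ (eventually (3 * suc j)) n N≤n)) ,
  λ n N₀≤n F₁ F₂ injective₁ injective₂ b β → conclude n N₀≤n F₁ F₂ injective₁ injective₂ b (v n) refl β
  where
  admissible : ∀ n v → Dec (Admissible n (s₁ n) (s₂ n) (m n) v)
  admissible n = admissible? n (s₁ n) (s₂ n) (m n)

  -- The search stops at `n`, which tends to infinity and so does not keep `v n` bounded.
  v : ℕ → ℕ
  v n = greatest (admissible n) n

  -- `W` is at least `V`, at least 2, and at least the constant `C` of the hypothesis on `s₁`; being
  -- fixed, it is admissible for all large `n` by the hypothesis on `m` with factor `W ^ 20`.
  eventually : ∀ V → ∃ λ N → ∀ n → N ≤ n → V ≤ v n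
  eventually V = N₁ ℕ.⊔ (proj₁ (little (W ^ 20)) ℕ.⊔ W) , λ n N≤n → ≤-trans (≤-trans (m≤m+n V C) (m≤m+n (V + C) 2))
    (greatest-maximal (admissible n) n (≤-trans (≤-trans (m≤n⊔m (proj₁ (little (W ^ 20))) W) (m≤n⊔m N₁ _)) N≤n)
      ( m≤n+m 2 (V + C)
      , ≤-trans (omega n (≤-trans (m≤m⊔n N₁ _) N≤n)) (*-monoˡ-≤ (s₁ n) (≤-trans (m≤n+m C V) (m≤m+n (V + C) 2)))
      , proj₂ (little (W ^ 20)) n (≤-trans (≤-trans (m≤m⊔n (proj₁ (little (W ^ 20))) W) (m≤n⊔m N₁ _)) N≤n)))
    where
    W : ℕ
    W = V + C + 2

  conclude : ∀ n → N₀ ≤ n → (F₁ F₂ : Fin n → AbelianGroup.Carrier G) → InjectiveEnum G F₁ → InjectiveEnum G F₂ →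
    ∀ b v′ → v n ≡ v′ → IsBeta G ((ℚ.1ℚ ℚ.+ slackFor v′) ℚ.* ℕtoℚ (m n)) b →
    CountAtMost (GoodPair G F₁ F₂ (s₁ n) (s₂ n) (m n))
      (pairBound (2 ^ exponentFor (s₂ n) v′) (s₁ n) (s₂ n) (m n + b))
  conclude n N₀≤n F₁ F₂ injective₁ injective₂ b zero     eq β = ⊥-elim (no-beta G (m n) b β)
  conclude n N₀≤n F₁ F₂ injective₁ injective₂ b (suc v′) eq β with hyp n N₀≤n
  ... | s₂≥2 , s₁≤s₂ , s₂≤n , S≤m =
    count G F₁ F₂ injective₁ injective₂ (s₁ n) (s₂ n) (m n) v′ s₂≥2 s₁≤s₂ s₂≤n S≤m (greatest-satisfies (admissible n) n eq) b β
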